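{- Let $L$ be a finite language with no relation symbols, and let $A$ be a computable, Hopfian, finitely presented $L$-structure. Then $A$ has a computable $d$-$\Sigma_2$ Scott sentence if and only if the weak Whitehead problem for $A$ is decidable.
   Context: Computable structure: the domain is a computable subset of $\omega$ and the interpretations of the symbols of $L$ are computable. Finitely presented: fix an ambient class $K$ of $L$-structures with $A\in K$ (for example, the class of all groups in the language of groups). $A$ is finitely presented if for some $n$ there are a tuple $\bar a\in A^n$ generating $A$ and a finite conjunction $\psi(\bar x)$ of atomic $L$-formulas (equations between terms), $\bar x=(x_1,\dots,x_n)$, such that $A\models\psi(\bar a)$ and, whenever $B\in K$ and $\bar b\in B^n$ satisfy $B\models\psi(\bar b)$, the map $\bar a\mapsto\bar b$ extends (uniquely) to a homomorphism $A\to B$. In that case one writes $A=\langle\bar a\mid\psi(\bar x)\rangle$. Hopfian: every surjective endomorphism of $A$ is an automorphism of $A$. Decidable weak Whitehead problem: for every finite tuple $\bar a$ generating $A$, of length $n$ say, the set $\{\alpha(\bar a):\alpha\in\mathrm{Aut}(A)\}$ is a computable subset of $A^n$. Infinitary formulas (of $\mathfrak L_{\omega_1,\omega}$; all tuples of variables are finite): computable $\Sigma_0$ = computable $\Pi_0$ = finitary quantifier-free. For a computable ordinal $\alpha>0$, a formula $\varphi(\bar x)$ is computable $\Sigma_\alpha$ if it is a computably enumerable disjunction of formulas $\exists\bar y\,\theta(\bar x,\bar y)$ with each $\theta$ computable $\Pi_\beta$ for some $\beta<\alpha$; it is computable $\Pi_\alpha$ if it is a computably enumerable conjunction of formulas $\forall\bar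 y\,\theta(\bar x,\bar y)$ with each $\theta$ computable $\Sigma_\beta$ for some $\beta<\alpha$. A computable $d$-$\Sigma_2$ formula is the conjunction of a computable $\Sigma_2$ formula and a computable $\Pi_2$ formula. A Scott sentence for a countable structure $A$ is a sentence of $\mathfrak L_{\omega_1,\omega}$ whose countable models are exactly the countable $L$-structures isomorphic to $A$. -}

module Defs where

open import Axiom.ExcludedMiddle using (ExcludedMiddle)
open import Data.Bool.Base using (Bool; T)
open import Data.Empty using (⊥)
open import Data.Fin.Base using (Fin; toℕ)
open import Data.List.Base using (List)
open import Data.List.Relation.Unary.All using (All)
open import Data.Nat.Base using (ℕ; zero; suc; _+_; _<_)
open import Data.Product.Base using (Σ; ∃-syntax; _×_; _,_; proj₁; proj₂)
open import Data.Sum.Base using (_⊎_)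
open import Data.Vec.Base using (Vec; []; _∷_; _++_; lookup; map)
open import Function.Bundles using (_↣_; _⇔_)
open import Function.Definitions using (Surjective; Bijective)
open import Level using (Setω; _⊔_) renaming (suc to lsuc; zero to 0ℓ)
open import Relation.Binary.PropositionalEquality.Core using (_≡_)
open import Relation.Nullary.Negation.Core using (¬_)

-- The metatheory of the mathematics is classical.  Agda's is not, so
-- excluded middle is available as an explicit hypothesis.
Classical : Setω
Classical = ∀ ℓ → ExcludedMiddle ℓ

------------------------------------------------------------------------
-- Computability on ℕ

triangle : ℕ → ℕ
triangle zero    = zero
triangle (suc n) = suc n + triangle n

-- Cantor's bijection ℕ × ℕ → ℕ.
⟨_,_⟩ : ℕ → ℕ → ℕ
⟨ a , b ⟩ = b + triangle (a + b)

⌜_⌝ᵛ : ∀ {n} → Vec ℕ n → ℕ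
⌜ [] ⌝ᵛ     = 0
⌜ x ∷ xs ⌝ᵛ = ⟨ x , ⌜ xs ⌝ᵛ ⟩

-- Programs for the unary partial recursive functions.  Functions of
-- several arguments are handled through the pairing ⟨_,_⟩.
data Code : Set where
  zeroᶜ sucᶜ leftᶜ rightᶜ : Code
  pairᶜ compᶜ precᶜ       : Code → Code → Code
  μᶜ                      : Code → Code

infix 4 _·_↓_

-- c · x ↓ y : the program c halts on input x with output y.
data _·_↓_ : Code → ℕ → ℕ → Set where
  ↓zero  : ∀ {x} → zeroᶜ · x ↓ 0
  ↓suc   : ∀ {x} → sucᶜ · x ↓ suc x
  ↓left  : ∀ {a b} → leftᶜ · ⟨ a , b ⟩ ↓ a
  ↓right : ∀ {a b} → rightᶜ · ⟨ a , b ⟩ ↓ b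
  ↓pair  : ∀ {f g x y z} → f · x ↓ y → g · x ↓ z → pairᶜ f g · x ↓ ⟨ y , z ⟩
  -- compᶜ f g is f ∘ g.
  ↓comp  : ∀ {f g x y z} → g · x ↓ y → f · y ↓ z → compᶜ f g · x ↓ z
  ↓prec₀ : ∀ {f g a y} → f · a ↓ y → precᶜ f g · ⟨ a , 0 ⟩ ↓ y
  ↓precₛ : ∀ {f g a n y z} → precᶜ f g · ⟨ a , n ⟩ ↓ y →
           g · ⟨ a , ⟨ n , y ⟩ ⟩ ↓ z → precᶜ f g · ⟨ a , suc n ⟩ ↓ z
  ↓μ     : ∀ {f x n} → (∀ {m} → m < n → ∃[ k ] f · ⟨ x , m ⟩ ↓ suc k) →
           f · ⟨ x , n ⟩ ↓ 0 → μᶜ f · x ↓ n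

-- An (injective) Gödel numbering of programs.
⌜_⌝ᶜ : Code → ℕ
⌜ zeroᶜ ⌝ᶜ     = ⟨ 0 , 0 ⟩
⌜ sucᶜ ⌝ᶜ      = ⟨ 1 , 0 ⟩
⌜ leftᶜ ⌝ᶜ     = ⟨ 2 , 0 ⟩
⌜ rightᶜ ⌝ᶜ    = ⟨ 3 , 0 ⟩
⌜ pairᶜ f g ⌝ᶜ = ⟨ 4 , ⟨ ⌜ f ⌝ᶜ , ⌜ g ⌝ᶜ ⟩ ⟩
⌜ compᶜ f g ⌝ᶜ = ⟨ 5 , ⟨ ⌜ f ⌝ᶜ , ⌜ g ⌝ᶜ ⟩ ⟩
⌜ precᶜ f g ⌝ᶜ = ⟨ 6 , ⟨ ⌜ f ⌝ᶜ , ⌜ g ⌝ᶜ ⟩ ⟩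
⌜ μᶜ f ⌝ᶜ      = ⟨ 7 , ⌜ f ⌝ᶜ ⟩

infix 4 _∈W_

-- The c.e. set W c is the domain of the partial function computed by c.
_∈W_ : ℕ → Code → Set
x ∈W c = ∃[ y ] c · x ↓ y

ComputableSet : (ℕ → Set) → Set
ComputableSet P = ∃[ c ] ∀ x → (P x × c · x ↓ 1) ⊎ (¬ P x × c · x ↓ 0)

------------------------------------------------------------------------
-- Structures in a finite language without relation symbols

-- Constant symbols are the function symbols of arity 0.
record Language : Set where
  field
    size  : ℕ
    arity : Fin size → ℕ

open Language public

record Structure (L : Language) : Set₁ where
  field
    Carrier   : Set
    inhabited : Carrier
    fun       : (f : Fin (size L)) → Vec Carrier (arity L f) → Carrier

open Structure public

record Hom {L : Language} (A B : Structure L) : Set where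
  field
    ⟦_⟧  : Carrier A → Carrier B
    homo : ∀ f v → ⟦ fun A f v ⟧ ≡ fun B f (map ⟦_⟧ v)

open Hom public

-- As there are no relation symbols, the inverse of a bijective
-- homomorphism is again a homomorphism.
IsIso : ∀ {L} {A B : Structure L} → Hom A B → Set
IsIso h = Bijective _≡_ _≡_ ⟦ h ⟧

_≅_ : ∀ {L} → Structure L → Structure L → Set
A ≅ B = Σ (Hom A B) IsIso

Hopfian : ∀ {L} → Structure L → Set
Hopfian A = (h : Hom A A) → Surjective _≡_ _≡_ ⟦ h ⟧ → IsIso h

-- Finite or countably infinite.
Countable : ∀ {L} → Structure L → Set
Countable B = Carrier B ↣ ℕ

-- A structure whose domain is a subset of ℕ, given by its
-- characteristic function so that membership is proof-irrelevant.
record ComputableStructure (L : Language) : Set where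
  field
    domain    : ℕ → Bool

  Elem : Set
  Elem = Σ ℕ (λ x → T (domain x))

  field
    element           : Elem
    op                : (f : Fin (size L)) → Vec Elem (arity L f) → Elem
    domain-computable : ComputableSet (λ x → T (domain x))
    op-computable     : ∀ f → ∃[ c ] ∀ v → c · ⌜ map proj₁ v ⌝ᵛ ↓ proj₁ (op f v)

  structure : Structure L
  structure = record { Carrier = Elem ; inhabited = element ; fun = op }

open ComputableStructure public

------------------------------------------------------------------------
-- Terms and finitary quantifier-free formulas

-- Term L n and QF L n have their variables among x₀, …, xₙ₋₁.
data Term (L : Language) (n : ℕ) : Set where
  var : Fin n → Term L n
  app : (f : Fin (size L)) → Vec (Term L n) (arity L f) → Term L n

data QF (L : Language) (n : ℕ) : Set where
  _≐_        : Term L n → Term L n → QF L n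
  false      : QF L n
  not        : QF L n → QF L n
  _and_ _or_ : QF L n → QF L n → QF L n

module _ {L : Language} {n : ℕ} where

  mutual
    ⌜_⌝ᵗ : Term L n → ℕ
    ⌜ var i ⌝ᵗ    = ⟨ 0 , toℕ i ⟩
    ⌜ app f ts ⌝ᵗ = ⟨ 1 , ⟨ toℕ f , ⌜ ts ⌝ᵗˢ ⟩ ⟩

    ⌜_⌝ᵗˢ : ∀ {k} → Vec (Term L n) k → ℕ
    ⌜ [] ⌝ᵗˢ     = 0
    ⌜ t ∷ ts ⌝ᵗˢ = ⟨ ⌜ t ⌝ᵗ , ⌜ ts ⌝ᵗˢ ⟩

  ⌜_⌝ᵠ : QF L n → ℕ
  ⌜ s ≐ t ⌝ᵠ   = ⟨ 0 , ⟨ ⌜ s ⌝ᵗ , ⌜ t ⌝ᵗ ⟩ ⟩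
  ⌜ false ⌝ᵠ   = ⟨ 1 , 0 ⟩
  ⌜ not φ ⌝ᵠ   = ⟨ 2 , ⌜ φ ⌝ᵠ ⟩
  ⌜ φ and χ ⌝ᵠ = ⟨ 3 , ⟨ ⌜ φ ⌝ᵠ , ⌜ χ ⌝ᵠ ⟩ ⟩
  ⌜ φ or χ ⌝ᵠ  = ⟨ 4 , ⟨ ⌜ φ ⌝ᵠ , ⌜ χ ⌝ᵠ ⟩ ⟩

module _ {L : Language} (B : Structure L) {n : ℕ} (v : Vec (Carrier B) n) where

  mutual
    eval : Term L n → Carrier B
    eval (var i)    = lookup v i
    eval (app f ts) = fun B f (evals ts)

    evals : ∀ {k} → Vec (Term L n) k → Vec (Carrier B) k
    evals []       = []
    evals (t ∷ ts) = eval t ∷ evals ts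

  SatQF : QF L n → Set
  SatQF (s ≐ t)   = eval s ≡ eval t
  SatQF false     = ⊥
  SatQF (not φ)   = ¬ SatQF φ
  SatQF (φ and χ) = SatQF φ × SatQF χ
  SatQF (φ or χ)  = SatQF φ ⊎ SatQF χ

  -- The list stands for the conjunction of the equations s = t.
  SatEquations : List (Term L n × Term L n) → Set
  SatEquations = All (λ (s , t) → eval s ≡ eval t)

  Generates : Set
  Generates = ∀ b → ∃[ t ] eval t ≡ b

------------------------------------------------------------------------
-- Computable infinitary formulas of finite rank

data Kind : Set where
  σ π : Kind

-- Formula L σ α n (resp. Formula L π α n) consists of the computable Σ_α
-- (resp. Π_α) formulas in n free variables.  For α > 0 such a formula is
-- given by a c.e. index c, and stands for
--   ⋁ { ∃ y₁ … yₘ θ | ⟨ β , ⟨ m , ⌜ θ ⌝ ⟩ ⟩ ∈ W c }    (kind σ),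
--   ⋀ { ∀ y₁ … yₘ θ | ⟨ β , ⟨ m , ⌜ θ ⌝ ⟩ ⟩ ∈ W c }    (kind π),
-- where β < α and θ is a computable Π_β (resp. Σ_β) formula in n + m
-- variables; elements of W c not of this form contribute nothing.
data Formula (L : Language) : Kind → ℕ → ℕ → Set where
  qf : ∀ {κ n} → QF L n → Formula L κ 0 n
  ⋁∃ : ∀ {α n} → Code → Formula L σ (suc α) n
  ⋀∀ : ∀ {α n} → Code → Formula L π (suc α) n

⌜_⌝ : ∀ {L κ α n} → Formula L κ α n → ℕ
⌜ qf φ ⌝ = ⌜ φ ⌝ᵠ
⌜ ⋁∃ c ⌝ = ⌜ c ⌝ᶜ
⌜ ⋀∀ c ⌝ = ⌜ c ⌝ᶜ

-- Satisfaction, as an inductive family because it recurses on β < α.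
data Sat {L : Language} (B : Structure L) :
         ∀ {κ α n} → Formula L κ α n → Vec (Carrier B) n → Set where
  sat-qf : ∀ {κ n} {φ : QF L n} {v} → SatQF B v φ → Sat B (qf {κ = κ} φ) v
  sat-⋁∃ : ∀ {α n c} {v : Vec (Carrier B) n} {β m} (θ : Formula L π β (n + m)) →
           β < suc α → ⟨ β , ⟨ m , ⌜ θ ⌝ ⟩ ⟩ ∈W c →
           (ys : Vec (Carrier B) m) → Sat B θ (v ++ ys) →
           Sat B (⋁∃ {α = α} c) v
  sat-⋀∀ : ∀ {α n c} {v : Vec (Carrier B) n} →
           (∀ {β m} (θ : Formula L σ β (n + m)) →
            β < suc α → ⟨ β , ⟨ m , ⌜ θ ⌝ ⟩ ⟩ ∈W c →
            (ys : Vec (Carrier B) m) → Sat B θ (v ++ ys)) →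
           Sat B (⋀∀ {α = α} c) v

-- Computable d-Σ₂ sentences.
dΣ₂-Sentence : Language → Set
dΣ₂-Sentence L = Formula L σ 2 0 × Formula L π 2 0

infix 4 _⊨_

_⊨_ : ∀ {L} → Structure L → dΣ₂-Sentence L → Set
B ⊨ (φ , χ) = Sat B φ [] × Sat B χ []

IsScottSentence : ∀ {L} → Structure L → dΣ₂-Sentence L → Set₁
IsScottSentence {L} A φ = (B : Structure L) → Countable B → (B ⊨ φ ⇔ A ≅ B)

HasComputable-dΣ₂-ScottSentence : ∀ {L} → Structure L → Set₁
HasComputable-dΣ₂-ScottSentence {L} A = ∃[ φ ] IsScottSentence A φ

------------------------------------------------------------------------
-- Finite presentations and the weak Whitehead problem

-- The homomorphism extending a ↦ b is unique because a generates A.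
FinitelyPresentedIn : ∀ {L k} → (Structure L → Set k) → Structure L → Set (lsuc 0ℓ ⊔ k)
FinitelyPresentedIn {L} K A =
  ∃[ n ] Σ (Vec (Carrier A) n) λ a → Σ (List (Term L n × Term L n)) λ ψ →
    Generates A a × SatEquations A a ψ ×
    (∀ (B : Structure L) → K B → (b : Vec (Carrier B) n) → SatEquations B b ψ →
     Σ (Hom A B) λ h → map ⟦ h ⟧ a ≡ b)

module _ {L : Language} (A : ComputableStructure L) where

  -- A computable subset of Aⁿ ⊆ ℕⁿ is given by its set of tuple codes.
  ComputableSubset : ∀ {n} → (Vec (Elem A) n → Set) → Set
  ComputableSubset S = ComputableSet λ k → ∃[ v ] S v × ⌜ map proj₁ v ⌝ᵛ ≡ k

  AutOrbit : ∀ {n} → Vec (Elem A) n → Vec (Elem A) n → Set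
  AutOrbit a b = Σ (Hom (structure A) (structure A)) λ α →
    IsIso α × map ⟦ α ⟧ a ≡ b

  DecidableWeakWhitehead : Set
  DecidableWeakWhitehead = ∀ {n} (a : Vec (Elem A) n) →
    Generates (structure A) a → ComputableSubset (AutOrbit a)

{-# OPTIONS --safe #-}
-- Write a for generators of A presented by ψ.
--
-- From a Scott sentence to the Whitehead problem: let θ be a Π₁ disjunct of
-- the Σ₂ part that holds of some c in A.  Either there are finitely many
-- quantifier-free facts such that every endomorphism preserving them and
-- θ (c) is onto, or there is a sequence A → A → A → … of endomorphisms that
-- are not onto and preserve θ (c) and more and more facts.  In the second
-- case, if the facts are chosen to witness the Π₂ part, the direct limit is
-- a model of the Scott sentence.  As A is finitely presented, an isomorphism
-- from A to the limit factors through some stage, so that the next stage maps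
-- onto the limit; by the Hopf property that map is injective, and the
-- preceding endomorphism is onto after all.  In the first case, writing c and
-- the parameters of the facts as terms in a, the orbit of a consists of the b
-- that satisfy ψ, θ and the facts, and its complement is c.e.; the orbit
-- itself is c.e. since it consists of the generating tuples satisfying ψ.
--
-- Conversely, if the orbit of a is computable, let θ (x) say that x satisfies
-- the quantifier-free type of a, and that x ≠ t (y) whenever ψ (y) holds and
-- t (a) lies outside the orbit.  In A it defines the orbit of a: if b = t (a)
-- is not in the orbit, then y = a refutes θ (b), and if b is in the orbit and
-- b = t (y), then a ↦ y is onto, hence an automorphism.  The Scott sentence
-- says that some x satisfies θ, and that all such x generate.

module Submission where

open import Defs
open import Data.Bool.Base using (Bool; true; false; T)
open import Data.Bool.Properties using (T-irrelevant)
open import Data.Empty using (⊥-elim)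
open import Data.Fin.Base using (Fin; zero; suc; toℕ; _↑ˡ_; _↑ʳ_)
open import Data.Fin.Properties using (toℕ-↑ˡ; toℕ-↑ʳ; toℕ-injective)
open import Data.List.Base as List using (List; []; _∷_)
open import Data.List.Membership.Propositional using (_∈_)
open import Data.List.Membership.Propositional.Properties using (∈-map⁺; ∈-++⁺ʳ)
open import Data.List.Relation.Unary.All as All using (All; []; _∷_)
open import Data.List.Relation.Unary.All.Properties using (++⁺; ++⁻)
open import Data.List.Relation.Unary.Any using (here)
open import Data.Nat.Base
open import Data.Nat.Induction using (<-rec)
open import Data.Nat.Properties
open import Data.Product.Base using (Σ; Σ-syntax; ∃-syntax; _×_; _,_; proj₁; proj₂)
open import Data.Sum.Base using (_⊎_; inj₁; inj₂; [_,_]′)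
open import Data.Vec.Base as Vec using (Vec; []; _∷_; _++_; lookup; map)
open import Data.Vec.Properties using (lookup-map; map-id; map-∘; map-++; lookup-++ˡ; lookup-++ʳ;
  ∷-injectiveˡ; ∷-injectiveʳ)
open import Function.Base using (_∘_; id; case_of_)
open import Function.Bundles using (_⇔_; mk⇔; mk↣; Equivalence)
open import Function.Definitions using (Surjective)
open import Level using () renaming (zero to 0ℓ)
open import Relation.Binary.PropositionalEquality
open import Relation.Nullary using (¬_; Dec; yes; no)
open import Relation.Nullary.Decidable using (True; fromWitness; toWitness)

open Equivalence using (to; from)

-- Cantor pairing

-- The successor in the enumeration of pairs by antidiagonals; iterating it from `0 , 0` inverts the
-- pairing without extracting square roots.
next : ℕ × ℕ → ℕ × ℕ
next (zero  , b) = suc b , 0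
next (suc a , b) = a , suc b

unpair : ℕ → ℕ × ℕ
unpair zero    = 0 , 0
unpair (suc n) = next (unpair n)

pair-next : ∀ p → ⟨ proj₁ (next p) , proj₂ (next p) ⟩ ≡ suc ⟨ proj₁ p , proj₂ p ⟩
pair-next (zero  , b) = cong (λ m → suc m + triangle m) (+-identityʳ b)
pair-next (suc a , b) = cong (λ m → suc b + triangle m) (+-suc a b)

abstract
  lft rgt : ℕ → ℕ
  lft n = proj₁ (unpair n)
  rgt n = proj₂ (unpair n)

  pair-unpair : ∀ n → ⟨ lft n , rgt n ⟩ ≡ n
  pair-unpair zero    = refl
  pair-unpair (suc n) = trans (pair-next (unpair n)) (cong suc (pair-unpair n))

  -- The recursion is on the code `k`: the predecessor of `suc a , 0` is `0 , a`, which is not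
  -- structurally below it.
  unpair-pair : ∀ k a b → ⟨ a , b ⟩ ≡ k → unpair k ≡ (a , b)
  unpair-pair zero    zero    zero    e = refl
  unpair-pair (suc k) (suc a) zero    e =
    cong next (unpair-pair k 0 a (suc-injective (trans (sym (pair-next (0 , a))) e)))
  unpair-pair (suc k) a       (suc b) e =
    cong next (unpair-pair k (suc a) b (suc-injective (trans (sym (pair-next (suc a , b))) e)))

  lft-⟨⟩ : ∀ a b → lft ⟨ a , b ⟩ ≡ a
  lft-⟨⟩ a b = cong proj₁ (unpair-pair _ a b refl)

  rgt-⟨⟩ : ∀ a b → rgt ⟨ a , b ⟩ ≡ b
  rgt-⟨⟩ a b = cong proj₂ (unpair-pair _ a b refl)

  lft≤ : ∀ n → lft n ≤ n
  lft≤ n = subst (lft n ≤_) (pair-unpair n)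
    (≤-trans (m≤m+n (lft n) (rgt n)) (≤-trans (m≤triangle (lft n + rgt n)) (m≤n+m _ (rgt n))))
    where
    m≤triangle : ∀ m → m ≤ triangle m
    m≤triangle zero    = z≤n
    m≤triangle (suc m) = m≤m+n (suc m) (triangle m)

  rgt≤ : ∀ n → rgt n ≤ n
  rgt≤ n = subst (rgt n ≤_) (pair-unpair n) (m≤m+n (rgt n) _)

  -- Strictness requires a nonzero left component, as ⟨ 0 , 0 ⟩ is 0. Compound terms and formulas
  -- carry a positive tag, so this bounds the codes of their parts.
  rgt< : ∀ n {a} → lft n ≡ suc a → rgt n < n
  rgt< n {a} e = subst₂ (λ x y → rgt n < y) e (pair-unpair n)
    (subst (λ x → rgt n < ⟨ x , rgt n ⟩) (sym e)
      (subst (_≤ ⟨ suc a , rgt n ⟩) (+-comm (rgt n) 1) (+-monoʳ-≤ (rgt n) (s≤s z≤n))))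

-- Computable functions

record Computable (f : ℕ → ℕ) : Set where
  constructor computable
  field
    code  : Code
    halts : ∀ x → code · x ↓ f x

open Computable

record Computable₂ (f : ℕ → ℕ → ℕ) : Set where
  constructor computable₂
  field
    uncurried : Computable (λ x → f (lft x) (rgt x))

open Computable₂

computable-≗ : ∀ {f g} → (∀ x → f x ≡ g x) → Computable f → Computable g
computable-≗ e (computable c h) = computable c λ x → subst (c · x ↓_) (e x) (h x)

compC : ∀ {f g} → Computable f → Computable g → Computable (λ x → f (g x))
compC (computable c h) (computable d k) = computable (compᶜ c d) λ x → ↓comp (k x) (h _)

#0 : Computable lft
#0 = computable leftᶜ λ x →
  subst (λ y → leftᶜ · y ↓ lft x) (pair-unpair x) (↓left {lft x} {rgt x})

#1 : Computable rgt
#1 = computable rightᶜ λ x →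
  subst (λ y → rightᶜ · y ↓ rgt x) (pair-unpair x) (↓right {lft x} {rgt x})

pairC : ∀ {f g} → Computable f → Computable g → Computable (λ x → ⟨ f x , g x ⟩)
pairC (computable c h) (computable d k) = computable (pairᶜ c d) λ x → ↓pair (h x) (k x)

idC : Computable (λ x → x)
idC = computable-≗ pair-unpair (pairC #0 #1)

lftC : ∀ {f} → Computable f → Computable (λ x → lft (f x))
lftC = compC #0

rgtC : ∀ {f} → Computable f → Computable (λ x → rgt (f x))
rgtC = compC #1

sucC : ∀ {f} → Computable f → Computable (λ x → suc (f x))
sucC = compC (computable sucᶜ λ x → ↓suc)

abstract
  constC : ∀ n → Computable (λ _ → n)
  constC zero    = computable zeroᶜ λ x → ↓zero
  constC (suc n) = sucC (constC n)

app₂ : ∀ {f u v} → Computable₂ f → Computable u → Computable v → Computable (λ x → f (u x) (v x))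
app₂ {f} {u} {v} (computable₂ F) U V =
  computable-≗ (λ x → cong₂ f (lft-⟨⟩ (u x) (v x)) (rgt-⟨⟩ (u x) (v x))) (compC F (pairC U V))

primrec : (ℕ → ℕ) → (ℕ → ℕ → ℕ → ℕ) → ℕ → ℕ → ℕ
primrec b g a zero    = b a
primrec b g a (suc n) = g a n (primrec b g a n)

primrecC : ∀ {b g} → Computable b →
  Computable (λ x → g (lft x) (lft (rgt x)) (rgt (rgt x))) → Computable₂ (primrec b g)
primrecC {b} {g} (computable c h) (computable d k) = computable₂ (computable (precᶜ c d) λ x →
  subst (λ y → precᶜ c d · y ↓ primrec b g (lft x) (rgt x)) (pair-unpair x) (go (lft x) (rgt x)))
  where
  step : ∀ a n y → d · ⟨ a , ⟨ n , y ⟩ ⟩ ↓ g a n y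
  step a n y = subst (d · ⟨ a , ⟨ n , y ⟩ ⟩ ↓_)
    (trans (cong₂ (λ u v → g u (lft v) (rgt v)) (lft-⟨⟩ a _) (rgt-⟨⟩ a _))
           (cong₂ (g a) (lft-⟨⟩ n y) (rgt-⟨⟩ n y)))
    (k ⟨ a , ⟨ n , y ⟩ ⟩)
  go : ∀ a n → precᶜ c d · ⟨ a , n ⟩ ↓ primrec b g a n
  go a zero    = ↓prec₀ {a = a} (h a)
  go a (suc n) = ↓precₛ {a = a} {n} (go a n) (step a n _)

-- Components of the argument ⟨ a , ⟨ n , y ⟩ ⟩ of a recursion step.
#a : Computable lft
#a = #0

#n : Computable (λ x → lft (rgt x))
#n = lftC #1

#y : Computable (λ x → rgt (rgt x))
#y = rgtC #1

computable₂-≗ : ∀ {f g} → (∀ x y → f x y ≡ g x y) → Computable₂ f → Computable₂ g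
computable₂-≗ e (computable₂ F) = computable₂ (computable-≗ (λ x → e _ _) F)

+C₂ : Computable₂ _+_
+C₂ = computable₂-≗ eq (primrecC {g = λ a n y → suc y} idC (sucC #y))
  where
  eq : ∀ a n → primrec (λ x → x) (λ _ _ y → suc y) a n ≡ a + n
  eq a zero    = sym (+-identityʳ a)
  eq a (suc n) = trans (cong suc (eq a n)) (sym (+-suc a n))

*C₂ : Computable₂ _*_
*C₂ = computable₂-≗ eq (primrecC {g = λ a n y → a + y} (constC 0) (app₂ +C₂ #a #y))
  where
  eq : ∀ a n → primrec (λ x → 0) (λ a _ y → a + y) a n ≡ a * n
  eq a zero    = sym (*-zeroʳ a)
  eq a (suc n) = trans (cong (a +_) (eq a n)) (sym (*-suc a n))

predC : ∀ {f} → Computable f → Computable (λ x → pred (f x))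
predC F = compC (computable-≗ eq (app₂ (primrecC {g = λ a n y → n} (constC 0) #n) (constC 0) idC)) F
  where
  eq : ∀ n → primrec (λ _ → 0) (λ _ n _ → n) 0 n ≡ pred n
  eq zero    = refl
  eq (suc n) = refl

∸C₂ : Computable₂ _∸_
∸C₂ = computable₂-≗ eq (primrecC {g = λ a n y → pred y} idC (predC #y))
  where
  eq : ∀ a n → primrec (λ x → x) (λ _ _ y → pred y) a n ≡ a ∸ n
  eq a zero    = refl
  eq a (suc n) = trans (cong pred (eq a n)) (pred[m∸n]≡m∸[1+n] a n)

ifz : ℕ → ℕ → ℕ → ℕ
ifz zero    t e = t
ifz (suc _) t e = e

-- A case distinction is a primitive recursion that ignores the previous value; both branches are
-- packed into the parameter.
ifzC : ∀ {c t e} → Computable c → Computable t → Computable e →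
       Computable (λ x → ifz (c x) (t x) (e x))
ifzC {c} {t} {e} C T E = computable-≗ (λ x → eq (c x) (t x) (e x))
  (app₂ (primrecC {g = λ a n y → rgt a} (lftC idC) (rgtC #a)) (pairC T E) C)
  where
  eq : ∀ n t e → primrec lft (λ a _ _ → rgt a) ⟨ t , e ⟩ n ≡ ifz n t e
  eq zero    t e = lft-⟨⟩ t e
  eq (suc n) t e = rgt-⟨⟩ t e

infixl 6 _+C_
infixl 7 _*C_

_+C_ : ∀ {f g} → Computable f → Computable g → Computable (λ x → f x + g x)
_+C_ = app₂ +C₂

_*C_ : ∀ {f g} → Computable f → Computable g → Computable (λ x → f x * g x)
_*C_ = app₂ *C₂

neq : ℕ → ℕ → ℕ
neq m n = (m ∸ n) + (n ∸ m)

neqC : ∀ {f g} → Computable f → Computable g → Computable (λ x → neq (f x) (g x))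
neqC F G = app₂ ∸C₂ F G +C app₂ ∸C₂ G F

neq-refl : ∀ n → neq n n ≡ 0
neq-refl n rewrite n∸n≡0 n = refl

neq⇒≡ : ∀ {m n} → neq m n ≡ 0 → m ≡ n
neq⇒≡ {m} {n} e = ≤-antisym (m∸n≡0⇒m≤n (m+n≡0⇒m≡0 (m ∸ n) e))
                            (m∸n≡0⇒m≤n (m+n≡0⇒n≡0 (m ∸ n) e))

-- A kind of Kleene normal form: run c s x is suc y if c halts on x with
-- output y and all its μ-searches succeed below s, and 0 otherwise.
searchStep : ℕ → ℕ → ℕ
-- Here `r` is a value of `run`: 0 means divergence, 1 a zero found at `j`, and anything larger lets
-- the search go on.
searchStep j r = ifz r 1 (ifz (pred r) (2 + j) 0)

-- Value 0 means "keep searching", 1 "diverged", 2 + n "found n".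
search : (ℕ → ℕ) → ℕ → ℕ
search r zero    = 0
search r (suc j) = ifz (search r j) (searchStep j (r j)) (search r j)

run : Code → ℕ → ℕ → ℕ
runPrec : Code → Code → ℕ → ℕ → ℕ → ℕ
run zeroᶜ       s x = 1
run sucᶜ        s x = suc (suc x)
run leftᶜ       s x = suc (lft x)
run rightᶜ      s x = suc (rgt x)
run (pairᶜ f g) s x = ifz (run f s x) 0 (ifz (run g s x) 0 (suc ⟨ pred (run f s x) , pred (run g s x) ⟩))
run (compᶜ f g) s x = ifz (run g s x) 0 (run f s (pred (run g s x)))
run (precᶜ f g) s x = runPrec f g s (lft x) (rgt x)
-- `pred` merges "keep searching" and "diverged" into 0, and turns `2 + n` into the result `suc n`.
run (μᶜ f)      s x = pred (search (λ j → run f s ⟨ x , j ⟩) s)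
runPrec f g s a zero    = run f s a
runPrec f g s a (suc n) =
  ifz (runPrec f g s a n) 0 (run g s ⟨ a , ⟨ n , pred (runPrec f g s a n) ⟩ ⟩)

runC : ∀ c → Computable₂ (run c)
runC zeroᶜ       = computable₂ (constC 1)
runC sucᶜ        = computable₂ (sucC (sucC #1))
runC leftᶜ       = computable₂ (sucC (lftC #1))
runC rightᶜ      = computable₂ (sucC (rgtC #1))
runC (pairᶜ f g) = computable₂
  (ifzC (uncurried (runC f)) (constC 0) (ifzC (uncurried (runC g)) (constC 0)
    (sucC (pairC (predC (uncurried (runC f))) (predC (uncurried (runC g)))))))
runC (compᶜ f g) = computable₂
  (ifzC (uncurried (runC g)) (constC 0) (app₂ (runC f) #0 (predC (uncurried (runC g)))))
runC (precᶜ f g) = computable₂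
  (computable-≗ (λ x → eq (lft x) (lft (rgt x)) (rgt (rgt x)))
    (app₂ (primrecC {g = λ p n y → ifz y 0 (run g (lft p) ⟨ rgt p , ⟨ n , pred y ⟩ ⟩)}
             (uncurried (runC f))
             (ifzC #y (constC 0)
               (app₂ (runC g) (lftC #a) (pairC (rgtC #a) (pairC #n (predC #y))))))
          (pairC #0 (lftC #1)) (rgtC #1)))
  where
  eq : ∀ s a n → primrec (λ x → run f (lft x) (rgt x))
    (λ p n y → ifz y 0 (run g (lft p) ⟨ rgt p , ⟨ n , pred y ⟩ ⟩)) ⟨ s , a ⟩ n ≡ runPrec f g s a n
  eq s a zero = cong₂ (run f) (lft-⟨⟩ s a) (rgt-⟨⟩ s a)
  eq s a (suc n) rewrite eq s a n | lft-⟨⟩ s a | rgt-⟨⟩ s a = refl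
runC (μᶜ f)      = computable₂
  (predC (computable-≗ (λ x → eq (lft x) (rgt x) (lft x))
    (app₂ (primrecC {g = λ p j y → ifz y (searchStep j (run f (lft p) ⟨ rgt p , j ⟩)) y}
             (constC 0)
             (ifzC #y (ifzC r (constC 1) (ifzC (predC r) (sucC (sucC #n)) (constC 0))) #y))
          (pairC #0 #1) #0)))
  where
  r : Computable (λ x → run f (lft (lft x)) ⟨ rgt (lft x) , lft (rgt x) ⟩)
  r = app₂ (runC f) (lftC #a) (pairC (rgtC #a) #n)
  eq : ∀ s x n → primrec (λ _ → 0)
    (λ p j y → ifz y (searchStep j (run f (lft p) ⟨ rgt p , j ⟩)) y) ⟨ s , x ⟩ n
    ≡ search (λ j → run f s ⟨ x , j ⟩) n
  eq s x zero = refl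
  eq s x (suc n) rewrite eq s x n | lft-⟨⟩ s x | rgt-⟨⟩ s x = refl

-- Soundness and completeness of bounded evaluation

search-0 : ∀ r n → search r n ≡ 0 → ∀ {m} → m < n → ∃[ k ] r m ≡ suc (suc k)
search-0 r (suc n) e m<n with search r n in s
search-0 r (suc n) e m<n | zero with r n in t
search-0 r (suc n) () m<n | zero | zero
search-0 r (suc n) () m<n | zero | suc zero
search-0 r (suc n) e m<n | zero | suc (suc k) with m≤n⇒m<n∨m≡n m<n
... | inj₁ (s≤s m<n′) = search-0 r n s m<n′
... | inj₂ refl = k , t
search-0 r (suc n) () m<n | suc _

search-found : ∀ r n {m} → search r n ≡ suc (suc m) → search r m ≡ 0 × r m ≡ 1
search-found r (suc n) e with search r n in s
search-found r (suc n) e | zero with r n in t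
search-found r (suc n) () | zero | zero
search-found r (suc n) refl | zero | suc zero = s , t
search-found r (suc n) () | zero | suc (suc k)
search-found r (suc n) refl | suc _ = search-found r n s

search-0⁻ : ∀ r n → (∀ {m} → m < n → ∃[ k ] r m ≡ suc (suc k)) → search r n ≡ 0
search-0⁻ r zero    h = refl
search-0⁻ r (suc n) h
  rewrite search-0⁻ r n (λ m<n → h (m≤n⇒m≤1+n m<n)) | proj₂ (h (n<1+n n)) = refl

search-found⁻ : ∀ r n {m} → m < n → search r m ≡ 0 → r m ≡ 1 → search r n ≡ suc (suc m)
search-found⁻ r (suc n) m<n e t with m≤n⇒m<n∨m≡n m<n
... | inj₁ (s≤s m<n′) rewrite search-found⁻ r n m<n′ e t = refl
... | inj₂ refl rewrite e | t = refl

run-sound : ∀ c s x {y} → run c s x ≡ suc y → c · x ↓ y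
runPrec-sound : ∀ f g s a n {y} → runPrec f g s a n ≡ suc y → precᶜ f g · ⟨ a , n ⟩ ↓ y
run-sound zeroᶜ s x refl = ↓zero
run-sound sucᶜ s x refl = ↓suc
run-sound leftᶜ s x refl = halts #0 x
run-sound rightᶜ s x refl = halts #1 x
run-sound (pairᶜ f g) s x e with run f s x in p
... | suc u with run g s x in q
run-sound (pairᶜ f g) s x refl | suc u | suc v = ↓pair (run-sound f s x p) (run-sound g s x q)
run-sound (compᶜ f g) s x e with run g s x in q
... | suc v = ↓comp (run-sound g s x q) (run-sound f s v e)
run-sound (precᶜ f g) s x {y} e = subst (λ z → precᶜ f g · z ↓ y) (pair-unpair x)
  (runPrec-sound f g s (lft x) (rgt x) e)
run-sound (μᶜ f) s x e with search (λ j → run f s ⟨ x , j ⟩) s in p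
run-sound (μᶜ f) s x refl | suc (suc n) = let h , t = search-found _ s p in
  ↓μ (λ {m} m<n → let k , u = search-0 _ n h m<n in k , run-sound f s ⟨ x , m ⟩ u)
     (run-sound f s ⟨ x , n ⟩ t)
runPrec-sound f g s a zero e = ↓prec₀ {a = a} (run-sound f s a e)
runPrec-sound f g s a (suc n) e with runPrec f g s a n in p
... | suc u = ↓precₛ {a = a} {n} (runPrec-sound f g s a n p) (run-sound g s _ e)

Eventually : (ℕ → Set) → Set
Eventually P = ∃[ M ] ∀ m → M ≤ m → P m

eventually-× : ∀ {P Q : ℕ → Set} → Eventually P → Eventually Q → Eventually (λ m → P m × Q m)
eventually-× (M , p) (N , q) = M ⊔ N , λ m l →
  p m (≤-trans (m≤m⊔n M N) l) , q m (≤-trans (m≤n⊔m M N) l)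

eventually-map : ∀ {P Q : ℕ → Set} → (∀ {m} → P m → Q m) → Eventually P → Eventually Q
eventually-map f (M , p) = M , λ m l → f (p m l)

always : ∀ {P : ℕ → Set} → (∀ m → P m) → Eventually P
always p = 0 , λ m _ → p m

-- Finitely many thresholds have a maximum. This serves the μ-operator, whose result depends on all
-- earlier candidates.
eventually-< : ∀ n {P : ℕ → ℕ → Set} → (∀ {m} → m < n → Eventually (P m)) →
               Eventually (λ s → ∀ {m} → m < n → P m s)
eventually-< zero    h = always λ s ()
eventually-< (suc n) {P} h = eventually-map
  (λ { {s} (p , q) {m} m<n → [ (λ { (s≤s m<n′) → p m<n′ }) , (λ { refl → q }) ]′ (m≤n⇒m<n∨m≡n m<n) })
  (eventually-× (eventually-< n {P} λ m<n → h (m≤n⇒m≤1+n m<n)) (h (n<1+n n)))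

-- Asking for all large bounds, and not just for one, lets the bounds of subcomputations be combined
-- by taking maxima.
run-complete : ∀ {c x y} → c · x ↓ y → Eventually (λ s → run c s x ≡ suc y)
run-complete ↓zero = always λ s → refl
run-complete ↓suc = always λ s → refl
run-complete (↓left {a} {b}) = always λ s → cong suc (lft-⟨⟩ a b)
run-complete (↓right {a} {b}) = always λ s → cong suc (rgt-⟨⟩ a b)
run-complete (↓pair d e) = eventually-map
  (λ { (p , q) → trans (cong₂ (λ u v → ifz u 0 (ifz v 0 (suc ⟨ pred u , pred v ⟩))) p q) refl })
  (eventually-× (run-complete d) (run-complete e))
run-complete (↓comp {f} d e) = eventually-map
  (λ { {s} (p , q) → trans (cong (λ u → ifz u 0 (run f s (pred u))) p) q })
  (eventually-× (run-complete d) (run-complete e))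
run-complete (↓prec₀ {f} {g} {a} d) = eventually-map
  (λ {s} p → trans (cong₂ (runPrec f g s) (lft-⟨⟩ a 0) (rgt-⟨⟩ a 0)) p) (run-complete d)
run-complete (↓precₛ {f} {g} {a} {n} {y} d e) = eventually-map
  (λ { {s} (p , q) → trans (cong₂ (runPrec f g s) (lft-⟨⟩ a (suc n)) (rgt-⟨⟩ a (suc n)))
    (trans (cong (λ u → ifz u 0 (run g s ⟨ a , ⟨ n , pred u ⟩ ⟩))
             (trans (sym (cong₂ (runPrec f g s) (lft-⟨⟩ a n) (rgt-⟨⟩ a n))) p)) q) })
  (eventually-× (run-complete d) (run-complete e))
run-complete (↓μ {f} {x} {n} h t) = eventually-map
  (λ { {s} (n<s , p , q) → cong pred (search-found⁻ _ s n<s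
       (search-0⁻ (λ j → run f s ⟨ x , j ⟩) n p) q) })
  -- The bound has to exceed `n` itself, as `search` only inspects the candidates below it.
  (eventually-× (suc n , λ m l → l)
    (eventually-× (eventually-< n {λ m s → ∃[ k ] run f s ⟨ x , m ⟩ ≡ suc (suc k)}
       λ m<n → eventually-map (proj₁ (h m<n) ,_) (run-complete (proj₂ (h m<n)))) (run-complete t)))

-- At a common bound both computations are read off from the same value of the function `run`.
↓-deterministic : ∀ {c x y z} → c · x ↓ y → c · x ↓ z → y ≡ z
↓-deterministic d e = let M , h = eventually-× (run-complete d) (run-complete e)
                          p , q = h M ≤-refl in suc-injective (trans (sym p) q)

-- Decidable and c.e. sets; the value 0 means "true".

record Decidable (P : ℕ → Set) : Set where
  constructor decidable
  field
    {test} : ℕ → ℕ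
    testC  : Computable test
    true⇔0 : ∀ x → P x ⇔ test x ≡ 0

record CE (P : ℕ → Set) : Set where
  constructor ce
  field
    {test} : ℕ → ℕ → ℕ
    testC  : Computable₂ test
    true⇔0 : ∀ x → P x ⇔ (∃[ w ] test x w ≡ 0)

open Decidable
open CE

≡-Decidable : ∀ {f g} → Computable f → Computable g → Decidable (λ x → f x ≡ g x)
≡-Decidable {f} {g} F G = decidable (neqC F G) λ x →
  mk⇔ (λ e → trans (cong (neq (f x)) (sym e)) (neq-refl (f x))) neq⇒≡

¬-Decidable : ∀ {P} → Decidable P → Decidable (λ x → ¬ P x)
¬-Decidable (decidable {t} T e) = decidable (ifzC T (constC 1) (constC 0)) λ x → mk⇔
  (λ ¬p → help (t x) λ t≡0 → ¬p (from (e x) t≡0))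
  (λ q p → case trans (sym (cong (λ u → ifz u 1 0) (to (e x) p))) q of λ ())
  where
  help : ∀ n → ¬ n ≡ 0 → ifz n 1 0 ≡ 0
  help zero    h = ⊥-elim (h refl)
  help (suc n) h = refl

infixr 6 _×-Decidable_ _×-CE_
infixr 5 _⊎-Decidable_ _⊎-CE_

-- With 0 for truth, conjunction is addition of tests and disjunction is multiplication.
_×-Decidable_ : ∀ {P Q} → Decidable P → Decidable Q → Decidable (λ x → P x × Q x)
decidable {s} S d ×-Decidable decidable {t} T e = decidable (S +C T) λ x → mk⇔
  (λ { (p , q) → cong₂ _+_ (to (d x) p) (to (e x) q) })
  (λ u → from (d x) (m+n≡0⇒m≡0 (s x) u) , from (e x) (m+n≡0⇒n≡0 (s x) u))

_⊎-Decidable_ : ∀ {P Q} → Decidable P → Decidable Q → Decidable (λ x → P x ⊎ Q x)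
decidable {s} S d ⊎-Decidable decidable {t} T e = decidable (S *C T) λ x → mk⇔
  [ (λ p → cong (_* t x) (to (d x) p)) , (λ q → trans (cong (s x *_) (to (e x) q)) (*-zeroʳ (s x))) ]′
  (λ u → [ inj₁ ∘ from (d x) , inj₂ ∘ from (e x) ]′ (m*n≡0⇒m≡0∨n≡0 (s x) u))

Decidable⇒CE : ∀ {P} → Decidable P → CE P
Decidable⇒CE (decidable T e) = ce (computable₂ (compC T #0)) λ x →
  mk⇔ (λ p → 0 , to (e x) p) (λ (w , t) → from (e x) t)

CE-⇔ : ∀ {P Q} → (∀ x → P x ⇔ Q x) → CE P → CE Q
CE-⇔ h (ce T e) = ce T λ x → mk⇔ (to (e x) ∘ from (h x)) (to (h x) ∘ from (e x))

CE-∘ : ∀ {P f} → CE P → Computable f → CE (P ∘ f)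
CE-∘ {f = f} (ce T e) F = ce (computable₂ (app₂ T (compC F #0) #1)) (e ∘ f)

_×-CE_ : ∀ {P Q} → CE P → CE Q → CE (λ x → P x × Q x)
ce {s} S d ×-CE ce {t} T e = ce
  {test = λ x w → s x (lft w) + t x (rgt w)}
  (computable₂ (app₂ S #0 (lftC #1) +C app₂ T #0 (rgtC #1))) λ x → mk⇔
  (λ (p , q) → let v , a = to (d x) p ; w , b = to (e x) q in ⟨ v , w ⟩ ,
    cong₂ _+_ (trans (cong (s x) (lft-⟨⟩ v w)) a) (trans (cong (t x) (rgt-⟨⟩ v w)) b))
  (λ (w , u) → from (d x) (lft w , m+n≡0⇒m≡0 (s x (lft w)) u) ,
               from (e x) (rgt w , m+n≡0⇒n≡0 (s x (lft w)) u))

_⊎-CE_ : ∀ {P Q} → CE P → CE Q → CE (λ x → P x ⊎ Q x)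
ce {s} S d ⊎-CE ce {t} T e = ce {test = λ x w → s x w * t x w}
  (computable₂ (uncurried S *C uncurried T)) λ x → mk⇔
  [ (λ p → let v , a = to (d x) p in v , cong (_* t x v) a)
  , (λ q → let w , b = to (e x) q in w , trans (cong (s x w *_) b) (*-zeroʳ (s x w))) ]′
  (λ (w , u) → [ (λ a → inj₁ (from (d x) (w , a))) , (λ b → inj₂ (from (e x) (w , b))) ]′
                 (m*n≡0⇒m≡0∨n≡0 (s x w) u))

∃-CE : ∀ {P : ℕ → ℕ → Set} → CE (λ z → P (lft z) (rgt z)) → CE (λ x → ∃[ y ] P x y)
∃-CE {P} (ce {t} T e) = ce {test = λ x w → t ⟨ x , lft w ⟩ (rgt w)}
  (computable₂ (app₂ T (pairC #0 (lftC #1)) (rgtC #1))) λ x → mk⇔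
  (λ (y , p) → let w , a = to (e ⟨ x , y ⟩) (subst₂ P (sym (lft-⟨⟩ x y)) (sym (rgt-⟨⟩ x y)) p) in
    ⟨ y , w ⟩ , trans (cong₂ (λ u v → t ⟨ x , u ⟩ v) (lft-⟨⟩ y w) (rgt-⟨⟩ y w)) a)
  (λ (w , a) → lft w , subst₂ P (lft-⟨⟩ x (lft w)) (rgt-⟨⟩ x (lft w))
    (from (e ⟨ x , lft w ⟩) (rgt w , a)))

W-CE : ∀ c → CE (_∈W c)
W-CE c = ce {test = λ x s → ifz (run c s x) 1 0}
  (computable₂ (ifzC (app₂ (runC c) #1 #0) (constC 1) (constC 0))) λ x → mk⇔
  (λ (y , d) → let s , h = run-complete d in s , cong (λ u → ifz u 1 0) (h s ≤-refl))
  (λ (s , e) → sound s x e)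
  where
  sound : ∀ s x → ifz (run c s x) 1 0 ≡ 0 → ∃[ y ] c · x ↓ y
  sound s x e with run c s x in p
  ... | suc y = y , run-sound c s x p

-- Enumeration of c.e. sets and Post's theorem

least : ∀ (t : ℕ → ℕ) n → t n ≡ 0 → ∃[ m ] t m ≡ 0 × (∀ {i} → i < m → ∃[ k ] t i ≡ suc k)
least t n e with t 0 in p
... | zero = 0 , p , λ ()
least t zero    e | suc k = case trans (sym e) p of λ ()
least t (suc n) e | suc k = let m , q , h = least (t ∘ suc) n e in
  suc m , q , λ { {zero} _ → k , p ; {suc i} (s≤s l) → h l }

module _ {P : ℕ → Set} (P-CE : CE P) where
  private
    t = CE.test P-CE
    c = code (uncurried (CE.testC P-CE))
    e = CE.true⇔0 P-CE

    at : ∀ x w → c · ⟨ x , w ⟩ ↓ t x w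
    at x w = subst (c · ⟨ x , w ⟩ ↓_) (cong₂ t (lft-⟨⟩ x w) (rgt-⟨⟩ x w))
      (halts (uncurried (CE.testC P-CE)) ⟨ x , w ⟩)

  abstract
    enumerator : Code
    enumerator = μᶜ c

    -- Any witness makes the search halt, but its output is the least one, so `m` replaces `w`.
    μ-halts : ∀ x w → t x w ≡ 0 → ∃[ m ] t x m ≡ 0 × enumerator · x ↓ m
    μ-halts x w q = let m , r , l = least (t x) w q in m , r ,
      ↓μ (λ {i} i<m → proj₁ (l i<m) , subst (c · ⟨ x , i ⟩ ↓_) (proj₂ (l i<m)) (at x i))
         (subst (c · ⟨ x , m ⟩ ↓_) r (at x m))

    enumerator-⇔ : ∀ x → P x ⇔ x ∈W enumerator
    enumerator-⇔ x = mk⇔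
      (λ p → let w , q = to (e x) p ; m , _ , d = μ-halts x w q in m , d)
      (λ { (m , ↓μ _ d) → from (e x) (m , ↓-deterministic (at x m) d) })

-- Post's theorem. A single search looks for a zero of the product of the two tests; at the `m` that
-- it finds, `s x m` tells which side has been confirmed. `P?` shows that the search halts.
post : ∀ {P} → CE P → CE (λ x → ¬ P x) → (∀ x → Dec (P x)) → ComputableSet P
post {P} (ce {s} S d) (ce {t} T e) P? =
  compᶜ (code outC) (pairᶜ (code idC) (enumerator both)) , λ x → decide x (P? x)
  where
  both : CE (λ x → ∃[ w ] s x w * t x w ≡ 0)
  both = ce {test = λ x w → s x w * t x w} (computable₂ (uncurried S *C uncurried T)) λ x → mk⇔ id id
  out : ℕ → ℕ → ℕ
  out x w = ifz (s x w) 1 0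
  outC : Computable (λ z → out (lft z) (rgt z))
  outC = ifzC (uncurried S) (constC 1) (constC 0)
  result : ∀ x w → s x w * t x w ≡ 0 → ∃[ m ] s x m * t x m ≡ 0 ×
           compᶜ (code outC) (pairᶜ (code idC) (enumerator both)) · x ↓ out x m
  result x w q = let m , r , d = μ-halts both x w q in m , r ,
    ↓comp (↓pair (halts idC x) d)
      (subst (code outC · ⟨ x , m ⟩ ↓_) (cong₂ out (lft-⟨⟩ x m) (rgt-⟨⟩ x m)) (halts outC ⟨ x , m ⟩))
  decide : ∀ x → Dec (P x) →
    let c = compᶜ (code outC) (pairᶜ (code idC) (enumerator both)) in
    (P x × c · x ↓ 1) ⊎ (¬ P x × c · x ↓ 0)
  decide x (yes p) = let w , a = to (d x) p
                         m , r , h = result x w (cong (_* t x w) a) in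
    inj₁ (p , subst (_ · x ↓_) (value m r) h)
    where
    value : ∀ m → s x m * t x m ≡ 0 → out x m ≡ 1
    value m r with s x m in q
    ... | zero = refl
    ... | suc k = ⊥-elim (from (e x) (m , m+n≡0⇒m≡0 (t x m) r) p)
  decide x (no ¬p) = let w , a = to (e x) ¬p
                         m , r , h = result x w (trans (cong (s x w *_) a) (*-zeroʳ (s x w))) in
    inj₂ (¬p , subst (_ · x ↓_) (value m r) h)
    where
    value : ∀ m → s x m * t x m ≡ 0 → out x m ≡ 0
    value m r with s x m in q
    ... | zero = ⊥-elim (¬p (from (d x) (m , q)))
    ... | suc k = refl

ComputableSet⇒Decidable : ∀ {P} → ComputableSet P → Decidable P
ComputableSet⇒Decidable {P} (c , h) = decidable {test = λ x → ifz (value x) 1 0}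
  (ifzC (computable c value-halts) (constC 1) (constC 0)) correct
  where
  value : ℕ → ℕ
  value x = [ (λ _ → 1) , (λ _ → 0) ]′ (h x)
  value-halts : ∀ x → c · x ↓ value x
  value-halts x with h x
  ... | inj₁ (_ , d) = d
  ... | inj₂ (_ , d) = d
  correct : ∀ x → P x ⇔ ifz (value x) 1 0 ≡ 0
  correct x with h x
  ... | inj₁ (p , _) = mk⇔ (λ _ → refl) (λ _ → p)
  ... | inj₂ (¬p , _) = mk⇔ (λ p → ⊥-elim (¬p p)) (λ ())

-- Decoding of programs

-- The first argument is fuel, bounding the depth of the program. The arbitrary value `zeroᶜ` is
-- returned when it runs out.
decode : ℕ → ℕ → Code
decodeTag : ℕ → ℕ → ℕ → Code
decode zero    n = zeroᶜ
decode (suc s) n = decodeTag s (lft n) (rgt n)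
decodeTag s 0 r = zeroᶜ
decodeTag s 1 r = sucᶜ
decodeTag s 2 r = leftᶜ
decodeTag s 3 r = rightᶜ
decodeTag s 4 r = pairᶜ (decode s (lft r)) (decode s (rgt r))
decodeTag s 5 r = compᶜ (decode s (lft r)) (decode s (rgt r))
decodeTag s 6 r = precᶜ (decode s (lft r)) (decode s (rgt r))
decodeTag s _ r = μᶜ (decode s r)

-- Both parts of a program receive the same fuel, so correctness is needed for all large amounts. It
-- gives the injectivity of the Gödel numbering and an enumeration of all programs.
decode-⌜⌝ : ∀ c → Eventually (λ s → decode s ⌜ c ⌝ᶜ ≡ c)
decode-⌜⌝ c = go c
  where
  tagged : ∀ {t r d} → Eventually (λ s → decodeTag s t r ≡ d) → Eventually (λ s → decode s ⟨ t , r ⟩ ≡ d)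
  tagged {t} {r} (M , h) = suc M , λ { (suc s) (s≤s l) →
    trans (cong₂ (decodeTag s) (lft-⟨⟩ t r) (rgt-⟨⟩ t r)) (h s l) }
  two : ∀ {f g} (k : Code → Code → Code) → Eventually (λ s → decode s ⌜ f ⌝ᶜ ≡ f) →
        Eventually (λ s → decode s ⌜ g ⌝ᶜ ≡ g) → let r = ⟨ ⌜ f ⌝ᶜ , ⌜ g ⌝ᶜ ⟩ in
        Eventually (λ s → k (decode s (lft r)) (decode s (rgt r)) ≡ k f g)
  two {f} {g} k p q = eventually-map
    (λ { {s} (u , v) → cong₂ k (trans (cong (decode s) (lft-⟨⟩ ⌜ f ⌝ᶜ ⌜ g ⌝ᶜ)) u)
                               (trans (cong (decode s) (rgt-⟨⟩ ⌜ f ⌝ᶜ ⌜ g ⌝ᶜ)) v) })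
    (eventually-× p q)
  go : ∀ c → Eventually (λ s → decode s ⌜ c ⌝ᶜ ≡ c)
  go zeroᶜ       = tagged {0} {0} (always λ s → refl)
  go sucᶜ        = tagged {1} {0} (always λ s → refl)
  go leftᶜ       = tagged {2} {0} (always λ s → refl)
  go rightᶜ      = tagged {3} {0} (always λ s → refl)
  go (pairᶜ f g) = tagged {4} {⟨ ⌜ f ⌝ᶜ , ⌜ g ⌝ᶜ ⟩} (two pairᶜ (go f) (go g))
  go (compᶜ f g) = tagged {5} {⟨ ⌜ f ⌝ᶜ , ⌜ g ⌝ᶜ ⟩} (two compᶜ (go f) (go g))
  go (precᶜ f g) = tagged {6} {⟨ ⌜ f ⌝ᶜ , ⌜ g ⌝ᶜ ⟩} (two precᶜ (go f) (go g))
  go (μᶜ f)      = tagged {7} {⌜ f ⌝ᶜ} (eventually-map (cong μᶜ) (go f))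

⌜⌝ᶜ-injective : ∀ {c d} → ⌜ c ⌝ᶜ ≡ ⌜ d ⌝ᶜ → c ≡ d
⌜⌝ᶜ-injective {c} {d} e = let M , h = eventually-× (decode-⌜⌝ c) (decode-⌜⌝ d)
                              p , q = h M ≤-refl in
  trans (sym p) (trans (cong (decode M) e) q)

⟨⟩-injective : ∀ {a b c d} → ⟨ a , b ⟩ ≡ ⟨ c , d ⟩ → a ≡ c × b ≡ d
⟨⟩-injective {a} {b} {c} {d} e =
  trans (sym (lft-⟨⟩ a b)) (trans (cong lft e) (lft-⟨⟩ c d)) ,
  trans (sym (rgt-⟨⟩ a b)) (trans (cong rgt e) (rgt-⟨⟩ c d))

-- Course-of-values recursion

drop : ℕ → ℕ → ℕ
drop zero    x = x
drop (suc k) x = rgt (drop k x)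

dropC : Computable₂ drop
dropC = computable₂ (computable-≗ (λ x → eq (rgt x) (lft x))
  (app₂ (primrecC {g = λ _ _ y → rgt y} idC (rgtC #y)) #1 #0))
  where
  eq : ∀ x k → primrec (λ x → x) (λ _ _ y → rgt y) x k ≡ drop k x
  eq x zero    = refl
  eq x (suc k) = cong rgt (eq x k)

drop-rgt : ∀ k x → drop k (rgt x) ≡ rgt (drop k x)
drop-rgt zero    x = refl
drop-rgt (suc k) x = cong rgt (drop-rgt k x)

module CourseOfValues (F : ℕ → ℕ → (ℕ → ℕ) → ℕ) where

  -- In a list of the values at n - 1, ..., 0 the value at `i` has position n - 1 - i.
  recall : ℕ → ℕ → ℕ → ℕ
  recall n h i = lft (drop (n ∸ suc i) h)

  abstract
    -- The list of the values at n - 1, …, 0.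
    history : ℕ → ℕ → ℕ
    history = primrec (λ _ → 0) (λ e n h → ⟨ F e n (recall n h) , h ⟩)

    value : ℕ → ℕ → ℕ
    value e n = lft (history e (suc n))

    valueC : Computable (λ x → F (lft x) (lft (rgt x)) (recall (lft (rgt x)) (rgt (rgt x)))) →
             Computable₂ value
    valueC FC = computable₂ (lftC (app₂
      (primrecC {g = λ e n h → ⟨ F e n (recall n h) , h ⟩} (constC 0) (pairC FC #y)) #0 (sucC #1)))

    drop-history : ∀ e j i → drop j (history e (j + i)) ≡ history e i
    drop-history e zero    i = refl
    drop-history e (suc j) i = trans (sym (drop-rgt j (history e (suc j + i))))
      (trans (cong (drop j) (rgt-⟨⟩ (F e (j + i) (recall (j + i) (history e (j + i)))) _)) (drop-history e j i))

    -- `recall` is correct only below `n`, hence the condition that `F` depends only on the values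
    -- there.
    unfold : (∀ e n r r′ → (∀ {i} → i < n → r i ≡ r′ i) → F e n r ≡ F e n r′) →
             ∀ e n → value e n ≡ F e n (value e)
    unfold F-local e n = trans (lft-⟨⟩ (F e n (recall n (history e n))) (history e n))
      (F-local e n _ _ λ {i} i<n → cong lft
        (trans (cong (λ m → drop (n ∸ suc i) (history e m)) (sym (m∸n+n≡m i<n)))
               (drop-history e (n ∸ suc i) (suc i))))

nth : ℕ → ℕ → ℕ
nth e i = lft (drop i e)

nthC : Computable₂ nth
nthC = computable₂ (lftC (app₂ dropC #1 #0))

nth-⟨⟩-suc : ∀ x e i → nth ⟨ x , e ⟩ (suc i) ≡ nth e i
nth-⟨⟩-suc x e i = cong lft (trans (sym (drop-rgt i ⟨ x , e ⟩)) (cong (drop i) (rgt-⟨⟩ x e)))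

-- As 0 is ⟨ 0 , 0 ⟩, it codes an endless list of zeros. Positions beyond the end of a list thus
-- read 0.
nth-0 : ∀ i → nth 0 i ≡ 0
nth-0 i = cong lft (drop-0 i) ⟨trans⟩ n≤0⇒n≡0 (lft≤ 0)
  where
  _⟨trans⟩_ = trans
  drop-0 : ∀ i → drop i 0 ≡ 0
  drop-0 zero    = refl
  drop-0 (suc i) = trans (cong rgt (drop-0 i)) (n≤0⇒n≡0 (rgt≤ 0))

-- Terms and their codes

module _ {L : Language} where

  mutual
    sub : ∀ {m n} → (Fin n → Term L m) → Term L n → Term L m
    sub s (var i)    = s i
    sub s (app f ts) = app f (subs s ts)

    subs : ∀ {m n k} → (Fin n → Term L m) → Vec (Term L n) k → Vec (Term L m) k
    subs s []       = []
    subs s (t ∷ ts) = sub s t ∷ subs s ts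

  ren : ∀ {m n} → (Fin n → Fin m) → Term L n → Term L m
  ren ρ = sub (var ∘ ρ)

  rens : ∀ {m n k} → (Fin n → Fin m) → Vec (Term L n) k → Vec (Term L m) k
  rens ρ = subs (var ∘ ρ)

  module _ (B : Structure L) {m n : ℕ} {v : Vec (Carrier B) n} {w : Vec (Carrier B) m}
           {s : Fin n → Term L m} (h : ∀ i → eval B w (s i) ≡ lookup v i) where
    mutual
      eval-sub : ∀ t → eval B w (sub s t) ≡ eval B v t
      eval-sub (var i)    = h i
      eval-sub (app f ts) = cong (fun B f) (evals-subs ts)

      evals-subs : ∀ {k} (ts : Vec _ k) → evals B w (subs s ts) ≡ evals B v ts
      evals-subs []       = refl
      evals-subs (t ∷ ts) = cong₂ _∷_ (eval-sub t) (evals-subs ts)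

  module _ {A B : Structure L} (h : Hom A B) {n : ℕ} (v : Vec (Carrier A) n) where
    mutual
      eval-hom : ∀ t → ⟦ h ⟧ (eval A v t) ≡ eval B (map ⟦ h ⟧ v) t
      eval-hom (var i)    = sym (lookup-map i ⟦ h ⟧ v)
      eval-hom (app f ts) = trans (homo h f _) (cong (fun B f) (evals-hom ts))

      evals-hom : ∀ {k} (ts : Vec _ k) → map ⟦ h ⟧ (evals A v ts) ≡ evals B (map ⟦ h ⟧ v) ts
      evals-hom []       = refl
      evals-hom (t ∷ ts) = cong₂ _∷_ (eval-hom t) (evals-hom ts)

  module _ {m n : ℕ} (ρ : Fin n → Fin m) (h : ∀ i → toℕ (ρ i) ≡ toℕ i) where
    mutual
      -- A variable is coded by its position alone, so a renaming that keeps positions keeps codes.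
      ⌜ren⌝ : ∀ t → ⌜ ren ρ t ⌝ᵗ ≡ ⌜ t ⌝ᵗ
      ⌜ren⌝ (var i)    = cong ⟨ 0 ,_⟩ (h i)
      ⌜ren⌝ (app f ts) = cong (λ c → ⟨ 1 , ⟨ toℕ f , c ⟩ ⟩) (⌜rens⌝ ts)

      ⌜rens⌝ : ∀ {k} (ts : Vec _ k) → ⌜ rens ρ ts ⌝ᵗˢ ≡ ⌜ ts ⌝ᵗˢ
      ⌜rens⌝ []       = refl
      ⌜rens⌝ (t ∷ ts) = cong₂ ⟨_,_⟩ (⌜ren⌝ t) (⌜rens⌝ ts)

  tagᵗ bodyᵗ : ∀ {n} → Term L n → ℕ
  tagᵗ (var i)     = 0
  tagᵗ (app f ts)  = 1
  bodyᵗ (var i)    = toℕ i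
  bodyᵗ (app f ts) = ⟨ toℕ f , ⌜ ts ⌝ᵗˢ ⟩

  ⌜⌝ᵗ-tag : ∀ {n} (t : Term L n) → ⌜ t ⌝ᵗ ≡ ⟨ tagᵗ t , bodyᵗ t ⟩
  ⌜⌝ᵗ-tag (var i)    = refl
  ⌜⌝ᵗ-tag (app f ts) = refl

  tagᵠ bodyᵠ : ∀ {n} → QF L n → ℕ
  tagᵠ (s ≐ t)    = 0
  tagᵠ false      = 1
  tagᵠ (not φ)    = 2
  tagᵠ (φ and χ)  = 3
  tagᵠ (φ or χ)   = 4
  bodyᵠ (s ≐ t)   = ⟨ ⌜ s ⌝ᵗ , ⌜ t ⌝ᵗ ⟩
  bodyᵠ false     = 0
  bodyᵠ (not φ)   = ⌜ φ ⌝ᵠ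
  bodyᵠ (φ and χ) = ⟨ ⌜ φ ⌝ᵠ , ⌜ χ ⌝ᵠ ⟩
  bodyᵠ (φ or χ)  = ⟨ ⌜ φ ⌝ᵠ , ⌜ χ ⌝ᵠ ⟩

  ⌜⌝ᵠ-tag : ∀ {n} (φ : QF L n) → ⌜ φ ⌝ᵠ ≡ ⟨ tagᵠ φ , bodyᵠ φ ⟩
  ⌜⌝ᵠ-tag (s ≐ t)   = refl
  ⌜⌝ᵠ-tag false     = refl
  ⌜⌝ᵠ-tag (not φ)   = refl
  ⌜⌝ᵠ-tag (φ and χ) = refl
  ⌜⌝ᵠ-tag (φ or χ)  = refl

  -- Stated for two contexts, as codes do not record the number of variables.
  module _ (B : Structure L) {m n : ℕ} {v : Vec (Carrier B) m} {w : Vec (Carrier B) n}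
           (agree : ∀ i j → toℕ i ≡ toℕ j → lookup v i ≡ lookup w j) where
    private
      tags : ∀ {a b c d x y} → x ≡ ⟨ a , b ⟩ → y ≡ ⟨ c , d ⟩ → x ≡ y → a ≡ c × b ≡ d
      tags p q e = ⟨⟩-injective (trans (sym p) (trans e q))

    mutual
      eval-⌜⌝ : ∀ s t → ⌜ s ⌝ᵗ ≡ ⌜ t ⌝ᵗ → eval B v s ≡ eval B w t
      eval-⌜⌝ s t e = let p , q = tags (⌜⌝ᵗ-tag s) (⌜⌝ᵗ-tag t) e in eval-tag s t p q

      eval-tag : ∀ s t → tagᵗ s ≡ tagᵗ t → bodyᵗ s ≡ bodyᵗ t → eval B v s ≡ eval B w t
      eval-tag (var i)    (var j)    refl e = agree i j e
      eval-tag (app f ts) (app g us) refl e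
        with p , q ← ⟨⟩-injective {toℕ f} {⌜ ts ⌝ᵗˢ} {toℕ g} {⌜ us ⌝ᵗˢ} e
        with refl ← toℕ-injective p = cong (fun B f) (evals-⌜⌝ ts us q)

      evals-⌜⌝ : ∀ {k} (ts : Vec _ k) us → ⌜ ts ⌝ᵗˢ ≡ ⌜ us ⌝ᵗˢ → evals B v ts ≡ evals B w us
      evals-⌜⌝ []       []       e = refl
      evals-⌜⌝ (t ∷ ts) (u ∷ us) e =
        let p , q = ⟨⟩-injective {⌜ t ⌝ᵗ} {⌜ ts ⌝ᵗˢ} {⌜ u ⌝ᵗ} {⌜ us ⌝ᵗˢ} e in
        cong₂ _∷_ (eval-⌜⌝ t u p) (evals-⌜⌝ ts us q)

    mutual
      SatQF-⌜⌝ : ∀ φ χ → ⌜ φ ⌝ᵠ ≡ ⌜ χ ⌝ᵠ → SatQF B v φ ⇔ SatQF B w χ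
      SatQF-⌜⌝ φ χ e = let p , q = tags (⌜⌝ᵠ-tag φ) (⌜⌝ᵠ-tag χ) e in SatQF-tag φ χ p q

      SatQF-tag : ∀ φ χ → tagᵠ φ ≡ tagᵠ χ → bodyᵠ φ ≡ bodyᵠ χ → SatQF B v φ ⇔ SatQF B w χ
      SatQF-tag (s ≐ t)   (s′ ≐ t′)   refl e =
        let p , q = ⟨⟩-injective {⌜ s ⌝ᵗ} {⌜ t ⌝ᵗ} {⌜ s′ ⌝ᵗ} {⌜ t′ ⌝ᵗ} e
            p′ = eval-⌜⌝ s s′ p ; q′ = eval-⌜⌝ t t′ q in
        mk⇔ (λ u → trans (sym p′) (trans u q′)) (λ u → trans p′ (trans u (sym q′)))
      SatQF-tag false     false       refl e = mk⇔ id id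
      SatQF-tag (not φ)   (not φ′)    refl e = let i = SatQF-⌜⌝ φ φ′ e in
        mk⇔ (_∘ from i) (_∘ to i)
      SatQF-tag (φ and χ) (φ′ and χ′) refl e =
        let p , q = ⟨⟩-injective {⌜ φ ⌝ᵠ} {⌜ χ ⌝ᵠ} {⌜ φ′ ⌝ᵠ} {⌜ χ′ ⌝ᵠ} e
            i = SatQF-⌜⌝ φ φ′ p ; j = SatQF-⌜⌝ χ χ′ q in
        mk⇔ (λ (x , y) → to i x , to j y) (λ (x , y) → from i x , from j y)
      SatQF-tag (φ or χ)  (φ′ or χ′)  refl e =
        let p , q = ⟨⟩-injective {⌜ φ ⌝ᵠ} {⌜ χ ⌝ᵠ} {⌜ φ′ ⌝ᵠ} {⌜ χ′ ⌝ᵠ} e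
            i = SatQF-⌜⌝ φ φ′ p ; j = SatQF-⌜⌝ χ χ′ q in
        mk⇔ [ inj₁ ∘ to i , inj₂ ∘ to j ]′ [ inj₁ ∘ from i , inj₂ ∘ from j ]′

-- Evaluation of coded terms in a computable structure

-- Pairing of optional numbers: 0 is "undefined" and `suc x` is the value `x`.
optPair : ℕ → ℕ → ℕ
optPair u v = ifz u 0 (ifz v 0 (suc ⟨ pred u , pred v ⟩))

optPairC : ∀ {f g} → Computable f → Computable g → Computable (λ x → optPair (f x) (g x))
optPairC F G = ifzC F (constC 0) (ifzC G (constC 0) (sucC (pairC (predC F) (predC G))))

dispatch : ∀ {k} → (Fin k → ℕ → ℕ) → ℕ → ℕ → ℕ
dispatch {zero}  G i x = 0
dispatch {suc k} G i x = ifz i (G zero x) (dispatch (G ∘ suc) (pred i) x)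

dispatch-toℕ : ∀ {k} (G : Fin k → ℕ → ℕ) i x → dispatch G (toℕ i) x ≡ G i x
dispatch-toℕ G zero    x = refl
dispatch-toℕ G (suc i) x = dispatch-toℕ (G ∘ suc) i x

dispatch-suc : ∀ {k} (G : Fin k → ℕ → ℕ) i x {v} → dispatch G i x ≡ suc v →
               Σ[ j ∈ Fin k ] toℕ j ≡ i
dispatch-suc {suc k} G zero    x e = zero , refl
dispatch-suc {suc k} G (suc i) x e = let j , p = dispatch-suc (G ∘ suc) i x e in suc j , cong suc p

dispatch-local : ∀ {k} (G H : Fin k → ℕ → ℕ) i x → (∀ j → G j x ≡ H j x) → dispatch G i x ≡ dispatch H i x
dispatch-local {zero}  G H i       x h = refl
dispatch-local {suc k} G H zero    x h = h zero
dispatch-local {suc k} G H (suc i) x h = dispatch-local (G ∘ suc) (H ∘ suc) i x (h ∘ suc)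

args : (ℕ → ℕ) → ℕ → ℕ → ℕ
-- A list of terms has to end in exactly 0; any other end makes it undefined.
args r zero    ts = ifz ts 1 0
args r (suc k) ts = optPair (r (lft ts)) (args r k (rgt ts))

args-local : ∀ {r r′} k ts → (∀ {i} → i ≤ ts → r i ≡ r′ i) → args r k ts ≡ args r′ k ts
args-local zero    ts h = refl
args-local (suc k) ts h = cong₂ optPair (h (lft≤ ts)) (args-local k (rgt ts) λ l → h (≤-trans l (rgt≤ ts)))

module Evaluator {L : Language} (A : ComputableStructure L) where

  private
    𝔸 = structure A
    E = Elem A

  -- Numbers outside the domain decode to the default `element A`, which makes the decoding of
  -- tuples total.
  elemBool : ∀ x b → domain A x ≡ b → E
  elemBool x true  e = x , subst T (sym e) _
  elemBool x false e = element A

  elem : ℕ → E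
  elem x = elemBool x (domain A x) refl

  proj₁-injective : ∀ {x y : E} → proj₁ x ≡ proj₁ y → x ≡ y
  proj₁-injective {x , p} {_ , q} refl = cong (x ,_) (T-irrelevant p q)

  elem-proj₁ : ∀ y → elem (proj₁ y) ≡ y
  elem-proj₁ (x , t) = go (domain A x) refl
    where
    go : ∀ b (e : domain A x ≡ b) → elemBool x b e ≡ (x , t)
    go true  e = proj₁-injective refl
    go false e = ⊥-elim (subst T e t)

  elemC : Computable (proj₁ ∘ elem)
  elemC = computable-≗ (λ x → eq x (domain A x) refl)
    (ifzC (testC D) idC (constC (proj₁ (element A))))
    where
    D : Decidable (λ x → T (domain A x))
    D = ComputableSet⇒Decidable (domain-computable A)
    eq : ∀ x b (e : domain A x ≡ b) →
         ifz (test D x) x (proj₁ (element A)) ≡ proj₁ (elemBool x b e)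
    eq x true  e rewrite to (true⇔0 D x) (subst T (sym e) _) = refl
    eq x false e with test D x in p
    ... | zero  = ⊥-elim (subst T e (from (true⇔0 D x) p))
    ... | suc _ = refl

  tuple : ∀ {n} → Vec E n → ℕ
  tuple v = ⌜ map proj₁ v ⌝ᵛ

  untuple : ∀ n → ℕ → Vec E n
  untuple zero    k = []
  untuple (suc n) k = elem (lft k) ∷ untuple n (rgt k)

  untuple-tuple : ∀ {n} (v : Vec E n) → untuple n (tuple v) ≡ v
  untuple-tuple []       = refl
  untuple-tuple {suc n} (x ∷ v) = cong₂ _∷_
    (trans (cong elem (lft-⟨⟩ (proj₁ x) (tuple v))) (elem-proj₁ x))
    (trans (cong (untuple n) (rgt-⟨⟩ (proj₁ x) (tuple v))) (untuple-tuple v))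

  tuple-injective : ∀ {n} {v w : Vec E n} → tuple v ≡ tuple w → v ≡ w
  tuple-injective {n} {v} {w} e =
    trans (sym (untuple-tuple v)) (trans (cong (untuple n) e) (untuple-tuple w))

  record TupleC {n} (u : ℕ → Vec E n) : Set where
    constructor tupleC
    field tupled : Computable (λ x → tuple (u x))

  open TupleC public

  untupleC : ∀ n {f} → Computable f → TupleC (λ x → untuple n (f x))
  untupleC n F = tupleC (go n F)
    where
    go : ∀ n {f} → Computable f → Computable (λ x → tuple (untuple n (f x)))
    go zero    F = constC 0
    go (suc n) F = pairC (compC elemC (lftC F)) (go n (rgtC F))

  opC : ∀ {f u} → TupleC u → Computable (λ x → proj₁ (op A f (u x)))
  opC {f} {u} (tupleC U) = computable (compᶜ c (code U)) λ x → ↓comp (halts U x) (h (u x))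
    where
    c = proj₁ (op-computable A f)
    h = proj₂ (op-computable A f)

  lookupC : ∀ {n} {u : ℕ → Vec E n} → TupleC u → ∀ i → Computable (λ x → proj₁ (lookup (u x) i))
  lookupC {u = u} U i = computable-≗ (λ x → eq (u x) i)
    (app₂ nthC (tupled U) (constC (toℕ i)))
    where
    eq : ∀ {n} (v : Vec E n) i → nth (tuple v) (toℕ i) ≡ proj₁ (lookup v i)
    eq (x ∷ v) zero    = lft-⟨⟩ (proj₁ x) (tuple v)
    eq (x ∷ v) (suc i) = trans (nth-⟨⟩-suc (proj₁ x) (tuple v) (toℕ i)) (eq v i)

  module _ {n : ℕ} {u : ℕ → Vec E n} (U : TupleC u) where
    mutual
      evalC : ∀ t → Computable (λ x → proj₁ (eval 𝔸 (u x) t))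
      evalC (var i)    = lookupC U i
      evalC (app f ts) = opC (evalsC ts)

      evalsC : ∀ {k} (ts : Vec (Term L n) k) → TupleC (λ x → evals 𝔸 (u x) ts)
      evalsC []       = tupleC (constC 0)
      evalsC (t ∷ ts) = tupleC (pairC (evalC t) (tupled (evalsC ts)))

    SatQF-Decidable : ∀ φ → Decidable (λ x → SatQF 𝔸 (u x) φ)
    SatQF-Decidable (s ≐ t) = let decidable T e = ≡-Decidable (evalC s) (evalC t) in
      decidable T λ x → mk⇔ (to (e x) ∘ cong proj₁) (proj₁-injective ∘ from (e x))
    SatQF-Decidable false     = decidable (constC 1) λ x → mk⇔ (λ ()) (λ ())
    SatQF-Decidable (not φ)   = ¬-Decidable (SatQF-Decidable φ)
    SatQF-Decidable (φ and χ) = SatQF-Decidable φ ×-Decidable SatQF-Decidable χ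
    SatQF-Decidable (φ or χ)  = SatQF-Decidable φ ⊎-Decidable SatQF-Decidable χ

    SatEquations-Decidable : ∀ es → Decidable (λ x → SatEquations 𝔸 (u x) es)
    SatEquations-Decidable [] = decidable (constC 0) λ x → mk⇔ (λ _ → refl) (λ _ → [])
    SatEquations-Decidable ((s , t) ∷ es) =
      let decidable T e = SatQF-Decidable (s ≐ t) ×-Decidable SatEquations-Decidable es in
      decidable T λ x → mk⇔ (λ { (p ∷ ps) → to (e x) (p , ps) })
                            (λ q → let p , ps = from (e x) q in p ∷ ps)

  -- An assignment is coded as the list of the successors of its values,
  -- so that 0 stands for "undefined", in particular beyond its length.
  extend : ℕ → ℕ → ℕ → ℕ
  extend zero    k e = e
  extend (suc n) k e = ⟨ suc (lft k) , extend n (rgt k) e ⟩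

  extendC : ∀ n {f g} → Computable f → Computable g → Computable (λ x → extend n (f x) (g x))
  extendC zero    F G = G
  extendC (suc n) F G = pairC (sucC (lftC F)) (extendC n (rgtC F) G)

  assign : ∀ {n} → Vec E n → ℕ
  assign []      = 0
  assign (x ∷ v) = ⟨ suc (proj₁ x) , assign v ⟩

  extend-assign : ∀ {m n} (v : Vec E m) (w : Vec E n) → extend m (tuple v) (assign w) ≡ assign (v ++ w)
  extend-assign []      w = refl
  extend-assign {suc m} (x ∷ v) w = cong₂ ⟨_,_⟩
    (cong suc (lft-⟨⟩ (proj₁ x) (tuple v)))
    (trans (cong (λ k → extend m k (assign w)) (rgt-⟨⟩ (proj₁ x) (tuple v))) (extend-assign v w))

  assignC : ∀ {n} {u : ℕ → Vec E n} → TupleC u → Computable (λ x → assign (u x))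
  assignC {n} {u} U = computable-≗ (λ x → eq (u x)) (extendC n (tupled U) (constC 0))
    where
    eq : ∀ {n} (v : Vec E n) → extend n (tuple v) 0 ≡ assign v
    eq []      = refl
    eq {suc n} (x ∷ v) = cong₂ ⟨_,_⟩ (cong suc (lft-⟨⟩ (proj₁ x) (tuple v)))
      (trans (cong (λ k → extend n k 0) (rgt-⟨⟩ (proj₁ x) (tuple v))) (eq v))

  -- The length `m` is an input here, because the members of a c.e. formula have varying numbers of
  -- quantified variables. A primitive recursion builds the list from its last entry to its first.
  assign-untupleC : Computable₂ (λ m w → assign (untuple m w))
  assign-untupleC = computable₂ (computable-≗ (λ x → done (lft x) (rgt x))
    (app₂ (primrecC {g = step} (constC 0)
             (pairC (sucC (compC elemC (lftC (app₂ dropC (app₂ ∸C₂ (rgtC #a) (sucC #n)) (lftC #a))))) #y))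
          (pairC #1 #0) #0))
    where
    step : ℕ → ℕ → ℕ → ℕ
    step p j y = ⟨ suc (proj₁ (elem (lft (drop (rgt p ∸ suc j) (lft p))))) , y ⟩
    go : ∀ m w j → j ≤ m → primrec (λ _ → 0) step ⟨ w , m ⟩ j ≡ assign (untuple j (drop (m ∸ j) w))
    go m w zero    l = refl
    go m w (suc j) l = cong₂ ⟨_,_⟩
      (cong₂ (λ a b → suc (proj₁ (elem (lft (drop (a ∸ suc j) b))))) (rgt-⟨⟩ w m) (lft-⟨⟩ w m))
      (trans (go m w j (≤-trans (n≤1+n j) l))
        (cong (λ i → assign (untuple j (drop i w))) (+-∸-assoc 1 l)))
    done : ∀ m w → primrec (λ _ → 0) step ⟨ w , m ⟩ m ≡ assign (untuple m w)
    done m w = trans (go m w m ≤-refl) (cong (λ i → assign (untuple m (drop i w))) (n∸n≡0 m))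

  nth-assign : ∀ {n} (v : Vec E n) i → nth (assign v) (toℕ i) ≡ suc (proj₁ (lookup v i))
  nth-assign (x ∷ v) zero    = lft-⟨⟩ (suc (proj₁ x)) (assign v)
  nth-assign (x ∷ v) (suc i) = trans (nth-⟨⟩-suc (suc (proj₁ x)) (assign v) (toℕ i)) (nth-assign v i)

  nth-assign⁻ : ∀ {n} (v : Vec E n) i {y} → nth (assign v) i ≡ suc y → Σ[ j ∈ Fin n ] toℕ j ≡ i
  nth-assign⁻ [] i e = case trans (sym e) (nth-0 i) of λ ()
  nth-assign⁻ (x ∷ v) zero    e = zero , refl
  nth-assign⁻ (x ∷ v) (suc i) e =
    let j , p = nth-assign⁻ v i (trans (sym (nth-⟨⟩-suc (suc (proj₁ x)) (assign v) i)) e) in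
    suc j , cong suc p

  -- Option-valued evaluation: 0 if the argument is not the code of a term
  -- whose variables are all defined.
  applyOp : (f : Fin (size L)) → ℕ → ℕ
  applyOp f u = ifz u 0 (suc (proj₁ (op A f (untuple (arity L f) (pred u)))))

  applyOpC : ∀ f {g} → Computable g → Computable (λ x → applyOp f (g x))
  applyOpC f G = ifzC G (constC 0) (sucC (opC {f} (untupleC (arity L f) (predC G))))

  applyTerm : (ℕ → ℕ) → Fin (size L) → ℕ → ℕ
  applyTerm r f ts = applyOp f (args r (arity L f) ts)

  termStep : ℕ → ℕ → (ℕ → ℕ) → ℕ
  termStep e n r = ifz (lft n) (nth e (rgt n))
    (ifz (pred (lft n)) (dispatch (applyTerm r) (lft (rgt n)) (rgt (rgt n))) 0)

  termStep-local : ∀ e n r r′ → (∀ {i} → i < n → r i ≡ r′ i) → termStep e n r ≡ termStep e n r′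
  termStep-local e n r r′ h with lft n in p
  ... | zero        = refl
  ... | suc (suc _) = refl
  ... | suc zero    = dispatch-local (applyTerm r) (applyTerm r′) (lft (rgt n)) (rgt (rgt n))
    λ f → cong (applyOp f) (args-local (arity L f) (rgt (rgt n))
      λ l → h (≤-<-trans (≤-trans l (rgt≤ (rgt n))) (rgt< n p)))

  argsC : ∀ {r : ℕ → ℕ → ℕ} → Computable₂ r → ∀ k {g} → Computable g → Computable (λ x → args (r x) k (g x))
  argsC R zero    G = ifzC G (constC 1) (constC 0)
  argsC R (suc k) G = optPairC (app₂ R idC (lftC G)) (argsC R k (rgtC G))

  dispatchC : ∀ {k} {H : ℕ → Fin k → ℕ → ℕ} {g h} →
    (∀ f {k} → Computable k → Computable (λ x → H x f (k x))) →
    Computable g → Computable h → Computable (λ x → dispatch (H x) (g x) (h x))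
  dispatchC {zero}  HC G K = constC 0
  dispatchC {suc k} HC G K = ifzC G (HC zero K) (dispatchC (HC ∘ suc) (predC G) K)

  recallC : Computable₂ (λ x i → lft (drop (lft (rgt x) ∸ suc i) (rgt (rgt x))))
  recallC = computable₂ (lftC (app₂ dropC (app₂ ∸C₂ (lftC (rgtC #0)) (sucC #1)) (rgtC (rgtC #0))))

  open CourseOfValues termStep public using () renaming (value to evalCode)

  abstract
    evalCodeC : Computable₂ evalCode
    evalCodeC = CourseOfValues.valueC termStep
      (ifzC (lftC #n) (app₂ nthC #a (rgtC #n)) (ifzC (predC (lftC #n))
        (dispatchC {H = λ x → applyTerm (λ i → lft (drop (lft (rgt x) ∸ suc i) (rgt (rgt x))))}
          (λ f K → applyOpC f (argsC recallC (arity L f) K))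
          (lftC (rgtC #n)) (rgtC (rgtC #n))) (constC 0)))

  evalCode-unfold : ∀ e n → evalCode e n ≡ termStep e n (evalCode e)
  evalCode-unfold = CourseOfValues.unfold termStep termStep-local

  module _ {m n : ℕ} (ρ : Fin n → Fin m) (e : ℕ) where

    Defines : Vec E n → Set
    Defines v = ∀ i → nth e (toℕ (ρ i)) ≡ suc (proj₁ (lookup v i))

    module _ {v : Vec E n} (h : Defines v) where
      mutual
        -- The assignment only has to define the positions `ρ i`. This is applied with `ρ = id` and,
        -- for the Scott sentence, to terms in a later block of variables.
        evalCode-complete : ∀ t → evalCode e ⌜ ren ρ t ⌝ᵗ ≡ suc (proj₁ (eval 𝔸 v t))
        evalCode-complete (var i) =
          trans (evalCode-unfold e ⟨ 0 , toℕ (ρ i) ⟩)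
            (trans (cong₂ (λ a b → ifz a (nth e b) (ifz (pred a)
                     (dispatch (applyTerm (evalCode e)) (lft b) (rgt b)) 0))
                     (lft-⟨⟩ 0 (toℕ (ρ i))) (rgt-⟨⟩ 0 (toℕ (ρ i)))) (h i))
        evalCode-complete (app f ts) =
          let us = ⌜ rens ρ ts ⌝ᵗˢ
              fs = ⟨ toℕ f , us ⟩
              c  = ⟨ 1 , fs ⟩
          in trans (evalCode-unfold e c)
            (trans (cong₂ (λ a b → ifz a (nth e b) (ifz (pred a)
                     (dispatch (applyTerm (evalCode e)) (lft b) (rgt b)) 0)) (lft-⟨⟩ 1 fs) (rgt-⟨⟩ 1 fs))
            (trans (cong₂ (dispatch (applyTerm (evalCode e))) (lft-⟨⟩ (toℕ f) us) (rgt-⟨⟩ (toℕ f) us))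
            (trans (dispatch-toℕ (applyTerm (evalCode e)) f us)
            (trans (cong (applyOp f) (args-complete ts))
              (cong (λ w → suc (proj₁ (op A f w))) (untuple-tuple (evals 𝔸 v ts)))))))

        args-complete : ∀ {k} (ts : Vec (Term L n) k) →
          args (evalCode e) k ⌜ rens ρ ts ⌝ᵗˢ ≡ suc (tuple (evals 𝔸 v ts))
        args-complete [] = refl
        args-complete {suc k} (t ∷ ts) =
          let c = ⌜ ren ρ t ⌝ᵗ ; d = ⌜ rens ρ ts ⌝ᵗˢ in
          trans (cong₂ (λ a b → optPair (evalCode e a) (args (evalCode e) k b)) (lft-⟨⟩ c d) (rgt-⟨⟩ c d))
            (cong₂ optPair (evalCode-complete t) (args-complete ts))

    module _ (h : ∀ (i : ℕ) {y : ℕ} → nth e i ≡ suc y → Σ[ j ∈ Fin n ] toℕ (ρ j) ≡ i) where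

      SoundAt : ℕ → Set
      SoundAt c = ∀ {y} → evalCode e c ≡ suc y → Σ[ t ∈ Term L n ] ⌜ ren ρ t ⌝ᵗ ≡ c

      args-sound-below : ∀ k c → (∀ {i} → i ≤ c → SoundAt i) → ∀ {y} → args (evalCode e) k c ≡ suc y →
        Σ[ ts ∈ Vec (Term L n) k ] ⌜ rens ρ ts ⌝ᵗˢ ≡ c
      args-sound-below zero    zero s p = [] , refl
      args-sound-below (suc k) c s p with evalCode e (lft c) in p₁
      ... | suc u with args (evalCode e) k (rgt c) in p₂
      ... | suc v = let t , q₁ = s (lft≤ c) p₁
                        ts , q₂ = args-sound-below k (rgt c) (λ l → s (≤-trans l (rgt≤ c))) p₂
                    in t ∷ ts , trans (cong₂ ⟨_,_⟩ q₁ q₂) (pair-unpair c)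

      -- Strong induction on the code: a defined value means that every symbol and every argument
      -- list was recognised, so the term can be rebuilt.
      evalCode-sound : ∀ c → SoundAt c
      evalCode-sound = <-rec SoundAt λ c rec p →
        step c (λ l → rec l) (trans (sym (evalCode-unfold e c)) p)
        where
        step : ∀ c → (∀ {i} → i < c → SoundAt i) → ∀ {y} → termStep e c (evalCode e) ≡ suc y →
          Σ[ t ∈ Term L n ] ⌜ ren ρ t ⌝ᵗ ≡ c
        step c rec p with lft c in q
        ... | zero = let j , r = h (rgt c) p in
          var j , trans (cong₂ ⟨_,_⟩ (sym q) r) (pair-unpair c)
        ... | suc zero with f , r ← dispatch-suc (applyTerm (evalCode e)) (lft (rgt c)) _ p
          -- The second proof says that `applyOp` is nonzero, which excludes undefined arguments.
          with args (evalCode e) (arity L f) (rgt (rgt c)) in s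
             | trans (sym (dispatch-toℕ (applyTerm (evalCode e)) f (rgt (rgt c))))
                     (trans (cong (λ i → dispatch (applyTerm (evalCode e)) i (rgt (rgt c))) r) p)
        ... | suc v | _ =
          let ts , u = args-sound-below (arity L f) (rgt (rgt c))
                         (λ l → rec (≤-<-trans (≤-trans l (rgt≤ (rgt c))) (rgt< c q))) s
          in app f ts , trans (cong₂ ⟨_,_⟩ (sym q) (trans (cong₂ ⟨_,_⟩ r u) (pair-unpair (rgt c)))) (pair-unpair c)

      args-sound : ∀ k c {y} → args (evalCode e) k c ≡ suc y →
        Σ[ ts ∈ Vec (Term L n) k ] ⌜ rens ρ ts ⌝ᵗˢ ≡ c
      args-sound k c = args-sound-below k c (λ _ → evalCode-sound _)

-- Evaluation of coded quantifier-free formulas; the values 0, 1 and 2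
-- stand for "not a formula", "false" and "true".

data Truth (P : Set) : ℕ → Set where
  isFalse : ¬ P → Truth P 1
  isTrue  : P → Truth P 2

notᵇ : ℕ → ℕ
notᵇ u = ifz u 0 (ifz (pred u) 2 1)

andᵇ orᵇ eqᵇ : ℕ → ℕ → ℕ
andᵇ u v = ifz u 0 (ifz v 0 (ifz (pred u) 1 v))
orᵇ  u v = ifz u 0 (ifz v 0 (ifz (pred u) v 2))
eqᵇ  u v = ifz u 0 (ifz v 0 (ifz (neq u v) 2 1))

notᵇC : ∀ {f} → Computable f → Computable (λ x → notᵇ (f x))
notᵇC U = ifzC U (constC 0) (ifzC (predC U) (constC 2) (constC 1))

andᵇC : ∀ {f g} → Computable f → Computable g → Computable (λ x → andᵇ (f x) (g x))
andᵇC U V = ifzC U (constC 0) (ifzC V (constC 0) (ifzC (predC U) (constC 1) V))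

orᵇC : ∀ {f g} → Computable f → Computable g → Computable (λ x → orᵇ (f x) (g x))
orᵇC U V = ifzC U (constC 0) (ifzC V (constC 0) (ifzC (predC U) V (constC 2)))

eqᵇC : ∀ {f g} → Computable f → Computable g → Computable (λ x → eqᵇ (f x) (g x))
eqᵇC U V = ifzC U (constC 0) (ifzC V (constC 0) (ifzC (neqC U V) (constC 2) (constC 1)))

truth-not : ∀ {P u} → Truth P u → Truth (¬ P) (notᵇ u)
truth-not (isFalse ¬p) = isTrue ¬p
truth-not (isTrue p)   = isFalse (λ ¬p → ¬p p)

module _ {P Q : Set} where

  truth-and : ∀ {u v} → Truth P u → Truth Q v → Truth (P × Q) (andᵇ u v)
  truth-and (isFalse ¬p) (isFalse ¬q) = isFalse (¬p ∘ proj₁)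
  truth-and (isFalse ¬p) (isTrue q)   = isFalse (¬p ∘ proj₁)
  truth-and (isTrue p)   (isFalse ¬q) = isFalse (¬q ∘ proj₂)
  truth-and (isTrue p)   (isTrue q)   = isTrue (p , q)

  truth-or : ∀ {u v} → Truth P u → Truth Q v → Truth (P ⊎ Q) (orᵇ u v)
  truth-or (isFalse ¬p) (isFalse ¬q) = isFalse [ ¬p , ¬q ]′
  truth-or (isFalse ¬p) (isTrue q)   = isTrue (inj₂ q)
  truth-or (isTrue p)   (isFalse ¬q) = isTrue (inj₁ p)
  truth-or (isTrue p)   (isTrue q)   = isTrue (inj₁ p)

defined : ℕ → Set
defined u = ∃[ k ] u ≡ suc k

notᵇ-defined : ∀ u {y} → notᵇ u ≡ suc y → defined u
notᵇ-defined (suc u) _ = u , refl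

andᵇ-defined : ∀ u v {y} → andᵇ u v ≡ suc y → defined u × defined v
andᵇ-defined (suc u) (suc v) _ = (u , refl) , (v , refl)

orᵇ-defined : ∀ u v {y} → orᵇ u v ≡ suc y → defined u × defined v
orᵇ-defined (suc u) (suc v) _ = (u , refl) , (v , refl)

eqᵇ-defined : ∀ u v {y} → eqᵇ u v ≡ suc y → defined u × defined v
eqᵇ-defined (suc u) (suc v) _ = (u , refl) , (v , refl)

truth-eq : ∀ m n → Truth (m ≡ n) (eqᵇ (suc m) (suc n))
truth-eq m n with neq m n in e
... | zero  = isTrue (neq⇒≡ e)
... | suc _ = isFalse λ { refl → case trans (sym e) (neq-refl m) of λ () }

truth-map : ∀ {P Q u} → P ⇔ Q → Truth P u → Truth Q u
truth-map i (isFalse ¬p) = isFalse (¬p ∘ from i)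
truth-map i (isTrue p)   = isTrue (to i p)

truth-2 : ∀ {P u} → Truth P u → P ⇔ u ≡ 2
truth-2 (isFalse ¬p) = mk⇔ (⊥-elim ∘ ¬p) (λ ())
truth-2 (isTrue p)   = mk⇔ (λ _ → refl) (λ _ → p)

truth-1 : ∀ {P u} → Truth P u → (¬ P) ⇔ u ≡ 1
truth-1 (isFalse ¬p) = mk⇔ (λ _ → refl) (λ _ → ¬p)
truth-1 (isTrue p)   = mk⇔ (λ ¬p → ⊥-elim (¬p p)) (λ ())

module QFEvaluator {L : Language} (A : ComputableStructure L) where

  open Evaluator A
  private
    𝔸 = structure A
    E = Elem A

  qfTag : ℕ → ℕ → ℕ → (ℕ → ℕ) → ℕ
  qfTag t e b r =
    ifz t (eqᵇ (evalCode e (lft b)) (evalCode e (rgt b)))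
    (ifz (pred t) (ifz b 1 0)
    (ifz (pred (pred t)) (notᵇ (r b))
    (ifz (pred (pred (pred t))) (andᵇ (r (lft b)) (r (rgt b)))
    (ifz (pred (pred (pred (pred t)))) (orᵇ (r (lft b)) (r (rgt b))) 0))))

  qfStep : ℕ → ℕ → (ℕ → ℕ) → ℕ
  qfStep e n r = qfTag (lft n) e (rgt n) r

  qfStep-local : ∀ e n r r′ → (∀ {i} → i < n → r i ≡ r′ i) → qfStep e n r ≡ qfStep e n r′
  qfStep-local e n r r′ h with lft n in p
  ... | 0 = refl
  ... | 1 = refl
  ... | 2 = cong notᵇ (h (rgt< n p))
  ... | 3 = cong₂ andᵇ (h (≤-<-trans (lft≤ _) (rgt< n p))) (h (≤-<-trans (rgt≤ _) (rgt< n p)))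
  ... | 4 = cong₂ orᵇ (h (≤-<-trans (lft≤ _) (rgt< n p))) (h (≤-<-trans (rgt≤ _) (rgt< n p)))
  ... | suc (suc (suc (suc (suc _)))) = refl

  open CourseOfValues qfStep public using () renaming (value to satCode)

  abstract
    satCodeC : Computable₂ satCode
    satCodeC = CourseOfValues.valueC qfStep
      (let t = lftC #n ; b = rgtC #n
           r = λ {g} (G : Computable g) → app₂ recallC idC G
           u = r (lftC b) ; v = r (rgtC b) in
       ifzC t (eqᵇC (app₂ evalCodeC #a (lftC b)) (app₂ evalCodeC #a (rgtC b)))
       (ifzC (predC t) (ifzC b (constC 1) (constC 0))
       (ifzC (predC (predC t)) (notᵇC (r b))
       (ifzC (predC (predC (predC t))) (andᵇC u v)
       (ifzC (predC (predC (predC (predC t)))) (orᵇC u v) (constC 0))))))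

  satCode-unfold : ∀ e n → satCode e n ≡ qfStep e n (satCode e)
  satCode-unfold = CourseOfValues.unfold qfStep qfStep-local

  module _ {n : ℕ} (v : Vec E n) where
    private
      e = assign v

    evalCode-⌜⌝ : ∀ t → evalCode e ⌜ t ⌝ᵗ ≡ suc (proj₁ (eval 𝔸 v t))
    evalCode-⌜⌝ t = trans (cong (evalCode e) (sym (⌜ren⌝ id (λ _ → refl) t)))
      (evalCode-complete id e (nth-assign v) t)

    satCode-tag : ∀ t b → satCode e ⟨ t , b ⟩ ≡ qfTag t e b (satCode e)
    satCode-tag t b = trans (satCode-unfold e ⟨ t , b ⟩)
      (cong₂ (λ t b → qfTag t e b (satCode e)) (lft-⟨⟩ t b) (rgt-⟨⟩ t b))

    satCode-complete : ∀ φ → Truth (SatQF 𝔸 v φ) (satCode e ⌜ φ ⌝ᵠ)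
    satCode-complete (s ≐ t) = subst (Truth _)
      (sym (trans (satCode-tag 0 ⟨ ⌜ s ⌝ᵗ , ⌜ t ⌝ᵗ ⟩) (cong₂ eqᵇ
        (trans (cong (evalCode e) (lft-⟨⟩ ⌜ s ⌝ᵗ ⌜ t ⌝ᵗ)) (evalCode-⌜⌝ s))
        (trans (cong (evalCode e) (rgt-⟨⟩ ⌜ s ⌝ᵗ ⌜ t ⌝ᵗ)) (evalCode-⌜⌝ t)))))
      (truth-map (mk⇔ proj₁-injective (cong proj₁)) (truth-eq _ _))
    satCode-complete false = subst (Truth _) (sym (satCode-tag 1 0)) (isFalse id)
    satCode-complete (not φ) = subst (Truth _) (sym (satCode-tag 2 ⌜ φ ⌝ᵠ)) (truth-not (satCode-complete φ))
    satCode-complete (φ and χ) = subst (Truth _)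
      (sym (trans (satCode-tag 3 ⟨ ⌜ φ ⌝ᵠ , ⌜ χ ⌝ᵠ ⟩)
        (cong₂ (λ a b → andᵇ (satCode e a) (satCode e b)) (lft-⟨⟩ ⌜ φ ⌝ᵠ ⌜ χ ⌝ᵠ) (rgt-⟨⟩ ⌜ φ ⌝ᵠ ⌜ χ ⌝ᵠ))))
      (truth-and (satCode-complete φ) (satCode-complete χ))
    satCode-complete (φ or χ) = subst (Truth _)
      (sym (trans (satCode-tag 4 ⟨ ⌜ φ ⌝ᵠ , ⌜ χ ⌝ᵠ ⟩)
        (cong₂ (λ a b → orᵇ (satCode e a) (satCode e b)) (lft-⟨⟩ ⌜ φ ⌝ᵠ ⌜ χ ⌝ᵠ) (rgt-⟨⟩ ⌜ φ ⌝ᵠ ⌜ χ ⌝ᵠ))))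
      (truth-or (satCode-complete φ) (satCode-complete χ))

    evalCode-term : ∀ c {y} → evalCode e c ≡ suc y → Σ[ t ∈ Term L n ] ⌜ t ⌝ᵗ ≡ c
    evalCode-term c p = let t , q = evalCode-sound id e (λ i → nth-assign⁻ v i) c p in
      t , trans (sym (⌜ren⌝ id (λ _ → refl) t)) q

    SatSoundAt : ℕ → Set
    SatSoundAt c = ∀ {y} → satCode e c ≡ suc y → Σ[ φ ∈ QF L n ] ⌜ φ ⌝ᵠ ≡ c

    pair-sound : ∀ b → (∀ {i} → i ≤ b → SatSoundAt i) →
      defined (satCode e (lft b)) × defined (satCode e (rgt b)) →
      Σ[ φ ∈ QF L n ] Σ[ χ ∈ QF L n ] ⟨ ⌜ φ ⌝ᵠ , ⌜ χ ⌝ᵠ ⟩ ≡ b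
    pair-sound b h ((_ , p) , (_ , q)) =
      let φ , p′ = h (lft≤ b) p ; χ , q′ = h (rgt≤ b) q in
      φ , χ , trans (cong₂ ⟨_,_⟩ p′ q′) (pair-unpair b)

    qfTag-sound : ∀ t b → (∀ {k} → t ≡ suc k → ∀ {i} → i ≤ b → SatSoundAt i) →
      ∀ {y} → qfTag t e b (satCode e) ≡ suc y → Σ[ φ ∈ QF L n ] ⌜ φ ⌝ᵠ ≡ ⟨ t , b ⟩
    qfTag-sound 0 b h p =
      let (_ , p₁) , (_ , p₂) = eqᵇ-defined _ _ p
          s , q₁ = evalCode-term (lft b) p₁ ; t , q₂ = evalCode-term (rgt b) p₂ in
      s ≐ t , cong ⟨ 0 ,_⟩ (trans (cong₂ ⟨_,_⟩ q₁ q₂) (pair-unpair b))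
    qfTag-sound 1 zero h p = false , refl
    qfTag-sound 2 b h p = let _ , p₁ = notᵇ-defined _ p ; φ , q = h refl ≤-refl p₁ in
      not φ , cong ⟨ 2 ,_⟩ q
    qfTag-sound 3 b h p = let φ , χ , q = pair-sound b (h refl) (andᵇ-defined _ _ p) in
      φ and χ , cong ⟨ 3 ,_⟩ q
    qfTag-sound 4 b h p = let φ , χ , q = pair-sound b (h refl) (orᵇ-defined _ _ p) in
      φ or χ , cong ⟨ 4 ,_⟩ q

    satCode-sound : ∀ c → SatSoundAt c
    satCode-sound = <-rec SatSoundAt λ c rec p →
      let φ , q = qfTag-sound (lft c) (rgt c) (λ t l → rec (≤-<-trans l (rgt< c t)))
                    (trans (sym (satCode-unfold e c)) p)
      in φ , trans q (pair-unpair c)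

    args-⌜⌝ : ∀ {k} (ts : Vec (Term L n) k) →
      args (evalCode e) k ⌜ ts ⌝ᵗˢ ≡ suc (tuple (evals 𝔸 v ts))
    args-⌜⌝ {k} ts = trans (cong (args (evalCode e) k) (sym (⌜rens⌝ id (λ _ → refl) ts)))
      (args-complete id e (nth-assign v) ts)

    args-terms : ∀ k c {y} → args (evalCode e) k c ≡ suc y → Σ[ ts ∈ Vec (Term L n) k ] ⌜ ts ⌝ᵗˢ ≡ c
    args-terms k c p = let ts , q = args-sound id e (λ i → nth-assign⁻ v i) k c p in
      ts , trans (sym (⌜rens⌝ id (λ _ → refl) ts)) q

-- Homomorphisms, satisfaction and presentations

module _ {L : Language} where

  surjective : ∀ {A B : Structure L} (h : Hom A B) → (∀ y → ∃[ x ] ⟦ h ⟧ x ≡ y) →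
               Surjective _≡_ _≡_ ⟦ h ⟧
  surjective h s y = let x , e = s y in x , λ { refl → e }

  module _ {A B : Structure L} (h : Hom A B) (iso : IsIso h) where

    inv : Carrier B → Carrier A
    inv y = proj₁ (proj₂ iso y)

    ⟦⟧-inv : ∀ y → ⟦ h ⟧ (inv y) ≡ y
    ⟦⟧-inv y = proj₂ (proj₂ iso y) refl

    map-inv : ∀ {n} (ys : Vec _ n) → map ⟦ h ⟧ (map inv ys) ≡ ys
    map-inv []       = refl
    map-inv (y ∷ ys) = cong₂ _∷_ (⟦⟧-inv y) (map-inv ys)

    inv-map : ∀ {n} (xs : Vec _ n) → map inv (map ⟦ h ⟧ xs) ≡ xs
    inv-map []       = refl
    inv-map (x ∷ xs) = cong₂ _∷_ (proj₁ iso (⟦⟧-inv _)) (inv-map xs)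

    invHom : Hom B A
    invHom = record
      { ⟦_⟧  = inv
      ; homo = λ f v → proj₁ iso (trans (⟦⟧-inv _) (trans
          (cong (fun B f) (sym (map-inv v))) (sym (homo h f _)))) }

    SatQF-iso : ∀ {n} (v : Vec _ n) φ → SatQF A v φ ⇔ SatQF B (map ⟦ h ⟧ v) φ
    SatQF-iso v (s ≐ t) = mk⇔
      (λ e → trans (sym (eval-hom h v s)) (trans (cong ⟦ h ⟧ e) (eval-hom h v t)))
      (λ e → proj₁ iso (trans (eval-hom h v s) (trans e (sym (eval-hom h v t)))))
    SatQF-iso v false     = mk⇔ id id
    SatQF-iso v (not φ)   = let i = SatQF-iso v φ in mk⇔ (_∘ from i) (_∘ to i)
    SatQF-iso v (φ and χ) = let i = SatQF-iso v φ ; j = SatQF-iso v χ in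
      mk⇔ (λ (x , y) → to i x , to j y) (λ (x , y) → from i x , from j y)
    SatQF-iso v (φ or χ)  = let i = SatQF-iso v φ ; j = SatQF-iso v χ in
      mk⇔ [ inj₁ ∘ to i , inj₂ ∘ to j ]′ [ inj₁ ∘ from i , inj₂ ∘ from j ]′

    -- Existential witnesses are pushed forward along `h`, and universally quantified elements are
    -- pulled back along its inverse.
    Sat-iso : ∀ {κ α n} {φ : Formula L κ α n} {v} → Sat A φ v → Sat B φ (map ⟦ h ⟧ v)
    Sat-iso (sat-qf s) = sat-qf (to (SatQF-iso _ _) s)
    Sat-iso {v = v} (sat-⋁∃ θ l w ys s) =
      sat-⋁∃ θ l w (map ⟦ h ⟧ ys) (subst (Sat B θ) (map-++ ⟦ h ⟧ v ys) (Sat-iso s))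
    Sat-iso {v = v} (sat-⋀∀ s) = sat-⋀∀ λ θ l w ys → subst (Sat B θ)
      (trans (map-++ ⟦ h ⟧ v (map inv ys)) (cong (map ⟦ h ⟧ v ++_) (map-inv ys)))
      (Sat-iso (s θ l w (map inv ys)))

  equations : ∀ {n k} → Vec (Term L n) k → Vec (Term L n) k → List (Term L n × Term L n)
  equations []       []       = []
  equations (s ∷ ss) (t ∷ ts) = (s , t) ∷ equations ss ts

  conjunction : ∀ {n} → List (Term L n × Term L n) → QF L n
  conjunction []             = not false
  conjunction ((s , t) ∷ es) = (s ≐ t) and conjunction es

  vars : ∀ {m n} → (Fin n → Fin m) → Vec (Term L m) n
  vars ρ = Vec.tabulate (var ∘ ρ)

  module _ (B : Structure L) where

    SatEquations-equations : ∀ {n k} {v : Vec _ n} (ss ts : Vec _ k) →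
      SatEquations B v (equations ss ts) ⇔ evals B v ss ≡ evals B v ts
    SatEquations-equations []       []       = mk⇔ (λ _ → refl) (λ _ → [])
    SatEquations-equations {v = v} (s ∷ ss) (t ∷ ts) = let i = SatEquations-equations {v = v} ss ts in mk⇔
      (λ { (p ∷ ps) → cong₂ _∷_ p (to i ps) })
      (λ e → ∷-injectiveˡ e ∷ from i (∷-injectiveʳ e))

    SatQF-conjunction : ∀ {n} {v : Vec _ n} es → SatEquations B v es ⇔ SatQF B v (conjunction es)
    SatQF-conjunction []       = mk⇔ (λ _ ()) (λ _ → [])
    SatQF-conjunction {v = v} (_ ∷ es) = let i = SatQF-conjunction {v = v} es in
      mk⇔ (λ { (p ∷ ps) → p , to i ps }) (λ (p , ps) → p ∷ from i ps)

    evals-vars : ∀ {m n} {w : Vec _ m} {v : Vec _ n} (ρ : Fin n → Fin m) →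
                 (∀ i → lookup w (ρ i) ≡ lookup v i) → evals B w (vars ρ) ≡ v
    evals-vars {v = []}    ρ h = refl
    evals-vars {v = x ∷ v} ρ h = cong₂ _∷_ (h zero) (evals-vars (ρ ∘ suc) (h ∘ suc))

    SatEquations-sub : ∀ {m n} {w : Vec _ m} {v : Vec _ n} {s : Fin n → Term L m} →
      (∀ i → eval B w (s i) ≡ lookup v i) → ∀ es →
      SatEquations B w (List.map (λ (t , u) → sub s t , sub s u) es) ⇔ SatEquations B v es
    SatEquations-sub h [] = mk⇔ (λ _ → []) (λ _ → [])
    SatEquations-sub h ((t , u) ∷ es) = let i = SatEquations-sub h es in mk⇔
      (λ { (p ∷ ps) → trans (sym (eval-sub B h t)) (trans p (eval-sub B h u)) ∷ to i ps })
      (λ { (p ∷ ps) → trans (eval-sub B h t) (trans p (sym (eval-sub B h u))) ∷ from i ps })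

    lookup-evals : ∀ {n k} {v : Vec _ n} (ts : Vec (Term L n) k) i →
                   eval B v (lookup ts i) ≡ lookup (evals B v ts) i
    lookup-evals (t ∷ ts) zero    = refl
    lookup-evals (t ∷ ts) (suc i) = lookup-evals ts i

    module _ {n : ℕ} {v : Vec (Carrier B) n} (gen : Generates B v) where

      terms : ∀ {k} → Vec (Carrier B) k → Vec (Term L n) k
      terms []       = []
      terms (b ∷ bs) = proj₁ (gen b) ∷ terms bs

      evals-terms : ∀ {k} (bs : Vec _ k) → evals B v (terms bs) ≡ bs
      evals-terms []       = refl
      evals-terms (b ∷ bs) = cong₂ _∷_ (proj₂ (gen b)) (evals-terms bs)

      hom-≗ : ∀ {C : Structure L} (g h : Hom B C) → map ⟦ g ⟧ v ≡ map ⟦ h ⟧ v → ∀ x → ⟦ g ⟧ x ≡ ⟦ h ⟧ x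
      hom-≗ g h e x with gen x
      ... | t , refl = trans (eval-hom g v t) (trans (cong (λ w → eval _ w t) e) (sym (eval-hom h v t)))

      generating-image : ∀ {C : Structure L} (h : Hom C B) {w : Vec _ n} → map ⟦ h ⟧ w ≡ v →
                         ∀ y → ∃[ x ] ⟦ h ⟧ x ≡ y
      generating-image {C} h {w} refl y with gen y
      ... | t , e = eval C w t , trans (eval-hom h w t) e

    generates-image : ∀ {n} {v : Vec _ n} → Generates B v → (h : Hom B B) → IsIso h → Generates B (map ⟦ h ⟧ v)
    generates-image {v = v} gen h iso y with gen (inv h iso y)
    ... | t , e = t , trans (sym (eval-hom h v t)) (trans (cong ⟦ h ⟧ e) (⟦⟧-inv h iso y))

    Presents : ∀ {n} → Vec (Carrier B) n → List (Term L n × Term L n) → Set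
    Presents a ψ = SatEquations B a ψ ×
      (∀ b → SatEquations B b ψ → Σ[ h ∈ Hom B B ] map ⟦ h ⟧ a ≡ b)

    -- A Tietze transformation. With `a` written as terms `us` in `b`, and `b` as terms `ws` in `a`,
    -- the new relations are `ψ` with `us` substituted, together with the equations saying that
    -- substituting `us` into `ws` returns the new generators.
    transfer-presentation : ∀ {m n} {a : Vec _ m} {b : Vec _ n} {ψ} → Generates B a → Presents a ψ →
      Generates B b → ∃[ χ ] Presents b χ
    transfer-presentation {m} {n} {a} {b} {ψ} ga (sat , univ) gb =
      List.map (λ (t , u) → sub (lookup us) t , sub (lookup us) u) ψ List.++ equations (vars id) ws′ ,
      ++⁺ (from (SatEquations-sub σ-b ψ) sat)
          (from (SatEquations-equations (vars id) ws′)
            (trans (evals-vars id (λ _ → refl))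
              (trans (sym (evals-terms ga b)) (sym (evals-subs B σ-b ws))))) ,
      λ c sc → let sc₁ , sc₂ = ++⁻ (List.map _ ψ) sc
                   σ-c = λ i → lookup-evals {v = c} us i
                   h , e = univ (evals B c us) (to (SatEquations-sub σ-c ψ) sc₁)
               in h , trans (cong (map ⟦ h ⟧) (sym (evals-terms ga b)))
                        (trans (evals-hom h a ws) (trans (cong (λ v → evals B v ws) e)
                          (trans (sym (evals-subs B σ-c ws))
                            (trans (sym (to (SatEquations-equations (vars id) ws′) sc₂))
                              (evals-vars id (λ _ → refl))))))
      where
      us = terms gb a
      ws = terms ga b
      ws′ = subs (lookup us) ws
      σ-b : ∀ i → eval B b (lookup us i) ≡ lookup a i
      σ-b i = trans (lookup-evals us i) (cong (λ v → lookup v i) (evals-terms gb a))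

    SatEquations-hom : ∀ {n} {C : Structure L} (h : Hom B C) {a : Vec _ n} {ψ} →
                   SatEquations B a ψ → SatEquations C (map ⟦ h ⟧ a) ψ
    SatEquations-hom h {a} = All.map λ { {s , t} e →
      trans (sym (eval-hom h a s)) (trans (cong ⟦ h ⟧ e) (eval-hom h a t)) }

-- Direct limits of endomorphisms

eventually-from : ∀ {P : ℕ → Set} M → P M → (∀ m → M ≤ m → P m → P (suc m)) → Eventually P
eventually-from {P} M p s = M , λ m l → go (≤⇒≤′ l)
  where
  go : ∀ {m} → M ≤′ m → P m
  go ≤′-refl     = p
  go (≤′-step l) = s _ (≤′⇒≤ l) (go l)

module DirectLimit (em : {P : Set} → Dec P) {L : Language} (A : ComputableStructure L)
                   (h : ℕ → Hom (structure A) (structure A)) where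

  open Evaluator A
  private
    𝔸 = structure A
    E = Elem A

  -- move k m x is the image at stage m of the element x of stage k; it is
  -- x itself if m ≤ k.
  move : ℕ → ℕ → E → E
  moveStep : ∀ {k m} → Dec (k ≤ m) → E → E
  move k zero    x = x
  move k (suc m) x = moveStep {k} {m} (k ≤? m) x
  moveStep {k} {m} (yes _) x = ⟦ h m ⟧ (move k m x)
  moveStep         (no _)  x = x

  move-step : ∀ {k m} → k ≤ m → ∀ x → move k (suc m) x ≡ ⟦ h m ⟧ (move k m x)
  move-step {k} {m} l x with k ≤? m
  ... | yes _ = refl
  ... | no ¬l = ⊥-elim (¬l l)

  move-start : ∀ k x → move k k x ≡ x
  move-start zero    x = refl
  move-start (suc k) x with suc k ≤? k
  ... | yes l = ⊥-elim (1+n≰n l)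
  ... | no  _ = refl

  -- An element of the limit is represented by a sequence that follows the maps from some stage on;
  -- its earlier entries are arbitrary.
  Coherent : (ℕ → E) → Set
  Coherent p = Eventually λ m → p (suc m) ≡ ⟦ h m ⟧ (p m)

  -- The number ⟨ k , x ⟩ stands for the element `x` of stage `k`. By `realize` these countably many
  -- sequences represent all elements of the limit.
  thread : ℕ → ℕ → E
  thread i m = move (lft i) m (elem (rgt i))

  thread-coherent : ∀ i → Coherent (thread i)
  thread-coherent i = lft i , λ m l → move-step l _

  infix 4 _≈_

  _≈_ : (ℕ → E) → (ℕ → E) → Set
  p ≈ q = Eventually λ m → p m ≡ q m

  ≈-sym : ∀ {p q} → p ≈ q → q ≈ p
  ≈-sym = eventually-map sym

  ≈-trans : ∀ {p q r} → p ≈ q → q ≈ r → p ≈ r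
  ≈-trans e f = eventually-map (λ (a , b) → trans a b) (eventually-× e f)

  -- Once both sequences follow the maps, a single coincidence propagates to all later stages.
  meet⇒≈ : ∀ {p q} ((M , _) : Coherent p) ((N , _) : Coherent q) {m} → M ≤ m → N ≤ m → p m ≡ q m → p ≈ q
  meet⇒≈ (M , c) (N , d) {m} k l e = eventually-from m e λ n m≤n e′ →
    trans (c n (≤-trans k m≤n)) (trans (cong ⟦ h n ⟧ e′) (sym (d n (≤-trans l m≤n))))

  realize : ∀ {p} → Coherent p → ∃[ i ] thread i ≈ p
  realize {p} (M , c) = i , meet⇒≈ (thread-coherent i) (M , c) {M}
    (≤-reflexive (lft-⟨⟩ M _)) ≤-refl
    (trans (cong₂ (λ k x → move k M (elem x)) (lft-⟨⟩ M (proj₁ (p M))) (rgt-⟨⟩ M (proj₁ (p M))))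
      (trans (move-start M _) (elem-proj₁ (p M))))
    where
    i = ⟨ M , proj₁ (p M) ⟩

  -- The limit consists of the least indices of the threads.
  Canonical : ℕ → Set
  Canonical i = ∀ j → thread j ≈ thread i → i ≤ j

  -- Excluded middle turns `≈` into a numerical test, whose least zero exists since `i` passes it.
  canonical : ∀ i → ∃[ j ] thread j ≈ thread i × Canonical j
  canonical i = j , j≈i , λ k k≈j → ≮⇒≥ λ k<j →
    case trans (sym (proj₂ (below k<j))) (bit-true em (≈-trans k≈j j≈i)) of λ ()
    where
    bit : ∀ {P : Set} → Dec P → ℕ
    bit (yes _) = 0
    bit (no _)  = 1
    bit-true : ∀ {P : Set} (d : Dec P) → P → bit d ≡ 0
    bit-true (yes _) p = refl
    bit-true (no ¬p) p = ⊥-elim (¬p p)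
    true-bit : ∀ {P : Set} (d : Dec P) → bit d ≡ 0 → P
    true-bit (yes p) _ = p
    found = least (λ j → bit (em {thread j ≈ thread i})) i (bit-true em (always λ _ → refl))
    j = proj₁ found
    j≈i = true-bit em (proj₁ (proj₂ found))
    below = proj₂ (proj₂ found)

  -- Canonical representatives take the place of a quotient. `True` makes canonicity
  -- proof-irrelevant, so elements are equal as soon as their indices are.
  Limit : Set
  Limit = Σ ℕ λ i → True (em {Canonical i})

  at : ℕ → Limit → E
  at m (i , _) = thread i m

  at-coherent : ∀ x → Coherent (λ m → at m x)
  at-coherent (i , _) = thread-coherent i

  limit-≡ : ∀ {x y : Limit} → proj₁ x ≡ proj₁ y → x ≡ y
  limit-≡ {i , c} {_ , d} refl = cong (i ,_) (T-irrelevant c d)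

  ≈⇒≡ : ∀ {x y} → (λ m → at m x) ≈ (λ m → at m y) → x ≡ y
  ≈⇒≡ {i , c} {j , d} e = limit-≡ (≤-antisym (toWitness c j (≈-sym e)) (toWitness d i e))

  abstract
    class : ∀ {p} → Coherent p → Limit
    class c = let i , _ = realize c ; j , _ , can = canonical i in j , fromWitness can

    at-class : ∀ {p} (c : Coherent p) → (λ m → at m (class c)) ≈ p
    at-class c = let i , e = realize c ; j , f , _ = canonical i in ≈-trans f e

  map-at-coherent : ∀ {n} (v : Vec Limit n) → Eventually λ m → map (at (suc m)) v ≡ map ⟦ h m ⟧ (map (at m) v)
  map-at-coherent []      = always λ _ → refl
  map-at-coherent (x ∷ v) = eventually-map (λ (a , b) → cong₂ _∷_ a b)
    (eventually-× (at-coherent x) (map-at-coherent v))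

  op-coherent : ∀ f (v : Vec Limit (arity L f)) → Coherent (λ m → op A f (map (at m) v))
  op-coherent f v = eventually-map (λ {m} e → trans (cong (op A f) e) (sym (homo (h m) f _))) (map-at-coherent v)

  limit : Structure L
  limit = record
    { Carrier   = Limit
    ; inhabited = class (thread-coherent 0)
    ; fun       = λ f v → class (op-coherent f v)
    }

  limit-countable : Countable limit
  limit-countable = mk↣ {to = proj₁} limit-≡

  move-coherent : ∀ k x → Coherent (λ m → move k m x)
  move-coherent k x = k , λ m l → move-step l x

  inject : ℕ → E → Limit
  inject k x = class (move-coherent k x)

  at-inject : ∀ k x → (λ m → at m (inject k x)) ≈ (λ m → move k m x)
  at-inject k x = at-class (move-coherent k x)

  map-at-inject : ∀ k {n} (v : Vec E n) → Eventually λ m → map (at m) (map (inject k) v) ≡ map (move k m) v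
  map-at-inject k []      = always λ _ → refl
  map-at-inject k (x ∷ v) = eventually-map (λ (a , b) → cong₂ _∷_ a b)
    (eventually-× (at-inject k x) (map-at-inject k v))

  map-move-start : ∀ k {n} (v : Vec E n) → map (move k k) v ≡ v
  map-move-start k []      = refl
  map-move-start k (x ∷ v) = cong₂ _∷_ (move-start k x) (map-move-start k v)

  map-move-step : ∀ {k m} → k ≤ m → ∀ {n} (v : Vec E n) → map (move k (suc m)) v ≡ map ⟦ h m ⟧ (map (move k m) v)
  map-move-step l []      = refl
  map-move-step l (x ∷ v) = cong₂ _∷_ (move-step l x) (map-move-step l v)

  injectHom : ℕ → Hom 𝔸 limit
  injectHom k = record
    { ⟦_⟧  = inject k
    ; homo = λ f v → ≈⇒≡ (≈-trans (at-inject k _) (≈-trans (move-op f v)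
        (≈-sym (≈-trans (at-class (op-coherent f (map (inject k) v)))
          (eventually-map (cong (op A f)) (map-at-inject k v))))))
    }
    where
    move-op : ∀ f v → (λ m → move k m (op A f v)) ≈ (λ m → op A f (map (move k m) v))
    move-op f v = eventually-from k
      (trans (move-start k _) (cong (op A f) (sym (map-move-start k v))))
      λ m l e → trans (move-step l _) (trans (cong ⟦ h m ⟧ e)
        (trans (homo (h m) f _) (cong (op A f) (sym (map-move-step l v)))))

  inject-suc : ∀ k x → inject (suc k) (⟦ h k ⟧ x) ≡ inject k x
  inject-suc k x = ≈⇒≡ (≈-trans (at-inject (suc k) _) (≈-trans
    (meet⇒≈ (move-coherent (suc k) _) (move-coherent k x) {suc k} ≤-refl (n≤1+n k)
      (trans (move-start (suc k) _) (sym (trans (move-step ≤-refl x) (cong ⟦ h k ⟧ (move-start k x))))))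
    (≈-sym (at-inject k x))))

  at-inject-≡ : ∀ {x m} → proj₁ (at-coherent x) ≤ m → inject m (at m x) ≡ x
  at-inject-≡ {x} {m} l = ≈⇒≡ (≈-trans (at-inject m _)
    (meet⇒≈ (move-coherent m (at m x)) (at-coherent x) ≤-refl l (move-start m _)))

  mutual
    at-eval : ∀ {n} (v : Vec Limit n) t → (λ m → at m (eval limit v t)) ≈ (λ m → eval 𝔸 (map (at m) v) t)
    at-eval v (var i)    = always λ m → sym (lookup-map i (at m) v)
    at-eval v (app f ts) = ≈-trans (at-class (op-coherent f (evals limit v ts)))
      (eventually-map (cong (op A f)) (at-evals v ts))

    at-evals : ∀ {n k} (v : Vec Limit n) (ts : Vec (Term L n) k) →
      Eventually λ m → map (at m) (evals limit v ts) ≡ evals 𝔸 (map (at m) v) ts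
    at-evals v []       = always λ m → refl
    at-evals v (t ∷ ts) = eventually-map (λ (a , b) → cong₂ _∷_ a b)
      (eventually-× (at-eval v t) (at-evals v ts))

  -- Quantifier-free truth in the limit

  data Decided {n} (v : Vec Limit n) (φ : QF L n) : Set where
    holds : SatQF limit v φ → Eventually (λ m → SatQF 𝔸 (map (at m) v) φ) → Decided v φ
    fails : ¬ SatQF limit v φ → Eventually (λ m → ¬ SatQF 𝔸 (map (at m) v) φ) → Decided v φ

  -- Truth and failure are handled together because negation exchanges them. An equation that fails
  -- in the limit fails at all late stages, as one late coincidence would persist.
  decided : ∀ {n} (v : Vec Limit n) φ → Decided v φ
  decided v (s ≐ t) with em {eval limit v s ≡ eval limit v t}
  ... | yes e = holds e (≈-trans (≈-sym (at-eval v s))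
    (≈-trans (always λ m → cong (at m) e) (at-eval v t)))
  ... | no ¬e = fails ¬e (eventually-map (λ (l , k , a , b) q → ¬e (≈⇒≡
      (meet⇒≈ (at-coherent (eval limit v s)) (at-coherent (eval limit v t)) l k (trans a (trans q (sym b))))))
    (eventually-× (_ , λ _ l → l) (eventually-× (_ , λ _ l → l) (eventually-× (at-eval v s) (at-eval v t)))))
  decided v false = fails (λ ()) (always λ m ())
  decided v (not φ) with decided v φ
  ... | holds p e = fails (λ ¬p → ¬p p) (eventually-map (λ q ¬q → ¬q q) e)
  ... | fails p e = holds p e
  decided v (φ and χ) with decided v φ | decided v χ
  ... | holds p e | holds q f = holds (p , q) (eventually-× e f)
  ... | fails p e | _         = fails (p ∘ proj₁) (eventually-map (_∘ proj₁) e)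
  ... | _         | fails q f = fails (q ∘ proj₂) (eventually-map (_∘ proj₂) f)
  decided v (φ or χ) with decided v φ | decided v χ
  ... | holds p e | _         = holds (inj₁ p) (eventually-map inj₁ e)
  ... | _         | holds q f = holds (inj₂ q) (eventually-map inj₂ f)
  ... | fails p e | fails q f = fails [ p , q ]′ (eventually-map (λ (a , b) → [ a , b ]′) (eventually-× e f))

  eventually⇒SatQF : ∀ {n} {v : Vec Limit n} {φ} → Eventually (λ m → SatQF 𝔸 (map (at m) v) φ) → SatQF limit v φ
  eventually⇒SatQF {v = v} {φ} e with decided v φ
  ... | holds p _ = p
  ... | fails _ f = let M , g = eventually-× e f ; p , ¬p = g M ≤-refl in ⊥-elim (¬p p)

-- A stable witness of the Σ₂ part

_∘ʰ_ : ∀ {L} {A B C : Structure L} → Hom B C → Hom A B → Hom A C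
_∘ʰ_ {C = C} g h = record
  { ⟦_⟧  = ⟦ g ⟧ ∘ ⟦ h ⟧
  ; homo = λ f v → trans (cong ⟦ g ⟧ (homo h f v)) (trans (homo g f _) (cong (fun C f) (sym (map-∘ ⟦ g ⟧ ⟦ h ⟧ v))))
  }

Onto : ∀ {L} {A B : Structure L} → Hom A B → Set
Onto h = ∀ y → ∃[ x ] ⟦ h ⟧ x ≡ y

module Stability (em : {P : Set} → Dec P) {L : Language} (A : ComputableStructure L)
  {β l : ℕ} (θ : Formula L π β l) where

  open Evaluator A
  private
    𝔸 = structure A
    E = Elem A

  Fact : Set
  Fact = Σ ℕ λ m → QF L m × Vec E m

  Holds : Fact → Set
  Holds (m , φ , v) = SatQF 𝔸 v φ

  moveFact : Hom 𝔸 𝔸 → Fact → Fact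
  moveFact h (m , φ , v) = m , φ , map ⟦ h ⟧ v

  Valid : Vec E l → List Fact → Set
  Valid c F = Sat 𝔸 θ c × All Holds F

  -- The first alternative of the dichotomy. Since `F` is finite, only `θ` contributes quantifiers
  -- to a description of the orbit obtained from it.
  Stable : Set
  Stable = Σ[ c ∈ Vec E l ] Σ[ F ∈ List Fact ] Valid c F ×
    (∀ h → Valid (map ⟦ h ⟧ c) (List.map (moveFact h) F) → Onto h)

  Escape : Vec E l → List Fact → Set
  Escape c F = Σ[ h ∈ Hom 𝔸 𝔸 ] Valid (map ⟦ h ⟧ c) (List.map (moveFact h) F) × ¬ Onto h

  -- Supplies the next map of the sequence, whatever finitely many facts are to be preserved.
  escape : ¬ Stable → ∀ c F → Valid c F → Escape c F
  escape ¬s c F v with em {Escape c F}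
  ... | yes e = e
  ... | no ¬e = ⊥-elim (¬s (c , F , v , λ h w → onto h w (em {Onto h})))
    where
    onto : ∀ h → Valid (map ⟦ h ⟧ c) (List.map (moveFact h) F) → Dec (Onto h) → Onto h
    onto h w (yes o) = o
    onto h w (no ¬o) = ⊥-elim (¬e (h , w , ¬o))

  -- A sequence of endomorphisms whose limit satisfies the Scott sentence

  indices : ∀ n → ℕ → Vec ℕ n
  indices zero    k = []
  indices (suc n) k = lft k ∷ indices n (rgt k)

  indices-⌜⌝ : ∀ {n} (v : Vec ℕ n) → indices n ⌜ v ⌝ᵛ ≡ v
  indices-⌜⌝ []      = refl
  indices-⌜⌝ {suc n} (x ∷ v) = cong₂ _∷_ (lft-⟨⟩ x ⌜ v ⌝ᵛ)
    (trans (cong (indices n) (rgt-⟨⟩ x ⌜ v ⌝ᵛ)) (indices-⌜⌝ v))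

  -- The index of a Σ₁ formula, and the indices of the limit elements for which it is to be
  -- witnessed.
  Request : Set
  Request = Σ ℕ λ m → Code × Vec ℕ m

  request : ℕ → Request
  request r = lft r , decode (lft (lft (rgt r))) (rgt (lft (rgt r))) , indices (lft r) (rgt (rgt r))

  request-surjective : ∀ q → ∃[ r ] request r ≡ q
  request-surjective (m , e , is) =
    ⟨ m , ⟨ d , ⌜ is ⌝ᵛ ⟩ ⟩ , eq (lft-⟨⟩ m ⟨ d , ⌜ is ⌝ᵛ ⟩)
      (trans (cong lft (rgt-⟨⟩ m ⟨ d , ⌜ is ⌝ᵛ ⟩)) (lft-⟨⟩ d ⌜ is ⌝ᵛ))
      (trans (cong rgt (rgt-⟨⟩ m ⟨ d , ⌜ is ⌝ᵛ ⟩)) (rgt-⟨⟩ d ⌜ is ⌝ᵛ))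
    where
    s = proj₁ (decode-⌜⌝ e)
    -- The number of a request carries the fuel that `decode` needs to recover `e`.
    d = ⟨ s , ⌜ e ⌝ᶜ ⟩
    eq : ∀ {a b c} → a ≡ m → b ≡ d → c ≡ ⌜ is ⌝ᵛ →
         _≡_ {A = Request} (a , decode (lft b) (rgt b) , indices a c) (m , e , is)
    eq refl refl refl = cong₂ (λ e is → m , e , is)
      (trans (cong₂ decode (lft-⟨⟩ s ⌜ e ⌝ᶜ) (rgt-⟨⟩ s ⌜ e ⌝ᶜ)) (proj₂ (decode-⌜⌝ e) s ≤-refl))
      (indices-⌜⌝ is)

  record Witness {m} (e : Code) (v : Vec E m) : Set where
    constructor witness
    field
      {width}  : ℕ
      formula  : QF L (m + width)
      member   : ⟨ 0 , ⟨ width , ⌜ formula ⌝ᵠ ⟩ ⟩ ∈W e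
      elements : Vec E width
      holds    : SatQF 𝔸 (v ++ elements) formula

  sat⇒witness : ∀ {m e} {v : Vec E m} → Sat 𝔸 (⋁∃ {α = 0} e) v → Witness e v
  sat⇒witness (sat-⋁∃ (qf φ) _ w ys (sat-qf s)) = witness φ w ys s
  sat⇒witness (sat-⋁∃ (⋀∀ _) (s≤s ()) w ys s)

  witnessFact : ∀ {m e} {v : Vec E m} → Witness e v → Fact
  witnessFact {v = v} (witness φ _ ys _) = _ , φ , v ++ ys

  -- `current j x` is the image at this stage of the element `x` of stage `j`. It is stored because
  -- the maps are defined along with the stages; `current-move` identifies it with `move`
  -- afterwards.
  record Stage : Set where
    constructor stage
    field
      distinguished : Vec E l
      facts         : List Fact
      valid         : Valid distinguished facts
      current       : ℕ → E → E

  open Stage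

  module Construction (¬stable : ¬ Stable) (c₀ : Vec E l) (sat₀ : Sat 𝔸 θ c₀) where

    tuple-at : ∀ {n} → (ℕ → E → E) → Vec ℕ n → Vec E n
    tuple-at u = map (λ i → u (lft i) (elem (rgt i)))

    newFact : ∀ {m e} {v : Vec E m} → Dec (Sat 𝔸 (⋁∃ {α = 0} e) v) → List Fact
    newFact (yes s) = witnessFact (sat⇒witness s) ∷ []
    newFact (no _)  = []

    newFact-holds : ∀ {m e} {v : Vec E m} (d : Dec (Sat 𝔸 (⋁∃ {α = 0} e) v)) → All Holds (newFact d)
    newFact-holds (yes s) = Witness.holds (sat⇒witness s) ∷ []
    newFact-holds (no _)  = []

    -- Stage `k` treats the request numbered `lft k`, so each request comes up at arbitrarily late
    -- stages.
    requested : ∀ k (S : Stage) → let m , e , is = request (lft k) in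
                Dec (Sat 𝔸 (⋁∃ {α = 0} e) (tuple-at (current S) is))
    requested k S = em

    enriched : ℕ → Stage → List Fact
    enriched k S = newFact (requested k S) List.++ facts S

    chosen : ∀ k S → Escape (distinguished S) (enriched k S)
    chosen k S = escape ¬stable (distinguished S) (enriched k S)
      (proj₁ (valid S) , ++⁺ (newFact-holds (requested k S)) (proj₂ (valid S)))

    moveIf : ∀ {P : Set} → Dec P → (E → E) → E → E → E
    moveIf (yes _) h x y = h x
    moveIf (no _)  h x y = y

    stages : ℕ → Stage
    stages zero    = stage c₀ [] (sat₀ , []) (λ _ x → x)
    stages (suc k) = let S = stages k ; h , v , _ = chosen k S in
      stage (map ⟦ h ⟧ (distinguished S)) (List.map (moveFact h) (enriched k S)) v
            (λ j x → moveIf (j ≤? k) ⟦ h ⟧ (current S j x) x)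

    step : ℕ → Hom 𝔸 𝔸
    step k = proj₁ (chosen k (stages k))

    step-not-onto : ∀ k → ¬ Onto (step k)
    step-not-onto k = proj₂ (proj₂ (chosen k (stages k)))

    open DirectLimit em A step public

    current-move : ∀ k j x → current (stages k) j x ≡ move j k x
    current-move zero    j x = refl
    current-move (suc k) j x with j ≤? k
    ... | yes _ = cong ⟦ step k ⟧ (current-move k j x)
    ... | no _  = refl

    distinguished-move : ∀ k → distinguished (stages k) ≡ map (move 0 k) c₀
    distinguished-move zero    = sym (map-id c₀)
    distinguished-move (suc k) = trans (cong (map ⟦ step k ⟧) (distinguished-move k))
      (sym (map-move-step z≤n c₀))

    C : Vec Limit l
    C = map (inject 0) c₀

    at-C : Eventually λ m → map (at m) C ≡ distinguished (stages m)
    at-C = eventually-map (λ {m} e → trans e (sym (distinguished-move m))) (map-at-inject 0 c₀)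

    -- An instance of a Π₁ formula is quantifier-free, and it holds at every late stage since the
    -- distinguished tuple satisfies `θ` at all stages.
    limit-θ : β < 2 → Sat limit θ C
    limit-θ = go θ (λ m → proj₁ (valid (stages m)))
      where
      sat-qf⁻ : ∀ {κ n φ} {v : Vec E n} → Sat 𝔸 (qf {κ = κ} φ) v → SatQF 𝔸 v φ
      sat-qf⁻ (sat-qf s) = s
      go : ∀ {β} (θ : Formula L π β l) → (∀ m → Sat 𝔸 θ (distinguished (stages m))) → β < 2 → Sat limit θ C
      go (qf φ) s _ = sat-qf (eventually⇒SatQF {φ = φ}
        (eventually-map (λ {m} e → subst (λ v → SatQF 𝔸 v φ) (sym e) (sat-qf⁻ (s m))) at-C))
      go (⋀∀ {zero} d) s _ = sat-⋀∀ λ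
        { (qf φ) lt w ys → sat-qf (eventually⇒SatQF {φ = φ} (eventually-map
            (λ {m} e → subst (λ v → SatQF 𝔸 v φ)
              (sym (trans (map-++ (at m) C ys) (cong (_++ map (at m) ys) e)))
              (instantiate φ w (map (at m) ys) (s m))) at-C))
        ; (⋁∃ _) (s≤s ()) w ys }
        where
        instantiate : ∀ {m v} (φ : QF L (l + m)) → ⟨ 0 , ⟨ m , ⌜ φ ⌝ᵠ ⟩ ⟩ ∈W d → (ys : Vec E m) →
          Sat 𝔸 (⋀∀ {α = 0} d) v → SatQF 𝔸 (v ++ ys) φ
        instantiate φ w ys (sat-⋀∀ f) = sat-qf⁻ (f (qf φ) (s≤s z≤n) w ys)
      go (⋀∀ {suc _} d) s (s≤s (s≤s ()))

    new-∈ : ∀ {m e} {v : Vec E m} (d : Dec (Sat 𝔸 (⋁∃ {α = 0} e) v)) → Sat 𝔸 (⋁∃ {α = 0} e) v →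
      Σ[ w ∈ Witness e v ] newFact d ≡ witnessFact w ∷ []
    new-∈ (yes s) _ = sat⇒witness s , refl
    new-∈ (no ¬s) s = ⊥-elim (¬s s)

    fact-persists : ∀ k {m φ} {v : Vec E m} → (m , φ , v) ∈ enriched k (stages k) →
      Eventually λ j → (m , φ , map (move k j) v) ∈ facts (stages j)
    fact-persists k {m} {φ} {v} p = eventually-from (suc k)
      (subst (λ u → (m , φ , u) ∈ facts (stages (suc k)))
        (sym (trans (map-move-step ≤-refl v) (cong (map ⟦ step k ⟧) (map-move-start k v))))
        (∈-map⁺ (moveFact (step k)) p))
      λ j l q → subst (λ u → (m , φ , u) ∈ facts (stages (suc j)))
        (sym (map-move-step (≤-trans (n≤1+n k) l) v))
        (∈-map⁺ (moveFact (step j)) (∈-++⁺ʳ (newFact (requested j (stages j))) q))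

    fact-in-limit : ∀ k {m φ} {v : Vec E m} → (m , φ , v) ∈ enriched k (stages k) →
      SatQF limit (map (inject k) v) φ
    fact-in-limit k {m} {φ} {v} p = eventually⇒SatQF {φ = φ} (eventually-map
      (λ { {j} (e , q) → subst (λ u → SatQF 𝔸 u φ) (sym e) (All.lookup (proj₂ (valid (stages j))) q) })
      (eventually-× (map-at-inject k v) (fact-persists k p)))

    added : ∀ k {m e is} → request (lft k) ≡ (m , e , is) → let v = tuple-at (current (stages k)) is in
      Sat 𝔸 (⋁∃ {α = 0} e) v → Σ[ w ∈ Witness e v ] witnessFact w ∈ enriched k (stages k)
    added k refl s = let w , eq = new-∈ (requested k (stages k)) s in
      w , subst (λ F → witnessFact w ∈ F List.++ facts (stages k)) (sym eq) (here refl)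

    Present : ∀ {n} → Vec Limit n → ℕ → Set
    Present ys k = ∀ j → k ≤ j → map (inject j) (map (at j) ys) ≡ ys

    eventually-present : ∀ {n} (ys : Vec Limit n) → Eventually (Present ys)
    eventually-present []       = always λ k j l → refl
    eventually-present (y ∷ ys) =
      let M = proj₁ (at-coherent y) ; N , e = eventually-present ys in
      M ⊔ N , λ k l j k≤j → cong₂ _∷_
        (at-inject-≡ {y} (≤-trans (≤-trans (m≤m⊔n M N) l) k≤j))
        (e k (≤-trans (m≤n⊔m M N) l) j k≤j)

    tuple-at-stage : ∀ k {n} (ys : Vec Limit n) → tuple-at (current (stages k)) (map proj₁ ys) ≡ map (at k) ys
    tuple-at-stage k []       = refl
    tuple-at-stage k (y ∷ ys) = cong₂ _∷_ (current-move k _ _) (tuple-at-stage k ys)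

    witness-in-limit : ∀ k {m e} (ys : Vec Limit m) v → map (inject k) v ≡ ys → (w : Witness e v) →
      witnessFact w ∈ enriched k (stages k) → Sat limit (⋁∃ {α = 0} e) ys
    witness-in-limit k ys v eq (witness φ w ws _) p = sat-⋁∃ (qf φ) (s≤s z≤n) w (map (inject k) ws)
      (sat-qf (subst (λ u → SatQF limit u φ)
        (trans (map-++ (inject k) v ws) (cong (_++ map (inject k) ws) eq))
        (fact-in-limit k {φ = φ} {v ++ ws} p)))

    -- Every Π₂ requirement about elements of the limit is treated at some
    -- stage at which all of these elements are already present.
    limit-⋁∃ : (e : Code) {m : ℕ} (ys : Vec Limit m) → (∀ v → Sat 𝔸 (⋁∃ {α = 0} e) v) → Sat limit (⋁∃ {α = 0} e) ys
    limit-⋁∃ e {m} ys sat =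
      let r , req   = request-surjective (m , e , map proj₁ ys)
          N , pres  = eventually-present ys
          k         = ⟨ r , N ⟩
          w , p     = added k (trans (cong request (lft-⟨⟩ r N)) req) (sat _)
      in witness-in-limit k ys _
           (trans (cong (map (inject k)) (tuple-at-stage k ys)) (pres N ≤-refl k (m≤m+n N _))) w p

    -- As `χ` is a sentence, its matrices hold of all tuples of A, in particular of the values at
    -- each stage. The Σ₁ matrices are what the requests are for.
    limit-Π₂ : (χ : Formula L π 2 0) → Sat 𝔸 χ [] → Sat limit χ []
    limit-Π₂ (⋀∀ c) (sat-⋀∀ s) = sat-⋀∀ λ
      { (qf φ) l w ys → sat-qf (eventually⇒SatQF {φ = φ}
          (always λ m → case s (qf φ) l w (map (at m) ys) of λ { (sat-qf q) → q }))
      ; (⋁∃ {zero} e) l w ys → limit-⋁∃ e ys (s (⋁∃ e) l w)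
      ; (⋁∃ {suc _} e) (s≤s (s≤s ())) w ys }

    limit-≇ : Hopfian 𝔸 → ∀ {n} {a : Vec E n} {ψ} → Generates 𝔸 a → Presents 𝔸 a ψ → ¬ (𝔸 ≅ limit)
    limit-≇ hopf {a = a} {ψ} gen (sat , univ) (g , iso) = step-not-onto M onto
      where
      w = map ⟦ g ⟧ a
      eventually-ψ : Eventually λ m → SatEquations 𝔸 (map (at m) w) ψ
      eventually-ψ with decided w (conjunction ψ)
      ... | holds _ e = eventually-map (from (SatQF-conjunction 𝔸 ψ)) e
      ... | fails ¬p _ = ⊥-elim (¬p (to (SatQF-conjunction limit ψ) (SatEquations-hom 𝔸 g sat)))
      both = eventually-× eventually-ψ (eventually-present w)
      M = proj₁ both
      -- At stage `M` the relations `ψ` hold of the images of the generators, so `g` factors through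
      -- `inject M`.
      g′ : Hom 𝔸 𝔸
      g′ = proj₁ (univ _ (proj₁ (proj₂ both M ≤-refl)))
      factor : ∀ x → inject M (⟦ g′ ⟧ x) ≡ ⟦ g ⟧ x
      factor = hom-≗ 𝔸 gen (injectHom M ∘ʰ g′) g (trans (map-∘ (inject M) ⟦ g′ ⟧ a)
        (trans (cong (map (inject M)) (proj₂ (univ _ (proj₁ (proj₂ both M ≤-refl)))))
               (proj₂ (proj₂ both M ≤-refl) M ≤-refl)))
      f : Hom 𝔸 𝔸
      f = invHom g iso ∘ʰ injectHom (suc M)
      f-step : ∀ z → ⟦ f ⟧ (⟦ step M ⟧ (⟦ g′ ⟧ z)) ≡ z
      f-step z = proj₁ iso (trans (⟦⟧-inv g iso _) (trans (inject-suc M _) (factor z)))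
      -- The composite of `g′`, `step M` and `f` is the identity, so `f` is onto and, by the Hopf
      -- property, injective. Cancelling `f` shows that `g′ ∘ f` is a section of `step M`.
      onto : Onto (step M)
      onto x = ⟦ g′ ⟧ (⟦ f ⟧ x) ,
        proj₁ (hopf f (surjective f λ z → _ , f-step z)) (f-step (⟦ f ⟧ x))

  stable : Hopfian 𝔸 → ∀ {n} {a : Vec E n} {ψ} → Generates 𝔸 a → Presents 𝔸 a ψ →
    β < 2 → ∀ c₀ → Sat 𝔸 θ c₀ → (χ : Formula L π 2 0) → Sat 𝔸 χ [] →
    (∀ B → Countable B → ∀ c → Sat B θ c → Sat B χ [] → 𝔸 ≅ B) → Stable
  stable hopf gen pres β<2 c₀ sat₀ χ satχ scott with em {Stable}
  ... | yes s = s
  ... | no ¬s = ⊥-elim (limit-≇ hopf gen pres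
    (scott limit limit-countable C (limit-θ β<2) (limit-Π₂ χ satχ)))
    where open Construction ¬s c₀ sat₀

-- The complexity of the automorphism orbit of a generating tuple

module Orbit (em : {P : Set} → Dec P) {L : Language} (A : ComputableStructure L)
             (hopf : Hopfian (structure A)) where

  open Evaluator A
  open QFEvaluator A
  private
    𝔸 = structure A
    E = Elem A

  onto-orbit : ∀ {n} {a b : Vec E n} (h : Hom 𝔸 𝔸) → map ⟦ h ⟧ a ≡ b → Onto h → AutOrbit A a b
  onto-orbit h e o = h , hopf h (surjective h o) , e

  module _ {n : ℕ} {a : Vec E n} (gen : Generates 𝔸 a) {ψ : List (Term L n × Term L n)}
           (pres : Presents 𝔸 a ψ) where

    GeneratesBack : Vec E n → Set
    GeneratesBack b = ∃[ w ] args (evalCode (assign b)) n w ≡ suc (tuple a)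

    -- If terms in `b` express `a`, the endomorphism taking `a` to `b` is onto, hence an
    -- automorphism by the Hopf property.
    orbit-⇔ : ∀ b → (SatEquations 𝔸 b ψ × GeneratesBack b) ⇔ AutOrbit A a b
    orbit-⇔ b = mk⇔ back forth
      where
      back : SatEquations 𝔸 b ψ × GeneratesBack b → AutOrbit A a b
      back (s , w , e) with proj₂ pres b s
      ... | h , refl with args-terms b n w e
      ... | ts , refl = onto-orbit h refl (generating-image 𝔸 gen h
        (trans (evals-hom h a ts) (tuple-injective (suc-injective (trans (sym (args-⌜⌝ b ts)) e)))))
      forth : AutOrbit A a b → SatEquations 𝔸 b ψ × GeneratesBack b
      forth (h , iso , refl) = SatEquations-hom 𝔸 h (proj₁ pres) ,
        ⌜ ts ⌝ᵗˢ , trans (args-⌜⌝ b ts) (cong (suc ∘ tuple) (evals-terms 𝔸 gen′ a))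
        where
        gen′ = generates-image 𝔸 gen h iso
        ts = terms 𝔸 gen′ a

    orbit-CE : CE (λ k → AutOrbit A a (untuple n k))
    orbit-CE = CE-⇔ (λ k → orbit-⇔ (untuple n k))
      (Decidable⇒CE (SatEquations-Decidable U ψ) ×-CE
       ∃-CE {P = λ k w → args (evalCode (assign (untuple n k))) n w ≡ suc (tuple a)}
         (Decidable⇒CE (≡-Decidable
           (argsC (computable₂ (app₂ evalCodeC (assignC (untupleC n (lftC #0))) #1)) n #1)
           (constC (suc (tuple a))))))
      where
      U = untupleC n idC

  -- Enumerating the failures of a Π₁ formula

  sat-qf-⇔ : ∀ {κ n} {φ : QF L n} {v} → Sat 𝔸 (qf {κ = κ} φ) v ⇔ SatQF 𝔸 v φ
  sat-qf-⇔ = mk⇔ (λ { (sat-qf s) → s }) sat-qf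

  -- `z` packs the number of quantified variables, the code of a matrix and values for these
  -- variables. The value 1 means a false formula; members of `W d` that are no formulas have value
  -- 0 and refute nothing.
  Counterexample : ∀ {l} → Code → Vec E l → ℕ → Set
  Counterexample {l} d v z = let m = lft z ; q = lft (rgt z) ; y = rgt (rgt z) in
    ⟨ 0 , ⟨ m , q ⟩ ⟩ ∈W d × satCode (extend l (tuple v) (assign (untuple m y))) q ≡ 1

  counterexample-⇔ : ∀ {l} d (v : Vec E l) → (∃[ z ] Counterexample d v z) ⇔ (¬ Sat 𝔸 (⋀∀ {α = 0} d) v)
  counterexample-⇔ {l} d v = mk⇔ refute find
    where
    refute : (∃[ z ] Counterexample d v z) → ¬ Sat 𝔸 (⋀∀ {α = 0} d) v
    refute (z , w , e) (sat-⋀∀ s)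
      with ys ← untuple (lft z) (rgt (rgt z))
      with e′ ← subst (λ c → satCode c _ ≡ 1) (extend-assign v ys) e
      with φ , q ← satCode-sound (v ++ ys) _ e′ =
      from (truth-1 (satCode-complete (v ++ ys) φ)) (trans (cong (satCode (assign (v ++ ys))) q) e′)
        (to sat-qf-⇔ (s (qf φ) (s≤s z≤n) (subst (λ c → ⟨ 0 , ⟨ lft z , c ⟩ ⟩ ∈W d) (sym q) w) ys))
    find : ¬ Sat 𝔸 (⋀∀ {α = 0} d) v → ∃[ z ] Counterexample d v z
    find ¬s with em {∃[ z ] Counterexample d v z}
    ... | yes c = c
    ... | no ¬c = ⊥-elim (¬s (sat-⋀∀ λ
      { (qf φ) _ w ys → sat-qf (decide φ w ys em)
      ; (⋁∃ _) (s≤s ()) w ys }))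
      where
      decide : ∀ {m} φ → ⟨ 0 , ⟨ m , ⌜ φ ⌝ᵠ ⟩ ⟩ ∈W d → (ys : Vec E m) →
               Dec (SatQF 𝔸 (v ++ ys) φ) → SatQF 𝔸 (v ++ ys) φ
      decide φ w ys (yes s) = s
      decide {m} φ w ys (no ¬s) = ⊥-elim (¬c (⟨ m , ⟨ ⌜ φ ⌝ᵠ , tuple ys ⟩ ⟩ ,
        subst₂ (λ m c → ⟨ 0 , ⟨ m , c ⟩ ⟩ ∈W d) (sym p) (sym q) w ,
        trans (cong₂ satCode (trans (cong (λ e → extend l (tuple v) e) (cong₂ (λ m y → assign (untuple m y)) p r))
                 (trans (cong (λ y → extend l (tuple v) (assign y)) (untuple-tuple ys)) (extend-assign v ys))) q)
          (to (truth-1 (satCode-complete (v ++ ys) φ)) ¬s)))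
        where
        b = ⟨ ⌜ φ ⌝ᵠ , tuple ys ⟩
        p : lft ⟨ m , b ⟩ ≡ m
        p = lft-⟨⟩ m b
        q : lft (rgt ⟨ m , b ⟩) ≡ ⌜ φ ⌝ᵠ
        q = trans (cong lft (rgt-⟨⟩ m b)) (lft-⟨⟩ ⌜ φ ⌝ᵠ (tuple ys))
        r : rgt (rgt ⟨ m , b ⟩) ≡ tuple ys
        r = trans (cong rgt (rgt-⟨⟩ m b)) (rgt-⟨⟩ ⌜ φ ⌝ᵠ (tuple ys))

  ¬Π₁-CE : ∀ {l β} {u : ℕ → Vec E l} → TupleC u → (θ : Formula L π β l) → β < 2 → CE (λ k → ¬ Sat 𝔸 θ (u k))
  ¬Π₁-CE {u = u} U (qf φ) _ = CE-⇔ (λ k → mk⇔ (_∘ to sat-qf-⇔) (_∘ from sat-qf-⇔))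
    (Decidable⇒CE (¬-Decidable (SatQF-Decidable U φ)))
  ¬Π₁-CE {l} {u = u} U (⋀∀ {zero} d) _ = CE-⇔ (λ k → counterexample-⇔ d (u k))
    (∃-CE {P = λ k → Counterexample d (u k)}
      (CE-∘ (W-CE d) (pairC (constC 0) (pairC m q)) ×-CE
       Decidable⇒CE (≡-Decidable
         (app₂ satCodeC (extendC l (compC (tupled U) #0) (app₂ assign-untupleC m y)) q)
         (constC 1))))
    where
    m = lftC #1
    q = lftC (rgtC #1)
    y = rgtC (rgtC #1)
  ¬Π₁-CE U (⋀∀ {suc _} d) (s≤s (s≤s ()))

  -- The complement of the orbit

  module _ {n : ℕ} {a : Vec E n} (gen : Generates 𝔸 a) {ψ : List (Term L n × Term L n)}
           (pres : Presents 𝔸 a ψ)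
           {l β : ℕ} {θ : Formula L π β l} (β<2 : β < 2) (st : Stability.Stable em A θ) where

    open Stability em A θ using (Fact; Holds; moveFact; Valid)

    private
      c = proj₁ st
      F = proj₁ (proj₂ st)
      valid = proj₁ (proj₂ (proj₂ st))
      onto = proj₂ (proj₂ (proj₂ st))

    -- With its parameters written as terms in `a`, a fact can be moved along `a` ↦ `b` by
    -- evaluating these terms at `b`.
    factAt : Vec E n → Fact → Set
    factAt b (m , φ , v) = SatQF 𝔸 (evals 𝔸 b (terms 𝔸 gen v)) φ

    Respects : Vec E n → Set
    Respects b = SatEquations 𝔸 b ψ × Sat 𝔸 θ (evals 𝔸 b (terms 𝔸 gen c)) × All (factAt b) F

    evals-image : ∀ (h : Hom 𝔸 𝔸) {k} (v : Vec E k) → evals 𝔸 (map ⟦ h ⟧ a) (terms 𝔸 gen v) ≡ map ⟦ h ⟧ v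
    evals-image h v = trans (sym (evals-hom h a (terms 𝔸 gen v))) (cong (map ⟦ h ⟧) (evals-terms 𝔸 gen v))

    respects⇒orbit : ∀ b → Respects b → AutOrbit A a b
    respects⇒orbit b (s , t , fs) with proj₂ pres b s
    ... | h , refl = onto-orbit h refl (onto h
      (subst (Sat 𝔸 θ) (evals-image h c) t , moved F fs))
      where
      moved : ∀ F → All (factAt (map ⟦ h ⟧ a)) F → All Holds (List.map (moveFact h) F)
      moved [] [] = []
      moved ((m , φ , v) ∷ F) (p ∷ ps) = subst (λ u → SatQF 𝔸 u φ) (evals-image h v) p ∷ moved F ps

    orbit⇒respects : ∀ b → AutOrbit A a b → Respects b
    orbit⇒respects b (h , iso , refl) = SatEquations-hom 𝔸 h (proj₁ pres) ,
      subst (Sat 𝔸 θ) (sym (evals-image h c)) (Sat-iso h iso (proj₁ valid)) ,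
      All.map (λ { {m , φ , v} p → subst (λ u → SatQF 𝔸 u φ) (sym (evals-image h v))
                                     (to (SatQF-iso h iso v φ) p) }) (proj₂ valid)

    module _ {u : ℕ → Vec E n} (U : TupleC u) where

      factsAt-Decidable : ∀ F → Decidable (λ k → All (factAt (u k)) F)
      factsAt-Decidable [] = decidable (constC 0) λ k → mk⇔ (λ _ → refl) (λ _ → [])
      factsAt-Decidable ((m , φ , v) ∷ F) =
        let decidable T e = SatQF-Decidable (evalsC U (terms 𝔸 gen v)) φ ×-Decidable factsAt-Decidable F in
        decidable T λ k → mk⇔ (λ { (p ∷ ps) → to (e k) (p , ps) })
                              (λ q → let p , ps = from (e k) q in p ∷ ps)

      ¬orbit-CE : CE (λ k → ¬ AutOrbit A a (u k))
      ¬orbit-CE = CE-⇔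
        (λ k → mk⇔
          (λ f o → let s , t , fs = orbit⇒respects (u k) o in
            [ (λ ¬s → ¬s s) , [ (λ ¬t → ¬t t) , (λ ¬fs → ¬fs fs) ]′ ]′ f)
          (λ ¬o → deMorgan (¬o ∘ respects⇒orbit (u k)) em em))
        (Decidable⇒CE (¬-Decidable (SatEquations-Decidable U ψ)) ⊎-CE
         ¬Π₁-CE (evalsC U (terms 𝔸 gen c)) θ β<2 ⊎-CE
         Decidable⇒CE (¬-Decidable (factsAt-Decidable F)))
        where
        deMorgan : ∀ {P Q R : Set} → ¬ (P × Q × R) → Dec P → Dec Q → ¬ P ⊎ ¬ Q ⊎ ¬ R
        deMorgan n (yes p) (yes q) = inj₂ (inj₂ λ r → n (p , q , r))
        deMorgan n (yes p) (no ¬q) = inj₂ (inj₁ ¬q)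
        deMorgan n (no ¬p) _       = inj₁ ¬p

    -- Post's theorem applies. Not every number codes a tuple of elements; those that do are
    -- recognised by decoding and coding again.
    orbit-computable : ComputableSubset A (AutOrbit A a)
    orbit-computable = post
      (CE-⇔ (λ k → mk⇔ (λ (e , o) → untuple n k , o , e) (λ { (v , o , refl) → coded v o }))
        (Decidable⇒CE code-decidable ×-CE orbit-CE gen pres))
      (CE-⇔ (λ k → mk⇔
          (λ { f (v , o , refl) → let e , o′ = coded v o in [ (λ ¬e → ¬e e) , (λ ¬o → ¬o o′) ]′ f })
          (λ n → uncoded k n em))
        (Decidable⇒CE (¬-Decidable code-decidable) ⊎-CE ¬orbit-CE U))
      (λ k → em)
      where
      U = untupleC n idC
      code-decidable : Decidable (λ k → tuple (untuple n k) ≡ k)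
      code-decidable = ≡-Decidable (tupled U) idC
      coded : ∀ v → AutOrbit A a v → tuple (untuple n (tuple v)) ≡ tuple v × AutOrbit A a (untuple n (tuple v))
      coded v o = cong tuple (untuple-tuple v) , subst (AutOrbit A a) (sym (untuple-tuple v)) o
      uncoded : ∀ k → ¬ (∃[ v ] AutOrbit A a v × tuple v ≡ k) → Dec (tuple (untuple n k) ≡ k) →
                ¬ tuple (untuple n k) ≡ k ⊎ ¬ AutOrbit A a (untuple n k)
      uncoded k n (yes e) = inj₂ λ o → n (_ , o , e)
      uncoded k n (no ¬e) = inj₁ ¬e

  ≅-refl : 𝔸 ≅ 𝔸
  ≅-refl = record { ⟦_⟧ = id ; homo = λ f v → cong (op A f) (sym (map-id v)) } , id , λ y → y , id

  -- Since A satisfies its Scott sentence, some disjunct `θ` holds of some `c₀`, and every countable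
  -- model of `χ` with a tuple satisfying `θ` is isomorphic to A. The presentation is transferred to
  -- the given generators `b`.
  scott⇒whitehead : ∀ {n} {a : Vec E n} {ψ} → Generates 𝔸 a → Presents 𝔸 a ψ →
    HasComputable-dΣ₂-ScottSentence 𝔸 → DecidableWeakWhitehead A
  scott⇒whitehead gen pres ((⋁∃ c , χ) , scott) b gen-b
    with sat-⋁∃ θ β<2 w c₀ sat₀ , satχ ← from (scott 𝔸 (mk↣ {to = proj₁} proj₁-injective)) ≅-refl =
    orbit-computable gen-b (proj₂ (transfer-presentation 𝔸 gen pres gen-b)) β<2
      (Stability.stable em A θ hopf gen pres β<2 c₀ sat₀ χ satχ
        λ B countable c sat sat′ → to (scott B countable) (sat-⋁∃ θ β<2 w c sat , sat′))

-- A Scott sentence from a computable orbit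

abstract
  singleton : ℕ → Code
  singleton k = enumerator (Decidable⇒CE (≡-Decidable idC (constC k)))

  singleton-⇔ : ∀ k x → x ∈W singleton k ⇔ x ≡ k
  singleton-⇔ k x = let i = enumerator-⇔ (Decidable⇒CE (≡-Decidable idC (constC k))) x in mk⇔ (from i) (to i)

-- The Gödel number of the formula with code c, of rank 1 and in n variables.
rank₁ : ℕ → Code → ℕ
rank₁ n c = ⟨ 1 , ⟨ n , ⌜ c ⌝ᶜ ⟩ ⟩

∈W-rank₁ : ∀ {β m q} n c → ⟨ β , ⟨ m , q ⟩ ⟩ ∈W singleton (rank₁ n c) → β ≡ 1 × m ≡ n × q ≡ ⌜ c ⌝ᶜ
∈W-rank₁ {β} {m} {q} n c w =
  let e , e′ = ⟨⟩-injective {β} {⟨ m , q ⟩} {1} {⟨ n , ⌜ c ⌝ᶜ ⟩}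
                 (to (singleton-⇔ (rank₁ n c) ⟨ β , ⟨ m , q ⟩ ⟩) w)
  in e , ⟨⟩-injective {m} {q} {n} {⌜ c ⌝ᶜ} e′

rank₁-∈W : ∀ n c → rank₁ n c ∈W singleton (rank₁ n c)
rank₁-∈W n c = from (singleton-⇔ (rank₁ n c) (rank₁ n c)) refl

module _ {L : Language} (B : Structure L) (n : ℕ) (c : Code) where

  -- The disjunction has one member, and the injectivity of the Gödel numbering identifies its
  -- matrix.
  sat-∃∀ : Sat B (⋁∃ {α = 1} (singleton (rank₁ n c))) [] ⇔ (∃[ x ] Sat B (⋀∀ {α = 0} {n = n} c) x)
  sat-∃∀ = mk⇔
    (λ { (sat-⋁∃ {β = β} {m} θ _ w x s) → recover θ (∈W-rank₁ {β} {m} {⌜ θ ⌝} n c w) x s })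
    (λ (x , s) → sat-⋁∃ (⋀∀ c) (s≤s (s≤s z≤n)) (rank₁-∈W n c) x s)
    where
    recover : ∀ {β m} (θ : Formula L π β m) → β ≡ 1 × m ≡ n × ⌜ θ ⌝ ≡ ⌜ c ⌝ᶜ →
              (x : Vec (Carrier B) m) → Sat B θ x → ∃[ x ] Sat B (⋀∀ {α = 0} {n = n} c) x
    recover (⋀∀ d) (refl , refl , e) x s = x , subst (λ d → Sat B (⋀∀ d) x) (⌜⌝ᶜ-injective e) s

  sat-∀∃ : Sat B (⋀∀ {α = 1} (singleton (rank₁ n c))) [] ⇔ (∀ x → Sat B (⋁∃ {α = 0} {n = n} c) x)
  sat-∀∃ = mk⇔
    (λ { (sat-⋀∀ s) x → s (⋁∃ c) (s≤s (s≤s z≤n)) (rank₁-∈W n c) x })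
    (λ g → sat-⋀∀ λ {β} {m} χ _ w ys → recover g χ (∈W-rank₁ {β} {m} {⌜ χ ⌝} n c w) ys)
    where
    recover : (∀ x → Sat B (⋁∃ {α = 0} {n = n} c) x) → ∀ {β m} (χ : Formula L σ β m) →
              β ≡ 1 × m ≡ n × ⌜ χ ⌝ ≡ ⌜ c ⌝ᶜ → (ys : Vec (Carrier B) m) → Sat B χ ys
    recover g (⋁∃ d) (refl , refl , e) ys = subst (λ d → Sat B (⋁∃ d) ys) (sym (⌜⌝ᶜ-injective e)) (g ys)

module _ (m : ℕ) {P : ℕ → Set} (P-CE : CE P) where
  private
    Coded : ℕ → Set
    Coded x = x ≡ ⟨ 0 , ⟨ m , rgt (rgt x) ⟩ ⟩ × P (rgt (rgt x))

    Coded-CE : CE Coded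
    Coded-CE = Decidable⇒CE (≡-Decidable idC (pairC (constC 0) (pairC (constC m) (rgtC #1)))) ×-CE
               CE-∘ P-CE (rgtC #1)

  -- The index of a Σ₁ or Π₁ formula with m quantified variables and
  -- matrices from P.
  matrices : Code
  matrices = enumerator Coded-CE

  matrices-⇔ : ∀ m′ q → ⟨ 0 , ⟨ m′ , q ⟩ ⟩ ∈W matrices ⇔ (m′ ≡ m × P q)
  matrices-⇔ m′ q = mk⇔
    (λ w → let e , p = from (enumerator-⇔ Coded-CE x) w in
      proj₁ (⟨⟩-injective {m′} {q} {m} {rgt (rgt x)}
        (proj₂ (⟨⟩-injective {0} {⟨ m′ , q ⟩} {0} {⟨ m , rgt (rgt x) ⟩} e))) , subst P r p)
    (λ { (refl , p) → to (enumerator-⇔ Coded-CE x)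
      (cong (λ c → ⟨ 0 , ⟨ m , c ⟩ ⟩) (sym r) , subst P (sym r) p) })
    where
    x = ⟨ 0 , ⟨ m′ , q ⟩ ⟩
    r : rgt (rgt x) ≡ q
    r = trans (cong rgt (rgt-⟨⟩ 0 ⟨ m′ , q ⟩)) (rgt-⟨⟩ m′ q)

-- Shifts an assignment by `k` positions, leaving the first `k` variables undefined.
pad : ℕ → ℕ → ℕ
pad zero    e = e
pad (suc k) e = ⟨ 0 , pad k e ⟩

nth-pad : ∀ k e j → nth (pad k e) (k + j) ≡ nth e j
nth-pad zero    e j = refl
nth-pad (suc k) e j = trans (nth-⟨⟩-suc 0 (pad k e) (k + j)) (nth-pad k e j)

nth-pad⁻ : ∀ k e i {y} → nth (pad k e) i ≡ suc y → ∃[ j ] i ≡ k + j × nth e j ≡ suc y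
nth-pad⁻ zero    e i       p = i , refl , p
nth-pad⁻ (suc k) e zero    p = case trans (sym (lft-⟨⟩ 0 (pad k e))) p of λ ()
nth-pad⁻ (suc k) e (suc i) p =
  let j , q , r = nth-pad⁻ k e i (trans (sym (nth-⟨⟩-suc 0 (pad k e) i)) p) in j , cong suc q , r

module _ {X : Set} where

  agree-refl : ∀ {n} (v : Vec X n) i j → toℕ i ≡ toℕ j → lookup v i ≡ lookup v j
  agree-refl v i j e = cong (lookup v) (toℕ-injective e)

  agree-++ : ∀ {m n} (v : Vec X m) (w : Vec X n) i j → toℕ i ≡ toℕ j → lookup v i ≡ lookup (v ++ w) j
  agree-++ (x ∷ v) w zero    zero    e = refl
  agree-++ (x ∷ v) w (suc i) (suc j) e = agree-++ v w i j (suc-injective e)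

  agree-assoc : ∀ {m n} (v : Vec X m) z (w : Vec X n) i j → toℕ i ≡ toℕ j →
                lookup ((v ++ z ∷ []) ++ w) i ≡ lookup (v ++ z ∷ w) j
  agree-assoc []      z w i       j       e = agree-refl (z ∷ w) i j e
  agree-assoc (x ∷ v) z w zero    zero    e = refl
  agree-assoc (x ∷ v) z w (suc i) (suc j) e = agree-assoc v z w i j (suc-injective e)

⌜subst⌝ : ∀ {L m n} (e : m ≡ n) (φ : QF L m) → ⌜ subst (QF L) e φ ⌝ᵠ ≡ ⌜ φ ⌝ᵠ
⌜subst⌝ refl φ = refl

conjunctionCode : ∀ {L n k} → Vec (Term L n) k → ℕ → ℕ
conjunctionCode {L} {n} []  w = ⌜ conjunction {L} {n} [] ⌝ᵠ
conjunctionCode (s ∷ ss)    w = ⟨ 3 , ⟨ ⟨ 0 , ⟨ ⌜ s ⌝ᵗ , lft w ⟩ ⟩ , conjunctionCode ss (rgt w) ⟩ ⟩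

conjunctionCodeC : ∀ {L n k} (ss : Vec (Term L n) k) {f} → Computable f →
                   Computable (λ x → conjunctionCode ss (f x))
conjunctionCodeC []       F = constC _
conjunctionCodeC (s ∷ ss) F =
  pairC (constC 3) (pairC (pairC (constC 0) (pairC (constC ⌜ s ⌝ᵗ) (lftC F))) (conjunctionCodeC ss (rgtC F)))

⌜conjunction⌝ : ∀ {L n k} (ss ts : Vec (Term L n) k) →
                ⌜ conjunction (equations ss ts) ⌝ᵠ ≡ conjunctionCode ss ⌜ ts ⌝ᵗˢ
⌜conjunction⌝ []       []       = refl
⌜conjunction⌝ (s ∷ ss) (t ∷ ts) = cong₂ (λ u φ → ⟨ 3 , ⟨ ⟨ 0 , ⟨ ⌜ s ⌝ᵗ , u ⟩ ⟩ , φ ⟩ ⟩)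
  (sym (lft-⟨⟩ ⌜ t ⌝ᵗ ⌜ ts ⌝ᵗˢ))
  (trans (⌜conjunction⌝ ss ts) (cong (conjunctionCode ss) (sym (rgt-⟨⟩ ⌜ t ⌝ᵗ ⌜ ts ⌝ᵗˢ))))

-- In the matrices the variables are x₁ … xₙ, z, y₁ … yₙ, where z stands
-- for an arbitrary element that is to be generated by x₁ … xₙ.
module ScottSentence (em : {P : Set} → Dec P) {L : Language} (A : ComputableStructure L)
  (hopf : Hopfian (structure A)) {n : ℕ} {a : Vec (Elem A) n} (gen : Generates (structure A) a)
  {ψ : List (Term L n × Term L n)}
  (pres : Presents (structure A) a ψ) (orbit : ComputableSubset A (AutOrbit A a)) where

  open Evaluator A
  open QFEvaluator A
  open Orbit em A hopf
  private
    𝔸 = structure A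
    E = Elem A

  xᵢ yᵢ : Fin n → Fin (n + suc n)
  xᵢ i = i ↑ˡ suc n
  yᵢ i = n ↑ʳ suc i

  xs : Vec (Term L (n + suc n)) n
  xs = vars xᵢ

  lookup-x : ∀ {X : Set} (x : Vec X n) z y i → lookup (x ++ z ∷ y) (xᵢ i) ≡ lookup x i
  lookup-x x z y i = lookup-++ˡ x (z ∷ y) i

  lookup-y : ∀ {X : Set} (x : Vec X n) z y i → lookup (x ++ z ∷ y) (yᵢ i) ≡ lookup y i
  lookup-y x z y i = lookup-++ʳ x (z ∷ y) (suc i)

  toℕ-x : ∀ i → toℕ (xᵢ i) ≡ toℕ i
  toℕ-x i = toℕ-↑ˡ i (suc n)

  toℕ-y : ∀ i → toℕ (yᵢ i) ≡ suc n + toℕ i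
  toℕ-y i = trans (toℕ-↑ʳ n (suc i)) (+-suc n (toℕ i))

  presentation : QF L (n + suc n)
  presentation = conjunction (List.map (λ (s , t) → ren yᵢ s , ren yᵢ t) ψ)

  -- x is not the value at y of terms ts whose value at a lies outside the
  -- orbit of a.
  separation : Vec (Term L n) n → QF L (n + suc n)
  separation ts = not (presentation and conjunction (equations xs (rens yᵢ ts)))

  abstract
    separationCode : ℕ → ℕ
    separationCode w = ⟨ 2 , ⟨ 3 , ⟨ ⌜ presentation ⌝ᵠ , conjunctionCode xs w ⟩ ⟩ ⟩

    separationCodeC : ∀ {f} → Computable f → Computable (λ x → separationCode (f x))
    separationCodeC F =
      pairC (constC 2) (pairC (constC 3) (pairC (constC ⌜ presentation ⌝ᵠ) (conjunctionCodeC xs F)))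

    ⌜separation⌝ : ∀ ts → ⌜ separation ts ⌝ᵠ ≡ separationCode ⌜ rens yᵢ ts ⌝ᵗˢ
    ⌜separation⌝ ts = cong (λ c → ⟨ 2 , ⟨ 3 , ⟨ ⌜ presentation ⌝ᵠ , c ⟩ ⟩ ⟩)
      (⌜conjunction⌝ xs (rens yᵢ ts))

  -- The tuple `a` as the value of y₁ ... yₙ, with x₁ ... xₙ and z undefined, so that a term has a
  -- value only if all its variables are among the y's.
  aᵧ : ℕ
  aᵧ = pad (suc n) (assign a)

  aᵧ-defines : Defines yᵢ aᵧ a
  aᵧ-defines i = trans (cong (nth aᵧ) (toℕ-y i)) (trans (nth-pad (suc n) (assign a) (toℕ i)) (nth-assign a i))

  aᵧ-defines⁻ : ∀ i {y} → nth aᵧ i ≡ suc y → Σ[ j ∈ Fin n ] toℕ (yᵢ j) ≡ i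
  aᵧ-defines⁻ i p = let j , q , r = nth-pad⁻ (suc n) (assign a) i p ; k , s = nth-assign⁻ a j r in
    k , trans (toℕ-y k) (trans (cong (suc n +_) s) (sym q))

  Outside : ℕ → Set
  Outside w = let u = args (evalCode aᵧ) n w in
    ¬ u ≡ 0 × ¬ (∃[ v ] AutOrbit A a v × tuple v ≡ pred u)

  outside-terms : ∀ {w} → Outside w → Σ[ ts ∈ Vec (Term L n) n ]
    ⌜ rens yᵢ ts ⌝ᵗˢ ≡ w × ¬ AutOrbit A a (evals 𝔸 a ts)
  outside-terms {w} (u≢0 , out) with args (evalCode aᵧ) n w in p
  ... | zero  = ⊥-elim (u≢0 refl)
  ... | suc u with args-sound yᵢ aᵧ aᵧ-defines⁻ n w p
  ... | ts , refl = ts , refl , λ o → out (_ , o ,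
    suc-injective (trans (sym (args-complete yᵢ aᵧ {a} aᵧ-defines ts)) p))

  terms-outside : ∀ ts → ¬ AutOrbit A a (evals 𝔸 a ts) → Outside ⌜ rens yᵢ ts ⌝ᵗˢ
  terms-outside ts ¬o rewrite args-complete yᵢ aᵧ {a} aᵧ-defines ts =
    (λ ()) , λ (v , o , e) → ¬o (subst (AutOrbit A a) (tuple-injective e) o)

  -- The first alternative lists the quantifier-free type of `a`, where 2 stands for truth; the
  -- second lists the separations.
  Axiom : ℕ → Set
  Axiom q = satCode (assign a) q ≡ 2 ⊎ (∃[ w ] q ≡ separationCode w × Outside w)

  Axiom-CE : CE Axiom
  Axiom-CE = Decidable⇒CE (≡-Decidable (app₂ satCodeC (constC (assign a)) idC) (constC 2)) ⊎-CE
    ∃-CE {P = λ q w → q ≡ separationCode w × Outside w} (Decidable⇒CE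
      (≡-Decidable #0 (separationCodeC #1)
       ×-Decidable ¬-Decidable (≡-Decidable U (constC 0))
       ×-Decidable ¬-Decidable (decidable (compC (Decidable.testC O) (predC U)) λ x → Decidable.true⇔0 O _)))
    where
    O : Decidable (λ k → ∃[ v ] AutOrbit A a v × tuple v ≡ k)
    O = ComputableSet⇒Decidable orbit
    U : Computable (λ x → args (evalCode aᵧ) n (rgt x))
    U = argsC {r = λ _ → evalCode aᵧ} (computable₂ (app₂ evalCodeC (constC aᵧ) #1)) n #1

  -- The matrices of the Σ₁ formula "z is the value of a term at x, or x violates an axiom". Here ⟨
  -- 0 , n ⟩ is the code of the variable z.
  Matrix : ℕ → Set
  Matrix q = (∃[ t ] ¬ evalCode (assign a) t ≡ 0 × q ≡ ⟨ 0 , ⟨ ⟨ 0 , n ⟩ , t ⟩ ⟩) ⊎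
             (∃[ q′ ] Axiom q′ × q ≡ ⟨ 2 , q′ ⟩)

  Matrix-CE : CE Matrix
  Matrix-CE =
    ∃-CE {P = λ q t → ¬ evalCode (assign a) t ≡ 0 × q ≡ ⟨ 0 , ⟨ ⟨ 0 , n ⟩ , t ⟩ ⟩} (Decidable⇒CE
      (¬-Decidable (≡-Decidable (app₂ evalCodeC (constC (assign a)) #1) (constC 0)) ×-Decidable
       ≡-Decidable #0 (pairC (constC 0) (pairC (constC ⟨ 0 , n ⟩) #1)))) ⊎-CE
    ∃-CE {P = λ q q′ → Axiom q′ × q ≡ ⟨ 2 , q′ ⟩}
      (CE-∘ Axiom-CE #1 ×-CE Decidable⇒CE (≡-Decidable #0 (pairC (constC 2) #1)))

  -- The slot of `z` gives the axioms the same variables as the matrices of `generated`, among which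
  -- their negations occur.
  ModelAt : (B : Structure L) → Vec (Carrier B) n → Carrier B → Set
  ModelAt B x z = ∀ (φ : QF L (n + suc n)) (y : Vec (Carrier B) n) → Axiom ⌜ φ ⌝ᵠ → SatQF B (x ++ z ∷ y) φ

  SatQF-separation : ∀ B x z y ts → SatQF B (x ++ z ∷ y) (separation ts) ⇔
                     (SatEquations B y ψ → ¬ x ≡ evals B y ts)
  SatQF-separation B x z y ts = mk⇔
    (λ s p e → s (to c₁ (from c₂ p) , to c₃ (from c₄ (trans ex (trans e (sym ey))))))
    (λ f (p , q) → f (to c₂ (from c₁ p)) (trans (sym ex) (trans (to c₄ (from c₃ q)) ey)))
    where
    w = x ++ z ∷ y
    c₁ = SatQF-conjunction B {v = w} (List.map (λ (s , t) → ren yᵢ s , ren yᵢ t) ψ)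
    c₂ = SatEquations-sub B {w = w} {v = y} (lookup-y x z y) ψ
    c₃ = SatQF-conjunction B {v = w} (equations xs (rens yᵢ ts))
    c₄ = SatEquations-equations B {v = w} xs (rens yᵢ ts)
    ex : evals B w xs ≡ x
    ex = evals-vars B xᵢ (lookup-x x z y)
    ey : evals B w (rens yᵢ ts) ≡ evals B y ts
    ey = evals-subs B (lookup-y x z y) ts

  -- The endomorphism `g` taking `a` to `y` has the generating tuple `b` in its image, hence is an
  -- automorphism; its inverse takes `b` to the value of `ts` at `a`.
  evals-orbit : ∀ {b y} → AutOrbit A a b → SatEquations 𝔸 y ψ → ∀ ts → b ≡ evals 𝔸 y ts →
                AutOrbit A a (evals 𝔸 a ts)
  evals-orbit {b} {y} (h , iso , refl) s ts e with proj₂ pres y s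
  ... | g , refl = onto-orbit (invHom g iso′ ∘ʰ h)
    (trans (map-∘ (inv g iso′) ⟦ h ⟧ a) (trans (cong (map (inv g iso′)) b≡) (inv-map g iso′ (evals 𝔸 a ts))))
    λ x → inv h iso (⟦ g ⟧ x) , trans (cong (inv g iso′) (⟦⟧-inv h iso _)) (proj₁ iso′ (⟦⟧-inv g iso′ _))
    where
    b≡ : b ≡ map ⟦ g ⟧ (evals 𝔸 a ts)
    b≡ = trans e (sym (evals-hom g a ts))
    iso′ : IsIso g
    iso′ = hopf g (surjective g (generating-image 𝔸 (generates-image 𝔸 gen h iso) g (sym b≡)))

  orbit⇒model : ∀ b z → AutOrbit A a b → ModelAt 𝔸 b z
  orbit⇒model b z (h , iso , refl) φ y (inj₁ e) with satCode-sound a ⌜ φ ⌝ᵠ e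
  ... | γ , q = to (SatQF-⌜⌝ 𝔸 (agree-++ b (z ∷ y)) γ φ q)
    (to (SatQF-iso h iso a γ) (from (truth-2 (satCode-complete a γ)) (trans (cong (satCode (assign a)) q) e)))
  orbit⇒model b z o φ y (inj₂ (w , q , out)) with outside-terms out
  ... | ts , refl , ¬o = to (SatQF-⌜⌝ 𝔸 (agree-refl (b ++ z ∷ y)) (separation ts) φ (trans (⌜separation⌝ ts) (sym q)))
    (from (SatQF-separation 𝔸 b z y ts) λ s e → ¬o (evals-orbit o s ts e))

  model⇒orbit : ∀ b z → ModelAt 𝔸 b z → AutOrbit A a b
  model⇒orbit b z m with em {AutOrbit A a b}
  ... | yes o = o
  ... | no ¬o = ⊥-elim (to (SatQF-separation 𝔸 b z a ts)
    (m (separation ts) a (inj₂ (_ , ⌜separation⌝ ts ,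
      terms-outside ts λ o → ¬o (subst (AutOrbit A a) (evals-terms 𝔸 gen b) o))))
    (proj₁ pres) (sym (evals-terms 𝔸 gen b)))
    where
    ts = terms 𝔸 gen b

  module Embedding (B : Structure L) (x : Vec (Carrier B) n) (z : Carrier B) (model : ModelAt B x z) where
    private
      -- The formulas used here come from the type of `a` and mention only the x's, so any values
      -- serve for the y's.
      y = Vec.replicate n z

    eval-x : ∀ t → eval B (x ++ z ∷ y) (ren xᵢ t) ≡ eval B x t
    eval-x = eval-sub B (lookup-x x z y)

    -- The type of `a` contains each equation or its negation, so equations are both preserved and
    -- reflected.
    diagram : ∀ s t → SatQF 𝔸 a (s ≐ t) ⇔ SatQF B x (s ≐ t)
    diagram s t = mk⇔
      (λ e → trans (sym (eval-x s)) (trans (model (ren xᵢ s ≐ ren xᵢ t) y (inj₁ (holds (s ≐ t) e code-≡))) (eval-x t)))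
      (λ e → case em of λ
        { (yes e′) → e′
        ; (no ¬e)  → ⊥-elim (model (not (ren xᵢ s ≐ ren xᵢ t)) y
            (inj₁ (holds (not (s ≐ t)) ¬e (cong ⟨ 2 ,_⟩ code-≡))) (trans (eval-x s) (trans e (sym (eval-x t))))) })
      where
      holds : ∀ γ → SatQF 𝔸 a γ → ∀ {q} → q ≡ ⌜ γ ⌝ᵠ → satCode (assign a) q ≡ 2
      holds γ s refl = to (truth-2 (satCode-complete a γ)) s
      code-≡ : ⌜ ren xᵢ s ≐ ren xᵢ t ⌝ᵠ ≡ ⌜ s ≐ t ⌝ᵠ
      code-≡ = cong₂ (λ c d → ⟨ 0 , ⟨ c , d ⟩ ⟩) (⌜ren⌝ xᵢ toℕ-x s) (⌜ren⌝ xᵢ toℕ-x t)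

    embed : E → Carrier B
    embed v = eval B x (proj₁ (gen v))

    embed-eval : ∀ t → embed (eval 𝔸 a t) ≡ eval B x t
    embed-eval t = to (diagram (proj₁ (gen (eval 𝔸 a t))) t) (proj₂ (gen (eval 𝔸 a t)))

    evals-map-embed : ∀ {k} (v : Vec E k) → evals B x (terms 𝔸 gen v) ≡ map embed v
    evals-map-embed []      = refl
    evals-map-embed (u ∷ v) = cong (embed u ∷_) (evals-map-embed v)

    embedding : Hom 𝔸 B
    embedding = record
      { ⟦_⟧  = embed
      ; homo = λ f v → trans (cong (embed ∘ op A f) (sym (evals-terms 𝔸 gen v)))
          (trans (embed-eval (app f (terms 𝔸 gen v))) (cong (fun B f) (evals-map-embed v)))
      }

    embedding-iso : (∀ b → ∃[ t ] eval B x t ≡ b) → IsIso embedding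
    embedding-iso g =
      (λ {u} {v} e → trans (sym (proj₂ (gen u)))
        (trans (from (diagram (proj₁ (gen u)) (proj₁ (gen v))) e) (proj₂ (gen v)))) ,
      surjective embedding (λ b → let t , e = g b in eval 𝔸 a t , trans (embed-eval t) e)

  defined-term : ∀ c → ¬ evalCode (assign a) c ≡ 0 → Σ[ t ∈ Term L n ] ⌜ t ⌝ᵗ ≡ c
  defined-term c valid = go (evalCode (assign a) c) refl
    where
    go : ∀ y → evalCode (assign a) c ≡ y → Σ[ t ∈ Term L n ] ⌜ t ⌝ᵗ ≡ c
    go zero    p = ⊥-elim (valid p)
    go (suc y) p = evalCode-term a c p

  -- The Scott sentence and its models

  θᶜ generatedᶜ : Code
  θᶜ         = matrices (suc n) Axiom-CE
  generatedᶜ = matrices n Matrix-CE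

  θ : Formula L π 1 n
  θ = ⋀∀ θᶜ

  generated : Formula L σ 1 (n + 1)
  generated = ⋁∃ generatedᶜ

  sentence : dΣ₂-Sentence L
  sentence = ⋁∃ (singleton (rank₁ n θᶜ)) , ⋀∀ (singleton (rank₁ (n + 1) generatedᶜ))

  module _ (B : Structure L) where

    sat-θ-⇔ : ∀ x → Sat B θ x ⇔ (∀ z → ModelAt B x z)
    sat-θ-⇔ x = mk⇔
      (λ { (sat-⋀∀ s) z φ y ax →
        case s (qf φ) (s≤s z≤n) (from (matrices-⇔ (suc n) Axiom-CE (suc n) ⌜ φ ⌝ᵠ) (refl , ax)) (z ∷ y)
        of λ { (sat-qf p) → p } })
      (λ m → sat-⋀∀ λ
        { {m = k} (qf φ) _ w ys → instantiate m φ (to (matrices-⇔ (suc n) Axiom-CE k ⌜ φ ⌝ᵠ) w) ys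
        ; (⋁∃ _) (s≤s ()) w ys })
      where
      instantiate : (∀ z → ModelAt B x z) → ∀ {m} (φ : QF L (n + m)) → m ≡ suc n × Axiom ⌜ φ ⌝ᵠ →
                    (ys : Vec (Carrier B) m) → Sat B (qf {κ = σ} φ) (x ++ ys)
      instantiate m φ (refl , ax) (z ∷ y) = sat-qf (m z φ y ax)

    -- Reading formulas in the variables (x , z) , y as formulas in x , (z , y).
    reassociate : QF L (n + 1 + n) → QF L (n + suc n)
    reassociate = subst (QF L) (+-assoc n 1 n)

    reassociate⁻ : QF L (n + suc n) → QF L (n + 1 + n)
    reassociate⁻ = subst (QF L) (sym (+-assoc n 1 n))

    SatQF-assoc : ∀ x z y (φ : QF L (n + 1 + n)) (χ : QF L (n + suc n)) → ⌜ φ ⌝ᵠ ≡ ⌜ χ ⌝ᵠ →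
                  SatQF B ((x ++ z ∷ []) ++ y) φ ⇔ SatQF B (x ++ z ∷ y) χ
    SatQF-assoc x z y = SatQF-⌜⌝ B (agree-assoc x z y)

    isTerm : Term L n → QF L (n + suc n)
    isTerm t = var (n ↑ʳ zero) ≐ ren xᵢ t

    ⌜isTerm⌝ : ∀ t → ⌜ isTerm t ⌝ᵠ ≡ ⟨ 0 , ⟨ ⟨ 0 , n ⟩ , ⌜ t ⌝ᵗ ⟩ ⟩
    ⌜isTerm⌝ t = cong₂ (λ i c → ⟨ 0 , ⟨ ⟨ 0 , i ⟩ , c ⟩ ⟩)
      (trans (toℕ-↑ʳ n zero) (+-identityʳ n)) (⌜ren⌝ xᵢ toℕ-x t)

    SatQF-isTerm : ∀ x z y t → SatQF B (x ++ z ∷ y) (isTerm t) ⇔ eval B x t ≡ z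
    SatQF-isTerm x z y t = mk⇔
      (λ e → sym (trans (sym z-lookup) (trans e x-eval)))
      (λ e → trans z-lookup (trans (sym e) (sym x-eval)))
      where
      z-lookup : lookup (x ++ z ∷ y) (n ↑ʳ zero) ≡ z
      z-lookup = lookup-++ʳ x (z ∷ y) zero
      x-eval : eval B (x ++ z ∷ y) (ren xᵢ t) ≡ eval B x t
      x-eval = eval-sub B (lookup-x x z y) t

    not⁻ : ∀ {m} (φ : QF L m) {q} → ⌜ φ ⌝ᵠ ≡ ⟨ 2 , q ⟩ → Σ[ χ ∈ QF L m ] φ ≡ not χ × ⌜ χ ⌝ᵠ ≡ q
    not⁻ φ {q} e = tag φ (⟨⟩-injective {tagᵠ φ} {bodyᵠ φ} {2} {q} (trans (sym (⌜⌝ᵠ-tag φ)) e))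
      where
      tag : ∀ {m} (φ : QF L m) {q} → tagᵠ φ ≡ 2 × bodyᵠ φ ≡ q → Σ[ χ ∈ QF L m ] φ ≡ not χ × ⌜ χ ⌝ᵠ ≡ q
      tag (not χ) (_ , e) = χ , refl , e

    -- As `x` satisfies the axioms, no negated axiom can be the true matrix; what remains is an
    -- equation between z and a term.
    sat-generated : ∀ x z → ModelAt B x z → Sat B generated (x ++ z ∷ []) → ∃[ t ] eval B x t ≡ z
    sat-generated x z model (sat-⋁∃ (⋀∀ _) (s≤s ()) w ys s)
    sat-generated x z model (sat-⋁∃ {m = m} (qf φ) _ w ys (sat-qf s)) =
      read φ (to (matrices-⇔ n Matrix-CE m ⌜ φ ⌝ᵠ) w) ys s
      where
      isTermᶜ : ∀ (φ : QF L (n + 1 + n)) ys → SatQF B ((x ++ z ∷ []) ++ ys) φ →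
        ∀ t → ⌜ φ ⌝ᵠ ≡ ⌜ isTerm t ⌝ᵠ → eval B x t ≡ z
      isTermᶜ φ ys s t e = to (SatQF-isTerm x z ys t) (to (SatQF-assoc x z ys φ (isTerm t) e) s)
      notᶜ : ∀ (χ : QF L (n + 1 + n)) ys → ¬ SatQF B ((x ++ z ∷ []) ++ ys) χ → ¬ Axiom ⌜ χ ⌝ᵠ
      notᶜ χ ys s ax = s (from (SatQF-assoc x z ys χ (reassociate χ) (sym e))
        (model (reassociate χ) ys (subst Axiom (sym e) ax)))
        where e = ⌜subst⌝ (+-assoc n 1 n) χ
      isNotᶜ : ∀ (φ : QF L (n + 1 + n)) ys → SatQF B ((x ++ z ∷ []) ++ ys) φ → ∀ {q} → Axiom q →
        ¬ (Σ[ χ ∈ QF L (n + 1 + n) ] φ ≡ not χ × ⌜ χ ⌝ᵠ ≡ q)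
      isNotᶜ φ ys s ax (χ , refl , e) = notᶜ χ ys s (subst Axiom (sym e) ax)
      read : ∀ {m} (φ : QF L (n + 1 + m)) → m ≡ n × Matrix ⌜ φ ⌝ᵠ → (ys : Vec (Carrier B) m) →
             SatQF B ((x ++ z ∷ []) ++ ys) φ → ∃[ t ] eval B x t ≡ z
      read φ (refl , inj₁ (c , valid , e)) ys s = let t , e′ = defined-term c valid in
        t , isTermᶜ φ ys s t (trans e (trans (cong (λ c → ⟨ 0 , ⟨ ⟨ 0 , n ⟩ , c ⟩ ⟩) (sym e′)) (sym (⌜isTerm⌝ t))))
      read φ (refl , inj₂ (q , ax , e)) ys s = ⊥-elim (isNotᶜ φ ys s ax (not⁻ φ e))

    intro-generated : ∀ x z (φ : QF L (n + 1 + n)) → Matrix ⌜ φ ⌝ᵠ → ∀ y →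
      SatQF B ((x ++ z ∷ []) ++ y) φ → Sat B generated (x ++ z ∷ [])
    intro-generated x z φ m y s = sat-⋁∃ (qf φ) (s≤s z≤n)
      (from (matrices-⇔ n Matrix-CE n ⌜ φ ⌝ᵠ) (refl , m)) y (sat-qf s)

    generated-by : ∀ x z t → eval B x t ≡ z → Sat B generated (x ++ z ∷ [])
    generated-by x z t e = intro-generated x z φ
      (inj₁ (⌜ t ⌝ᵗ , (λ p → case trans (sym p) (evalCode-⌜⌝ a t) of λ ()) , trans same (⌜isTerm⌝ t)))
      y (from (SatQF-assoc x z y φ (isTerm t) same) (from (SatQF-isTerm x z y t) e))
      where
      φ = reassociate⁻ (isTerm t)
      y = Vec.replicate n z
      same = ⌜subst⌝ (sym (+-assoc n 1 n)) (isTerm t)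

    generated-fails : ∀ x z (φ : QF L (n + suc n)) y → Axiom ⌜ φ ⌝ᵠ → ¬ SatQF B (x ++ z ∷ y) φ →
                      Sat B generated (x ++ z ∷ [])
    generated-fails x z φ y ax ¬s = intro-generated x z (not χ) (inj₂ (⌜ φ ⌝ᵠ , ax , cong ⟨ 2 ,_⟩ same))
      y λ s → ¬s (to (SatQF-assoc x z y χ φ same) s)
      where
      χ = reassociate⁻ φ
      same = ⌜subst⌝ (sym (+-assoc n 1 n)) φ

    -- A tuple satisfying `θ` gives an embedding of A, and `generated` makes it onto.
    model⇒≅ : (∃[ x ] Sat B θ x) → (∀ ys → Sat B generated ys) → 𝔸 ≅ B
    model⇒≅ (x , t) g = embedding , embedding-iso λ z →
      sat-generated x z (to (sat-θ-⇔ x) t z) (g (x ++ z ∷ []))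
      where open Embedding B x (inhabited B) (to (sat-θ-⇔ x) t (inhabited B))

  -- Either some axiom fails, which provides a true negated matrix, or `x` lies in the orbit of `a`
  -- and therefore generates A.
  generated-at : ∀ x z → Sat 𝔸 generated (x ++ z ∷ [])
  generated-at x z = decide em
    where
    Fails : Set
    Fails = Σ[ φ ∈ QF L (n + suc n) ] Σ[ y ∈ Vec E n ] Axiom ⌜ φ ⌝ᵠ × ¬ SatQF 𝔸 (x ++ z ∷ y) φ
    model : ¬ Fails → ModelAt 𝔸 x z
    model none φ y ax = holds em
      where
      holds : Dec (SatQF 𝔸 (x ++ z ∷ y) φ) → SatQF 𝔸 (x ++ z ∷ y) φ
      holds (yes s) = s
      holds (no ¬s) = ⊥-elim (none (φ , y , ax , ¬s))
    by-orbit : AutOrbit A a x → Sat 𝔸 generated (x ++ z ∷ [])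
    by-orbit (h , iso , e) =
      let t , p = subst (Generates 𝔸) e (generates-image 𝔸 gen h iso) z in generated-by 𝔸 x z t p
    decide : Dec Fails → Sat 𝔸 generated (x ++ z ∷ [])
    decide (yes (φ , y , ax , ¬s)) = generated-fails 𝔸 x z φ y ax ¬s
    decide (no none)               = by-orbit (model⇒orbit x z (model none))

  𝔸⊨sentence : 𝔸 ⊨ sentence
  𝔸⊨sentence =
    from (sat-∃∀ 𝔸 n θᶜ) (a , from (sat-θ-⇔ 𝔸 a) λ z → orbit⇒model a z
      (proj₁ ≅-refl , proj₂ ≅-refl , map-id a)) ,
    from (sat-∀∃ 𝔸 (n + 1) generatedᶜ) λ ys → split ys (Vec.splitAt n ys)
    where
    split : ∀ ys → (∃[ x ] ∃[ w ] ys ≡ x ++ w) → Sat 𝔸 generated ys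
    split ys (x , z ∷ [] , e) = subst (Sat 𝔸 generated) (sym e) (generated-at x z)

  scottSentence : HasComputable-dΣ₂-ScottSentence 𝔸
  scottSentence = sentence , λ B _ → mk⇔
    (λ (s , g) → model⇒≅ B (to (sat-∃∀ B n θᶜ) s) (to (sat-∀∃ B (n + 1) generatedᶜ) g))
    λ (h , iso) → Sat-iso h iso (proj₁ 𝔸⊨sentence) , Sat-iso h iso (proj₂ 𝔸⊨sentence)

theorem1p4 : Classical →
    ∀ {k} (L : Language) (K : Structure L → Set k) (A : ComputableStructure L) →
    K (structure A) →
    Hopfian (structure A) →
    FinitelyPresentedIn K (structure A) →
    HasComputable-dΣ₂-ScottSentence (structure A) ⇔ DecidableWeakWhitehead A
theorem1p4 classical L K A A∈K hopf (n , a , ψ , gen , sat , univ) = mk⇔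
  (scott⇒whitehead gen pres)
  (λ whitehead → ScottSentence.scottSentence em A hopf gen pres (whitehead a gen))
  where
  em : {P : Set} → Dec P
  em = classical 0ℓ
  pres : Presents (structure A) a ψ
  pres = sat , univ (structure A) A∈K
  open Orbit em A hopf
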